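{- Let $n>3$. Consider two-state models (states $0,1$) and sequences of length $n$ starting with state $0$. (1) Up to equivalence, there are exactly seven min-weight sequences of length $n$ starting with state $0$. If $n=2m$ they are $A=0^{2m+1}$, $B=0^{2m}1$, $C=0(01)^m$, $D=(01)^m1$, $E=(01)^m0$, $F=01^{2m-1}0$, $G=01^{2m}$; if $n=2m+1$ they are $A=0^{2m+2}$, $B=0^{2m+1}1$, $C=0(01)^m0$, $D=(01)^m10$, $E=(01)^{m+1}$, $F=01^{2m}0$, $G=01^{2m+1}$. (2) The convex hull in $\mathbb R^4$ of the points $(x_{00},x_{01},x_{10},x_{11})$ of all sequences of length $n$ starting with $0$ is a three-dimensional polytope with seven vertices (the points of the seven sequences above), 12 edges and seven two-dimensional faces. (3) Among these seven, the ones that are Viterbi sequences for two-state Markov chains are exactly $A,D,E,G$ if $n$ is even, and exactly $A,C,E,G$ if $n$ is odd.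
   Context: Here $i^r$ means state $i$ repeated $r$ times and $(01)^m$ means the block $01$ repeated $m$ times. A sequence of length $n$ is a sequence of states $s_0s_1\cdots s_n$ (with $n$ transitions). Two sequences of the same length are equivalent if they have the same initial state and the same multiset of transitions $(s_{t-1},s_t)$. For a sequence, $x_{ij}$ denotes the number of its transitions from $i$ to $j$. Min-weight sequences starting with $0$: a weighting is a vector $(w_{00},w_{01},w_{10},w_{11})\in\mathbb R^4$ (arbitrary real weights), the weight of a sequence starting with $0$ is $\sum_{t=1}^n w_{s_{t-1}s_t}$, and a minimum weight path of length $n$ is a sequence of length $n$ starting with $0$ of minimal weight. Two weightings are in the same region if they have the same set of minimum weight paths of length $n$; a min-weight sequence is a minimum weight path for some region of positive Lebesgue measure. Viterbi sequences: a two-state Markov chain has an initial distribution $(\pi_0,\pi_1)$ and a stochastic matrix $(p_{ij})$; the space of these is a product of three 1-simplices with Lebesgue measure. $\Pr[s_0\cdots s_n]=\pi_{s_0}\prod_{t=1}^n p_{s_{t-1}s_t}$. A Viterbi path of length $n$ of a chain is a sequence of length $n$ (any initial state) of maximal probability. Two chains are in the same region iff they have the same set of Viterbi paths of length $n$, and a Viterbi sequence is a Viterbi path for some region of positive measure. -}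

module Defs where

open import Level using (Level; 0ℓ; _⊔_)
open import Algebra.Bundles using (CommutativeRing)
import Algebra.Definitions.RawMonoid as RawMonoidOps
open import Data.Fin using (Fin; zero; suc; combine; toℕ)
import Data.Fin.Properties as Fin
open import Data.List using (List; []; _∷_; _++_; map; foldr; filter; length; head; replicate; concat)
open import Data.List.Relation.Binary.Permutation.Propositional using (_↭_)
open import Data.Maybe using (just)
open import Data.Nat as ℕ using (ℕ)
open import Data.Product using (_×_; _,_; ∃)
open import Data.Product.Properties using (≡-dec)
open import Data.Vec.Functional as Vector using (Vector)
open import Data.Vec.Functional.Relation.Binary.Pointwise using (Pointwise)
open import Function.Bundles using (_⇔_)
open import Relation.Binary.Core using (Rel)
open import Relation.Binary.Structures using (IsTotalOrder)
open import Relation.Binary.PropositionalEquality using (_≡_)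
open import Relation.Nullary using (¬_)
open import Relation.Unary using (Pred; _≐_)

-- These axioms determine the real numbers up to unique isomorphism.  Equality
-- is the ring's setoid equality.
record CompleteOrderedField : Set₁ where
  infix 4 _≤_ _<_
  field
    commutativeRing : CommutativeRing 0ℓ 0ℓ

  open CommutativeRing commutativeRing public

  field
    0≉1          : ¬ 0# ≈ 1#
    inverse      : ∀ x → ¬ x ≈ 0# → ∃ λ y → x * y ≈ 1#
    _≤_          : Rel Carrier 0ℓ
    isTotalOrder : IsTotalOrder _≈_ _≤_
    +-monoˡ-≤    : ∀ z {x y} → x ≤ y → x + z ≤ y + z
    *-nonneg     : ∀ {x y} → 0# ≤ x → 0# ≤ y → 0# ≤ x * y

  UpperBound : Pred Carrier 0ℓ → Pred Carrier 0ℓ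
  UpperBound S b = ∀ x → S x → x ≤ b

  field
    supremum : (S : Pred Carrier 0ℓ) → ∃ S → ∃ (UpperBound S) →
               ∃ λ b → UpperBound S b × (∀ c → UpperBound S c → b ≤ c)

  _<_ : Rel Carrier 0ℓ
  x < y = x ≤ y × ¬ x ≈ y

-- The family f lists the elements satisfying P, each exactly once up to _~_.
record Enumerates {a p r : Level} {X : Set a} {k : ℕ}
                  (_~_ : Rel X r) (P : Pred X p) (f : Fin k → X) : Set (a ⊔ p ⊔ r) where
  field
    sound    : ∀ i → P (f i)
    distinct : ∀ i j → f i ~ f j → i ≡ j
    complete : ∀ x → P x → ∃ λ i → x ~ f i

State : Set
State = Fin 2

pattern 𝟎 = zero
pattern 𝟏 = suc zero

-- Length counts transitions, not states.
HasLength : ℕ → Pred (List State) 0ℓ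
HasLength n s = length s ≡ ℕ.suc n

StartsWith0 : Pred (List State) 0ℓ
StartsWith0 s = head s ≡ just 𝟎

PathFrom0 : ℕ → Pred (List State) 0ℓ
PathFrom0 n s = HasLength n s × StartsWith0 s

transitions : List State → List (State × State)
transitions []          = []
transitions (_ ∷ [])    = []
transitions (i ∷ j ∷ s) = (i , j) ∷ transitions (j ∷ s)

x : State → State → List State → ℕ
x i j s = length (filter (≡-dec Fin._≟_ Fin._≟_ (i , j)) (transitions s))

-- Used only on sequences of equal length; _↭_ is equality of multisets.
Equivalent : Rel (List State) 0ℓ
Equivalent s t = head s ≡ head t × transitions s ↭ transitions t

pattern A = zero
pattern B = suc zero
pattern C = suc (suc zero)
pattern D = suc (suc (suc zero))
pattern E = suc (suc (suc (suc zero)))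
pattern F = suc (suc (suc (suc (suc zero))))
pattern G = suc (suc (suc (suc (suc (suc zero)))))

infix 8 _^_ [01]^_

_^_ : State → ℕ → List State
i ^ r = replicate r i

[01]^_ : ℕ → List State
[01]^ m = concat (replicate m (𝟎 ∷ 𝟏 ∷ []))

-- For n = 2m.
evenSeq : ℕ → Fin 7 → List State
evenSeq m A = 𝟎 ^ (2 ℕ.* m ℕ.+ 1)
evenSeq m B = 𝟎 ^ (2 ℕ.* m) ++ 𝟏 ∷ []
evenSeq m C = 𝟎 ∷ [01]^ m
evenSeq m D = [01]^ m ++ 𝟏 ∷ []
evenSeq m E = [01]^ m ++ 𝟎 ∷ []
evenSeq m F = 𝟎 ∷ 𝟏 ^ (2 ℕ.* m ℕ.∸ 1) ++ 𝟎 ∷ []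
evenSeq m G = 𝟎 ∷ 𝟏 ^ (2 ℕ.* m)

-- For n = 2m + 1.
oddSeq : ℕ → Fin 7 → List State
oddSeq m A = 𝟎 ^ (2 ℕ.* m ℕ.+ 2)
oddSeq m B = 𝟎 ^ (2 ℕ.* m ℕ.+ 1) ++ 𝟏 ∷ []
oddSeq m C = 𝟎 ∷ [01]^ m ++ 𝟎 ∷ []
oddSeq m D = [01]^ m ++ 𝟏 ∷ 𝟎 ∷ []
oddSeq m E = [01]^ (m ℕ.+ 1)
oddSeq m F = 𝟎 ∷ 𝟏 ^ (2 ℕ.* m) ++ 𝟎 ∷ []
oddSeq m G = 𝟎 ∷ 𝟏 ^ (2 ℕ.* m ℕ.+ 1)

module Over (ℝ : CompleteOrderedField) where

  open CompleteOrderedField ℝ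
  open RawMonoidOps +-rawMonoid using (sum) renaming (_×_ to _·_)
  open RawMonoidOps *-rawMonoid using () renaming (sum to product)

  infix 4 _≋_

  ℝ^ : ℕ → Set
  ℝ^ d = Vector Carrier d

  _≋_ : ∀ {d} → Rel (ℝ^ d) 0ℓ
  _≋_ = Pointwise _≈_

  record Box (d : ℕ) : Set where
    field
      lower upper : ℝ^ d
      lower≤upper : ∀ i → lower i ≤ upper i

    volume : Carrier
    volume = product (λ i → upper i - lower i)

    Contains : Pred (ℝ^ d) 0ℓ
    Contains v = ∀ i → lower i ≤ v i × v i ≤ upper i

  -- The total volume of the cover, bounded through its partial sums.
  CoveredWithin : ∀ {d} → Pred (ℝ^ d) 0ℓ → Pred Carrier 0ℓ
  CoveredWithin {d} S t = ∃ λ (box : ℕ → Box d) →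
    (∀ v → S v → ∃ λ k → Box.Contains (box k) v) ×
    (∀ N → sum {N} (λ k → Box.volume (box (toℕ k))) ≤ t)

  -- The Lebesgue outer measure, i.e. the infimum (possibly ∞) of all t with
  -- CoveredWithin S t, is positive.  On measurable sets, such as all the
  -- regions below, outer measure is Lebesgue measure.
  PositiveMeasure : ∀ {d} → Pred (ℝ^ d) 0ℓ → Set
  PositiveMeasure S = ∃ λ ε → 0# < ε × (∀ t → CoveredWithin S t → ε ≤ t)

  -- (w₀₀ , w₀₁ , w₁₀ , w₁₁); combine i j is the position of w_ij.
  Weighting : Set
  Weighting = ℝ^ 4

  weight : Weighting → List State → Carrier
  weight w s = foldr _+_ 0# (map (λ (i , j) → w (combine i j)) (transitions s))

  MinWeightPath : ℕ → Weighting → Pred (List State) 0ℓ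
  MinWeightPath n w s = PathFrom0 n s × (∀ t → PathFrom0 n t → weight w s ≤ weight w t)

  WeightRegion : ℕ → Weighting → Pred Weighting 0ℓ
  WeightRegion n w w′ = ∀ s → MinWeightPath n w s ⇔ MinWeightPath n w′ s

  MinWeightSequence : ℕ → Pred (List State) 0ℓ
  MinWeightSequence n s = ∃ λ w → PositiveMeasure (WeightRegion n w) × MinWeightPath n w s

  record MarkovChain : Set where
    field
      π        : State → Carrier
      p        : State → State → Carrier
      π-nonneg : ∀ i → 0# ≤ π i
      p-nonneg : ∀ i j → 0# ≤ p i j
      π-sum    : π 𝟎 + π 𝟏 ≈ 1#
      p-sum    : ∀ i → p i 𝟎 + p i 𝟏 ≈ 1#

    probability : List State → Carrier
    probability []      = 1#
    probability (i ∷ s) = π i * foldr _*_ 1# (map (λ (j , k) → p j k) (transitions (i ∷ s)))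

    -- Each 1-simplex {(a , b) : a , b ≥ 0, a + b = 1} carries the Lebesgue
    -- measure of its coordinate a (any other normalisation differs by a
    -- positive constant factor).
    coordinates : ℝ^ 3
    coordinates = π 𝟎 Vector.∷ p 𝟎 𝟎 Vector.∷ p 𝟏 𝟎 Vector.∷ Vector.[]

  open MarkovChain using (probability; coordinates)

  ViterbiPath : ℕ → MarkovChain → Pred (List State) 0ℓ
  ViterbiPath n M s =
    HasLength n s × (∀ t → HasLength n t → probability M t ≤ probability M s)

  SameViterbiPaths : ℕ → Rel MarkovChain 0ℓ
  SameViterbiPaths n M M′ = ∀ s → ViterbiPath n M s ⇔ ViterbiPath n M′ s

  ChainRegion : ℕ → MarkovChain → Pred (ℝ^ 3) 0ℓ
  ChainRegion n M v = ∃ λ M′ → coordinates M′ ≋ v × SameViterbiPaths n M M′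

  ViterbiSequence : ℕ → Pred (List State) 0ℓ
  ViterbiSequence n s = ∃ λ M → PositiveMeasure (ChainRegion n M) × ViterbiPath n M s

  _∙_ : ∀ {d} → ℝ^ d → ℝ^ d → Carrier
  c ∙ v = sum (λ i → c i * v i)

  combination : ∀ {d k} → ℝ^ k → (Fin k → ℝ^ d) → ℝ^ d
  combination c v j = sum (λ i → c i * v i j)

  ConvexHull : ∀ {d} → Pred (ℝ^ d) 0ℓ → Pred (ℝ^ d) 0ℓ
  ConvexHull {d} S v =
    ∃ λ (k : ℕ) → ∃ λ (c : ℝ^ k) → ∃ λ (u : Fin k → ℝ^ d) →
      (∀ i → S (u i)) × (∀ i → 0# ≤ c i) × sum c ≈ 1# × v ≋ combination c u

  IsPolytope : ∀ {d} → Pred (ℝ^ d) 0ℓ → Set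
  IsPolytope {d} K = ∃ λ (k : ℕ) → ∃ λ (u : Fin k → ℝ^ d) →
    K ≐ ConvexHull (λ v → ∃ λ i → v ≋ u i)

  AffinelyIndependent : ∀ {d k} → (Fin k → ℝ^ d) → Set
  AffinelyIndependent u =
    ∀ c → sum c ≈ 0# → combination c u ≋ (λ _ → 0#) → ∀ i → c i ≈ 0#

  ContainsIndependent : ∀ {d} → ℕ → Pred (ℝ^ d) 0ℓ → Set
  ContainsIndependent {d} k K =
    ∃ λ (u : Fin k → ℝ^ d) → (∀ i → K (u i)) × AffinelyIndependent u

  HasDimension : ∀ {d} → Pred (ℝ^ d) 0ℓ → ℕ → Set
  HasDimension K k =
    ContainsIndependent (ℕ.suc k) K × ¬ ContainsIndependent (ℕ.suc (ℕ.suc k)) K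

  -- Faces include the empty set and K itself; neither has dimension 0, 1 or 2
  -- when K is three-dimensional.
  IsFace : ∀ {d} → Pred (ℝ^ d) 0ℓ → Pred (Pred (ℝ^ d) 0ℓ) 0ℓ
  IsFace K face = ∃ λ c → ∃ λ b →
    (∀ v → K v → c ∙ v ≤ b) × face ≐ (λ v → K v × c ∙ v ≈ b)

  FaceOfDimension : ∀ {d} → ℕ → Pred (ℝ^ d) 0ℓ → Pred (Pred (ℝ^ d) 0ℓ) 0ℓ
  FaceOfDimension k K face = IsFace K face × HasDimension face k

  IsVertex : ∀ {d} → Pred (ℝ^ d) 0ℓ → Pred (ℝ^ d) 0ℓ
  IsVertex K v = IsFace K (_≋ v)

  NumberOfFaces : ∀ {d} → Pred (ℝ^ d) 0ℓ → ℕ → ℕ → Set₁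
  NumberOfFaces {d} K k N = ∃ λ (f : Fin N → Pred (ℝ^ d) 0ℓ) →
    Enumerates _≐_ (FaceOfDimension k K) f

  point : List State → ℝ^ 4
  point s = (x 𝟎 𝟎 s · 1#) Vector.∷ (x 𝟎 𝟏 s · 1#) Vector.∷
            (x 𝟏 𝟎 s · 1#) Vector.∷ (x 𝟏 𝟏 s · 1#) Vector.∷ Vector.[]

  TransitionPolytope : ℕ → Pred (ℝ^ 4) 0ℓ
  TransitionPolytope n = ConvexHull (λ v → ∃ λ s → PathFrom0 n s × v ≋ point s)

  SevenMinWeightSequences : ℕ → (Fin 7 → List State) → Set
  SevenMinWeightSequences n seq = Enumerates Equivalent (MinWeightSequence n) seq

  PolytopeStructure : ℕ → (Fin 7 → List State) → Set₁
  PolytopeStructure n seq =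
    IsPolytope K × HasDimension K 3 ×
    Enumerates _≋_ (IsVertex K) (λ i → point (seq i)) ×
    NumberOfFaces K 1 12 × NumberOfFaces K 2 7
    where
    K : Pred (ℝ^ 4) 0ℓ
    K = TransitionPolytope n

{-# OPTIONS --safe #-}
module Submission where

-- Record a sequence by (x₀₀ , x₀₁ , x₁₀ , x₁₁).  For sequences starting with 0
-- the difference x₀₁ − x₁₀ is 0 or 1, so the points lie in two parallel planes;
-- in one plane they span a triangle, in the other a quadrilateral, and every
-- point is an explicit rational mean of these seven vertices.  All remaining
-- data of the polytope (facets, edges, a functional minimal at each vertex,
-- affine dependencies between vertices) are polynomials in m, and the
-- dependencies alone leave only the 28 expected subsets as vertex sets of faces.
--
-- A vertex is the unique minimum for some integral weighting, hence for a box
-- around it.  Conversely, if a mean of two or more vertices is minimal, these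
-- vertices are minimal on the whole region, which therefore lies in a
-- hyperplane and is null.
--
-- For Markov chains, comparing B, F and C (n even) or D (n odd) with three
-- other sequences forces p₀₀ = 1/2 or p₁₀ = 1/2.  The remaining four sequences
-- are optimal on boxes of chains where their transitions are likely; for D
-- (n even) and C (n odd) the loop at one state gets probability slightly above
-- 1/2, so that one loop beats leaving while two loops lose to a round trip.
--
-- That a box has positive outer measure is shown without compactness: given a
-- cover of smaller total volume, bisection finds a first coordinate where the
-- slices of the (slightly enlarged) covering boxes are still small in total,
-- then a second one, and so on, ending in a point that is not covered.

open import Defs
open import Level using (0ℓ)
open import Algebra.Bundles using (CommutativeMonoid; CommutativeRing)
import Algebra.Definitions.RawMonoid
import Algebra.Properties.CommutativeMonoid.Mult
import Algebra.Properties.CommutativeMonoid.Sum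
import Algebra.Properties.Monoid.Mult
import Algebra.Properties.Monoid.Sum
import Algebra.Properties.Ring
import Algebra.Properties.Semiring.Mult
import Algebra.Properties.Semiring.Mult.TCOptimised
import Algebra.Properties.Semiring.Sum
import Algebra.Solver.CommutativeMonoid
import Algebra.Solver.Ring
open import Algebra.Solver.Ring.AlmostCommutativeRing using (fromCommutativeRing; _-Raw-AlmostCommutative⟶_)
open import Axiom.ExcludedMiddle using (ExcludedMiddle)
open import Data.Bool as Bool using (Bool; true; false; not; _∧_)
import Data.Bool.Properties as Bool
open import Data.Fin using (Fin; zero; suc; toℕ; inject₁; punchIn; punchOut)
open import Data.Fin.Patterns using (0F; 1F; 2F; 3F; 4F; 5F; 6F)
import Data.Fin.Properties as Fin
open import Data.Integer as ℤ using (ℤ; +_; -[1+_])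
import Data.Integer.Properties as ℤ
open import Data.List using (List; []; _∷_; _++_; map; foldr; filter; length; head; replicate)
import Data.List.Membership.DecPropositional
open import Data.List.Membership.Propositional using (_∈_)
import Data.List.Properties as List
open import Data.List.Relation.Binary.Permutation.Propositional as Perm using (_↭_; ↭-trans; ↭-sym; prep; ↭-reflexive)
import Data.List.Relation.Binary.Permutation.Propositional.Properties as Perm
open import Data.List.Relation.Unary.All as All using (All)
open import Data.List.Relation.Unary.Any using (Any; here; there)
import Data.List.Relation.Unary.Any.Properties as Any
open import Data.Maybe using (Maybe; just; nothing)
open import Data.Nat as ℕ using (ℕ; zero; suc)
import Data.Nat.Properties as ℕ
open import Data.Nat.Tactic.RingSolver using (solve-∀)
open import Data.Product using (_×_; _,_; ∃; proj₁; proj₂)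
open import Data.Product.Properties using (≡-dec)
open import Data.Sum using (_⊎_; inj₁; inj₂; [_,_]′)
open import Data.Vec as Vec using (Vec; lookup; tabulate)
open import Data.Vec.Functional as Vector using (Vector)
import Data.Vec.Functional.Properties as Vector
import Data.Vec.Properties as Vec
open import Function using (_∘_)
open import Function.Bundles using (_⇔_; mk⇔; Equivalence)
open import Relation.Binary.Bundles using (Poset)
open import Relation.Binary.Definitions using (tri<; tri≈; tri>)
open import Relation.Binary.PropositionalEquality as ≡ using (_≡_)
import Relation.Binary.Reasoning.PartialOrder
import Relation.Binary.Reasoning.Setoid
open import Relation.Binary.Structures using (IsTotalOrder)
open import Relation.Nullary using (¬_; Dec; yes; no; does; contradiction; _×-dec_; _⊎-dec_; _→-dec_)
open import Relation.Nullary.Decidable using (dec-false; dec-true; decidable-stable; from-no; from-yes; map′; ¬?)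
open import Relation.Unary using (Pred; _⊆_; _≐_)

open Algebra.Definitions.RawMonoid ℕ.+-0-rawMonoid using () renaming (sum to sumℕ)

-- Two obstacles shape the argument. The claims concern every m, while a face lattice is a finite
-- object: in terms of r = m - 2 all data are polynomials with natural coefficients, so equations
-- and strict inequalities for all r are read off coefficientwise, and what remains is a decidable
-- check on 7 vertices and their 128 subsets. Positive measure, on the other hand, quantifies over
-- all countable covers, so the total volume of an arbitrary cover has to be bounded below; excluded
-- middle picks the half at each bisection.
--
-- The parity of n matters through the sequence E, which switches at every step: it returns to 0 for
-- even n and ends in 1 for odd n, and its plane is the one that carries the triangle.
--
-- Every vertex is optimal for some weighting because the four weights are free. The rows of a
-- stochastic matrix sum to 1, so at each state the larger probability is at least 1/2 and the
-- smaller at most 1/2. Where the comparisons put both probabilities of one state below the smaller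
-- one of the other state, the two bounds meet and leave no room.

module RingSolver (ℝ : CompleteOrderedField) where

  open CompleteOrderedField ℝ hiding (zero)
  open Algebra.Properties.Ring ring
  open Algebra.Properties.Semiring.Mult.TCOptimised semiring using (×1-homo-*; 1+×) renaming (_×_ to _·_; ×-homo-+ to ·-homo-+)
  open Relation.Binary.Reasoning.Setoid setoid

  -- The multiples are the optimised ones, so that `fromℤ (+ 1)` computes to `1#` and solver
  -- constants agree with the 0 and 1 of the field. Integer coefficients let the solver evaluate
  -- numerical constants, on which the later estimates in thirty-seconds rely.
  fromℤ : ℤ → Carrier
  fromℤ (+ n)    = n · 1#
  fromℤ -[1+ n ] = - (suc n · 1#)

  private
    cancel-1 : ∀ u v → (1# + u) - (1# + v) ≈ u - v
    cancel-1 u v = begin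
      (1# + u) + - (1# + v)     ≈⟨ +-cong (+-comm 1# u) (sym (-‿+-comm 1# v)) ⟩
      (u + 1#) + (- 1# + - v)   ≈⟨ +-assoc u 1# _ ⟩
      u + (1# + (- 1# + - v))   ≈⟨ +-congˡ (sym (+-assoc 1# (- 1#) (- v))) ⟩
      u + ((1# - 1#) + - v)     ≈⟨ +-congˡ (+-congʳ (-‿inverseʳ 1#)) ⟩
      u + (0# + - v)            ≈⟨ +-congˡ (+-identityˡ (- v)) ⟩
      u - v                     ∎

    fromℤ-⊖ : ∀ m n → fromℤ (m ℤ.⊖ n) ≈ m · 1# - n · 1#
    fromℤ-⊖ m zero = sym (trans (+-congˡ -0#≈0#) (+-identityʳ _))
    fromℤ-⊖ zero (suc n) = sym (+-identityˡ _)
    fromℤ-⊖ (suc m) (suc n) = begin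
      fromℤ (suc m ℤ.⊖ suc n)      ≡⟨ ≡.cong fromℤ (ℤ.[1+m]⊖[1+n]≡m⊖n m n) ⟩
      fromℤ (m ℤ.⊖ n)              ≈⟨ fromℤ-⊖ m n ⟩
      m · 1# - n · 1#              ≈⟨ sym (cancel-1 _ _) ⟩
      (1# + m · 1#) - (1# + n · 1#) ≈⟨ +-cong (sym (1+× m 1#)) (-‿cong (sym (1+× n 1#))) ⟩
      suc m · 1# - suc n · 1#      ∎

    fromℤ-+ : ∀ i j → fromℤ (i ℤ.+ j) ≈ fromℤ i + fromℤ j
    fromℤ-+ (+ m)    (+ n)    = ·-homo-+ 1# m n
    fromℤ-+ (+ m)    -[1+ n ] = fromℤ-⊖ m (suc n)
    fromℤ-+ -[1+ m ] (+ n)    = trans (fromℤ-⊖ n (suc m)) (+-comm _ _)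
    fromℤ-+ -[1+ m ] -[1+ n ] = begin
      - (suc (suc (m ℕ.+ n)) · 1#)       ≡⟨ ≡.cong (λ k → - (suc k · 1#)) (≡.sym (ℕ.+-suc m n)) ⟩
      - ((suc m ℕ.+ suc n) · 1#)         ≈⟨ -‿cong (·-homo-+ 1# (suc m) (suc n)) ⟩
      - (suc m · 1# + suc n · 1#)        ≈⟨ sym (-‿+-comm _ _) ⟩
      - (suc m · 1#) + - (suc n · 1#)    ∎

    fromℤ-neg : ∀ i → fromℤ (ℤ.- i) ≈ - fromℤ i
    fromℤ-neg (+ zero)  = sym -0#≈0#
    fromℤ-neg (+ suc n) = refl
    fromℤ-neg -[1+ n ]  = sym (-‿involutive _)

    fromℤ-*-pos : ∀ m j → fromℤ (+ m ℤ.* j) ≈ fromℤ (+ m) * fromℤ j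
    fromℤ-*-pos m (+ n) = begin
      fromℤ (+ m ℤ.* + n)   ≡⟨ ≡.cong fromℤ (≡.sym (ℤ.pos-* m n)) ⟩
      (m ℕ.* n) · 1#        ≈⟨ ×1-homo-* m n ⟩
      m · 1# * n · 1#       ∎
    fromℤ-*-pos m -[1+ n ] = begin
      fromℤ (+ m ℤ.* (ℤ.- (+ suc n)))      ≡⟨ ≡.cong fromℤ (≡.sym (ℤ.neg-distribʳ-* (+ m) (+ suc n))) ⟩
      fromℤ (ℤ.- (+ m ℤ.* + suc n))        ≈⟨ fromℤ-neg (+ m ℤ.* + suc n) ⟩
      - fromℤ (+ m ℤ.* + suc n)            ≈⟨ -‿cong (fromℤ-*-pos m (+ suc n)) ⟩
      - (m · 1# * suc n · 1#)              ≈⟨ -‿distribʳ-* _ _ ⟩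
      m · 1# * - (suc n · 1#)              ∎

    fromℤ-* : ∀ i j → fromℤ (i ℤ.* j) ≈ fromℤ i * fromℤ j
    fromℤ-* (+ m) j = fromℤ-*-pos m j
    fromℤ-* -[1+ m ] j = begin
      fromℤ (ℤ.- (+ suc m) ℤ.* j)          ≡⟨ ≡.cong fromℤ (≡.sym (ℤ.neg-distribˡ-* (+ suc m) j)) ⟩
      fromℤ (ℤ.- (+ suc m ℤ.* j))          ≈⟨ fromℤ-neg (+ suc m ℤ.* j) ⟩
      - fromℤ (+ suc m ℤ.* j)              ≈⟨ -‿cong (fromℤ-*-pos (suc m) j) ⟩
      - (suc m · 1# * fromℤ j)             ≈⟨ -‿distribˡ-* _ _ ⟩
      - (suc m · 1#) * fromℤ j             ∎

    homomorphism : CommutativeRing.rawRing ℤ.+-*-commutativeRing -Raw-AlmostCommutative⟶ fromCommutativeRing commutativeRing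
    homomorphism = record
      { ⟦_⟧ = fromℤ ; +-homo = fromℤ-+ ; *-homo = fromℤ-* ; -‿homo = fromℤ-neg
      ; 0-homo = refl ; 1-homo = refl }

    weaklyDecide : ∀ i j → Maybe (fromℤ i ≈ fromℤ j)
    weaklyDecide i j with i ℤ.≟ j
    ... | yes i≡j = just (reflexive (≡.cong fromℤ i≡j))
    ... | no _    = nothing

  open Algebra.Solver.Ring (CommutativeRing.rawRing ℤ.+-*-commutativeRing) (fromCommutativeRing commutativeRing) homomorphism weaklyDecide public
    using (solve; _:+_; _:*_; _:-_; :-_; _:=_; con)

-- Order, powers and finite sums in a complete ordered field.

module OrderedField (em : ExcludedMiddle 0ℓ) (ℝ : CompleteOrderedField) where

  open CompleteOrderedField ℝ hiding (zero)
  open Over ℝ using (ℝ^)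
  open RingSolver ℝ
  open IsTotalOrder isTotalOrder public
    using (total; antisym; ≤-respˡ-≈; ≤-respʳ-≈)
    renaming (refl to ≤-refl; reflexive to ≤-reflexive; trans to ≤-trans)

  poset : Poset 0ℓ 0ℓ 0ℓ
  poset = record { isPartialOrder = IsTotalOrder.isPartialOrder isTotalOrder }

  module ≤-Reasoning = Relation.Binary.Reasoning.PartialOrder poset

  by-contradiction : ∀ {Q : Set} → ¬ ¬ Q → Q
  by-contradiction = decidable-stable em

  0≤y-x : ∀ {x y} → x ≤ y → 0# ≤ y - x
  0≤y-x {x} x≤y = ≤-respˡ-≈ (-‿inverseʳ x) (+-monoˡ-≤ (- x) x≤y)

  -- The standard form of inequality proofs below: the difference is displayed as a visibly
  -- nonnegative term, and the identity is left to the ring solver.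
  ≤-by-difference : ∀ {x y d} → 0# ≤ d → y - x ≈ d → x ≤ y
  ≤-by-difference {x} {y} 0≤d eq =
    ≤-respʳ-≈ (solve 2 (λ x y → (y :- x) :+ x := y) refl x y)
      (≤-respˡ-≈ (+-identityˡ x) (+-monoˡ-≤ x (≤-respʳ-≈ (sym eq) 0≤d)))

  +-nonneg : ∀ {x y} → 0# ≤ x → 0# ≤ y → 0# ≤ x + y
  +-nonneg {x} {y} 0≤x 0≤y = ≤-trans 0≤y (≤-respˡ-≈ (+-identityˡ y) (+-monoˡ-≤ y 0≤x))

  +-mono-≤ : ∀ {x y u v} → x ≤ y → u ≤ v → x + u ≤ y + v
  +-mono-≤ {x} {y} {u} {v} x≤y u≤v = ≤-by-difference (+-nonneg (0≤y-x x≤y) (0≤y-x u≤v))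
    (solve 4 (λ x y u v → y :+ v :- (x :+ u) := (y :- x) :+ (v :- u)) refl x y u v)

  neg-mono-≤ : ∀ {x y} → x ≤ y → - y ≤ - x
  neg-mono-≤ {x} {y} x≤y = ≤-by-difference (0≤y-x x≤y) (solve 2 (λ x y → :- x :- :- y := y :- x) refl x y)

  +-cancelˡ-≤ : ∀ z {x y} → z + x ≤ z + y → x ≤ y
  +-cancelˡ-≤ z {x} {y} le = ≤-by-difference (0≤y-x le)
    (solve 3 (λ x y z → y :- x := (z :+ y) :- (z :+ x)) refl x y z)

  +-cancelˡ-≈ : ∀ z {x y} → z + x ≈ z + y → x ≈ y
  +-cancelˡ-≈ z eq = antisym (+-cancelˡ-≤ z (≤-reflexive eq)) (+-cancelˡ-≤ z (≤-reflexive (sym eq)))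

  ≰⇒> : ∀ {x y} → ¬ x ≤ y → y < x
  ≰⇒> {x} {y} x≰y with total x y
  ... | inj₁ x≤y = contradiction x≤y x≰y
  ... | inj₂ y≤x = y≤x , λ y≈x → x≰y (≤-reflexive (sym y≈x))

  ≤-or-> : ∀ x y → x ≤ y ⊎ y < x
  ≤-or-> x y with em {x ≤ y}
  ... | yes x≤y = inj₁ x≤y
  ... | no x≰y  = inj₂ (≰⇒> x≰y)

  <⇒≱ : ∀ {x y} → x < y → ¬ y ≤ x
  <⇒≱ (x≤y , x≉y) y≤x = x≉y (antisym x≤y y≤x)

  ≮⇒≥ : ∀ {x y} → ¬ x < y → y ≤ x
  ≮⇒≥ {x} {y} x≮y with ≤-or-> y x
  ... | inj₁ y≤x = y≤x
  ... | inj₂ x<y = contradiction x<y x≮y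

  <-≤-trans : ∀ {x y z} → x < y → y ≤ z → x < z
  <-≤-trans (x≤y , x≉y) y≤z =
    ≤-trans x≤y y≤z , λ x≈z → x≉y (antisym x≤y (≤-respʳ-≈ (sym x≈z) y≤z))

  ≤-<-trans : ∀ {x y z} → x ≤ y → y < z → x < z
  ≤-<-trans x≤y (y≤z , y≉z) =
    ≤-trans x≤y y≤z , λ x≈z → y≉z (antisym y≤z (≤-respˡ-≈ x≈z x≤y))

  <-resp-≈ : ∀ {x x′ y y′} → x ≈ x′ → y ≈ y′ → x < y → x′ < y′
  <-resp-≈ x≈ y≈ (x≤y , x≉y) = ≤-respˡ-≈ x≈ (≤-respʳ-≈ y≈ x≤y) , λ eq → x≉y (trans x≈ (trans eq (sym y≈)))

  0<y-x : ∀ {x y} → x < y → 0# < y - x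
  0<y-x {x} {y} (x≤y , x≉y) = 0≤y-x x≤y , λ 0≈ → x≉y (begin
    x            ≈⟨ sym (+-identityʳ x) ⟩
    x + 0#       ≈⟨ +-congˡ 0≈ ⟩
    x + (y - x)  ≈⟨ solve 2 (λ x y → x :+ (y :- x) := y) refl x y ⟩
    y            ∎)
    where open Relation.Binary.Reasoning.Setoid setoid

  <-by-difference : ∀ {x y d} → 0# < d → y - x ≈ d → x < y
  <-by-difference {x} {y} {d} (0≤d , 0≉d) eq = ≤-by-difference 0≤d eq , λ x≈y → 0≉d (begin
    0#     ≈⟨ sym (-‿inverseʳ x) ⟩
    x - x  ≈⟨ +-congʳ x≈y ⟩
    y - x  ≈⟨ eq ⟩
    d      ∎)
    where open Relation.Binary.Reasoning.Setoid setoid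

  +-pos-nonneg : ∀ {x y} → 0# < x → 0# ≤ y → 0# < x + y
  +-pos-nonneg {x} {y} 0<x 0≤y = <-≤-trans 0<x
    (≤-by-difference 0≤y (solve 2 (λ x y → x :+ y :- x := y) refl x y))

  *-monoˡ-≤ : ∀ {z x y} → 0# ≤ z → x ≤ y → z * x ≤ z * y
  *-monoˡ-≤ {z} {x} {y} 0≤z x≤y = ≤-by-difference (*-nonneg 0≤z (0≤y-x x≤y))
    (solve 3 (λ x y z → z :* y :- z :* x := z :* (y :- x)) refl x y z)

  *-monoʳ-≤ : ∀ {z x y} → 0# ≤ z → x ≤ y → x * z ≤ y * z
  *-monoʳ-≤ {z} {x} {y} 0≤z x≤y = ≤-respˡ-≈ (*-comm z x) (≤-respʳ-≈ (*-comm z y) (*-monoˡ-≤ 0≤z x≤y))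

  *-mono-≤ : ∀ {x y u v} → 0# ≤ x → x ≤ y → 0# ≤ u → u ≤ v → x * u ≤ y * v
  *-mono-≤ 0≤x x≤y 0≤u u≤v = ≤-trans (*-monoʳ-≤ 0≤u x≤y) (*-monoˡ-≤ (≤-trans 0≤x x≤y) u≤v)

  *-cancelˡ-≈0 : ∀ {x y} → ¬ x ≈ 0# → x * y ≈ 0# → y ≈ 0#
  *-cancelˡ-≈0 {x} {y} x≉0 xy≈0 with inverse x x≉0
  ... | x⁻¹ , eq = begin
    y               ≈⟨ sym (*-identityˡ y) ⟩
    1# * y          ≈⟨ *-congʳ (sym eq) ⟩
    x * x⁻¹ * y     ≈⟨ solve 3 (λ x i y → x :* i :* y := i :* (x :* y)) refl x x⁻¹ y ⟩
    x⁻¹ * (x * y)   ≈⟨ *-congˡ xy≈0 ⟩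
    x⁻¹ * 0#        ≈⟨ zeroʳ x⁻¹ ⟩
    0#              ∎
    where open Relation.Binary.Reasoning.Setoid setoid

  pos⇒≉0 : ∀ {x} → 0# < x → ¬ x ≈ 0#
  pos⇒≉0 (_ , 0≉x) x≈0 = 0≉x (sym x≈0)

  *-pos : ∀ {x y} → 0# < x → 0# < y → 0# < x * y
  *-pos 0<x@(0≤x , _) (0≤y , 0≉y) =
    *-nonneg 0≤x 0≤y , λ 0≈xy → 0≉y (sym (*-cancelˡ-≈0 (pos⇒≉0 0<x) (sym 0≈xy)))

  *-monoˡ-< : ∀ {z x y} → 0# < z → x < y → z * x < z * y
  *-monoˡ-< {z} {x} {y} 0<z x<y = <-by-difference (*-pos 0<z (0<y-x x<y))
    (solve 3 (λ x y z → z :* y :- z :* x := z :* (y :- x)) refl x y z)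

  *-cancelˡ-≤ : ∀ {z x y} → 0# < z → z * x ≤ z * y → x ≤ y
  *-cancelˡ-≤ 0<z le = ≮⇒≥ λ y<x → <⇒≱ (*-monoˡ-< 0<z y<x) le

  *-cancelˡ-< : ∀ {z x y} → 0# ≤ z → z * x < z * y → x < y
  *-cancelˡ-< 0≤z lt = ≰⇒> λ y≤x → <⇒≱ lt (*-monoˡ-≤ 0≤z y≤x)

  0<1 : 0# < 1#
  0<1 with total 0# 1#
  ... | inj₁ 0≤1 = 0≤1 , 0≉1
  ... | inj₂ 1≤0 = contradiction (antisym 0≤1 1≤0) 0≉1
    where
    0≤-1 : 0# ≤ - 1#
    0≤-1 = ≤-by-difference (0≤y-x 1≤0) (solve 0 (:- con (+ 1) :- con (+ 0) := con (+ 0) :- con (+ 1)) refl)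
    0≤1 : 0# ≤ 1#
    0≤1 = ≤-respʳ-≈ (solve 0 (:- con (+ 1) :* :- con (+ 1) := con (+ 1)) refl) (*-nonneg 0≤-1 0≤-1)

  0≤1 : 0# ≤ 1#
  0≤1 = proj₁ 0<1

  inverse-pos : ∀ {x} → 0# < x → ∃ λ y → 0# < y × x * y ≈ 1#
  inverse-pos {x} 0<x with inverse x (pos⇒≉0 0<x)
  ... | y , xy≈1 = y , *-cancelˡ-< (proj₁ 0<x) (<-resp-≈ (sym (zeroʳ x)) (sym xy≈1) 0<1) , xy≈1

  2# : Carrier
  2# = 1# + 1#

  0<2 : 0# < 2#
  0<2 = +-pos-nonneg 0<1 0≤1

  abstract
    ½ : Carrier
    ½ = proj₁ (inverse-pos 0<2)

    0<½ : 0# < ½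
    0<½ = proj₁ (proj₂ (inverse-pos 0<2))

    2*½≈1 : 2# * ½ ≈ 1#
    2*½≈1 = proj₂ (proj₂ (inverse-pos 0<2))

  0≤½ : 0# ≤ ½
  0≤½ = proj₁ 0<½

  ½+½≈1 : ½ + ½ ≈ 1#
  ½+½≈1 = trans (solve 1 (λ h → h :+ h := (con (+ 1) :+ con (+ 1)) :* h) refl ½) 2*½≈1

  ½x+½x≈x : ∀ x → ½ * x + ½ * x ≈ x
  ½x+½x≈x x = trans (sym (distribʳ x ½ ½)) (trans (*-congʳ ½+½≈1) (*-identityˡ x))

  open Algebra.Properties.Semiring.Sum semiring public
    using (sum; sum-cong-≋; ∑-distrib-+; ∑-comm; *-distribˡ-sum; *-distribʳ-sum; sum-replicate-zero)
  open Algebra.Properties.Monoid.Mult +-monoid public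
    using () renaming (_×_ to _·_; ×-homo-+ to ·-homo-+; ×-congʳ to ·-congʳ)
  open Algebra.Properties.Semiring.Mult semiring public
    using (×1-homo-*) renaming (×-comm-* to ·-comm-*)
  open Algebra.Definitions.RawMonoid *-rawMonoid public using () renaming (sum to product)

  infixl 9 _↑_

  _↑_ : Carrier → ℕ → Carrier
  z ↑ n = Algebra.Definitions.RawMonoid._×_ *-rawMonoid n z

  ↑-pos : ∀ {z} n → 0# < z → 0# < z ↑ n
  ↑-pos zero    0<z = 0<1
  ↑-pos (suc n) 0<z = *-pos 0<z (↑-pos n 0<z)

  ↑-nonneg : ∀ {z} n → 0# ≤ z → 0# ≤ z ↑ n
  ↑-nonneg zero    0≤z = 0≤1
  ↑-nonneg (suc n) 0≤z = *-nonneg 0≤z (↑-nonneg n 0≤z)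

  ↑-mono-≤ : ∀ {y z} n → 0# ≤ y → y ≤ z → y ↑ n ≤ z ↑ n
  ↑-mono-≤ zero    0≤y y≤z = ≤-refl
  ↑-mono-≤ (suc n) 0≤y y≤z = *-mono-≤ 0≤y y≤z (↑-nonneg n 0≤y) (↑-mono-≤ n 0≤y y≤z)

  *-mono-< : ∀ {x y u v} → 0# ≤ x → x < y → 0# < v → u ≤ v → x * u < y * v
  *-mono-< {x} {y} {u} {v} 0≤x x<y 0<v u≤v = ≤-<-trans (*-monoˡ-≤ 0≤x u≤v)
    (<-resp-≈ (*-comm v x) (*-comm v y) (*-monoˡ-< 0<v x<y))

  ↑-mono-< : ∀ {y z} n → 0# ≤ y → y < z → y ↑ suc n < z ↑ suc n
  ↑-mono-< n 0≤y y<z =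
    *-mono-< 0≤y y<z (↑-pos n (≤-<-trans 0≤y y<z)) (↑-mono-≤ n 0≤y (proj₁ y<z))

  ↑-cancel-≤ : ∀ {y z} n → 0# ≤ z → y ↑ suc n ≤ z ↑ suc n → y ≤ z
  ↑-cancel-≤ n 0≤z le = ≮⇒≥ λ z<y → <⇒≱ (↑-mono-< n 0≤z z<y) le

  2↑*½↑ : ∀ n → 2# ↑ n * ½ ↑ n ≈ 1#
  2↑*½↑ zero    = *-identityˡ 1#
  2↑*½↑ (suc n) = begin
    2# * 2# ↑ n * (½ * ½ ↑ n)   ≈⟨ solve 4 (λ a b c d → a :* b :* (c :* d) := a :* c :* (b :* d)) refl 2# (2# ↑ n) ½ (½ ↑ n) ⟩
    2# * ½ * (2# ↑ n * ½ ↑ n)   ≈⟨ *-cong 2*½≈1 (2↑*½↑ n) ⟩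
    1# * 1#                     ≈⟨ *-identityˡ 1# ⟩
    1#                          ∎
    where open Relation.Binary.Reasoning.Setoid setoid

  -- The supremum s of the numbers 2ⁿ d would satisfy s ≤ s / 2.
  archimedean : ∀ {d} w → 0# < d → ∃ λ n → w < 2# ↑ n * d
  archimedean {d} w 0<d with em {∃ λ n → w < 2# ↑ n * d}
  ... | yes found = found
  ... | no none   = contradiction (≤-trans d≤s s≤0) (<⇒≱ 0<d)
    where
    Multiple : Carrier → Set
    Multiple y = ∃ λ n → y ≈ 2# ↑ n * d

    sup = supremum Multiple (_ , 0 , refl)
      (w , λ y (n , eq) → ≤-respˡ-≈ (sym eq) (≮⇒≥ λ lt → none (n , lt)))
    s = proj₁ sup

    d≤s : d ≤ s
    d≤s = proj₁ (proj₂ sup) d (0 , sym (*-identityˡ d))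

    s≤½s : s ≤ ½ * s
    s≤½s = proj₂ (proj₂ sup) (½ * s) λ y (n , eq) →
      ≤-respˡ-≈ (trans (begin
          ½ * (2# * 2# ↑ n * d)   ≈⟨ solve 4 (λ h t u d → h :* (t :* u :* d) := t :* h :* (u :* d)) refl ½ 2# (2# ↑ n) d ⟩
          2# * ½ * (2# ↑ n * d)   ≈⟨ *-congʳ 2*½≈1 ⟩
          1# * (2# ↑ n * d)       ≈⟨ *-identityˡ _ ⟩
          2# ↑ n * d              ∎) (sym eq))
        (*-monoˡ-≤ 0≤½ (proj₁ (proj₂ sup) _ (suc n , refl)))
      where open Relation.Binary.Reasoning.Setoid setoid

    s≤0 : s ≤ 0#
    s≤0 = *-cancelˡ-≤ 0<½ (≤-respʳ-≈ (sym (zeroʳ ½)) (+-cancelˡ-≤ (½ * s)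
      (≤-respˡ-≈ (sym (½x+½x≈x s)) (≤-respʳ-≈ (sym (+-identityʳ _)) s≤½s))))

  archimedean-½ : ∀ {d} w → 0# < d → ∃ λ n → w * ½ ↑ n < d
  archimedean-½ {d} w 0<d with archimedean w 0<d
  ... | n , w<2ⁿd = n , *-cancelˡ-< (proj₁ (↑-pos n 0<2))
    (<-resp-≈ eq refl w<2ⁿd)
    where
    eq : w ≈ 2# ↑ n * (w * ½ ↑ n)
    eq = sym (trans (solve 3 (λ t w h → t :* (w :* h) := w :* (t :* h)) refl (2# ↑ n) w (½ ↑ n))
           (trans (*-congˡ (2↑*½↑ n)) (*-identityʳ w)))

  sum-mono-≤ : ∀ {k} {u v : ℝ^ k} → (∀ i → u i ≤ v i) → sum u ≤ sum v
  sum-mono-≤ {zero}  u≤v = ≤-refl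
  sum-mono-≤ {suc k} u≤v = +-mono-≤ (u≤v zero) (sum-mono-≤ λ i → u≤v (suc i))

  sum-nonneg : ∀ {k} {u : ℝ^ k} → (∀ i → 0# ≤ u i) → 0# ≤ sum u
  sum-nonneg {zero}  0≤u = ≤-refl
  sum-nonneg {suc k} 0≤u = +-nonneg (0≤u zero) (sum-nonneg λ i → 0≤u (suc i))

  product-nonneg : ∀ {k} {u : ℝ^ k} → (∀ i → 0# ≤ u i) → 0# ≤ product u
  product-nonneg {zero}  0≤u = 0≤1
  product-nonneg {suc k} 0≤u = *-nonneg (0≤u zero) (product-nonneg λ i → 0≤u (suc i))

  product-pos : ∀ {k} {u : ℝ^ k} → (∀ i → 0# < u i) → 0# < product u
  product-pos {zero}  0<u = 0<1
  product-pos {suc k} 0<u = *-pos (0<u zero) (product-pos λ i → 0<u (suc i))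

  ·-nonneg : ∀ n {x} → 0# ≤ x → 0# ≤ n · x
  ·-nonneg zero    0≤x = ≤-refl
  ·-nonneg (suc n) 0≤x = +-nonneg 0≤x (·-nonneg n 0≤x)

  ·-pos : ∀ n {x} → 0# < x → 0# < suc n · x
  ·-pos n 0<x = +-pos-nonneg 0<x (·-nonneg n (proj₁ 0<x))

-- Boxes have positive outer measure.

module PositiveBoxes (em : ExcludedMiddle 0ℓ) (ℝ : CompleteOrderedField) where

  open CompleteOrderedField ℝ hiding (zero)
  open Over ℝ
  open OrderedField em ℝ
  open RingSolver ℝ
  open Algebra.Properties.Monoid.Sum *-monoid using () renaming (sum-cong-≋ to product-cong)

  partialSum : (ℕ → Carrier) → ℕ → Carrier
  partialSum f N = sum {N} (λ k → f (toℕ k))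

  term≤partialSum : ∀ {f} → (∀ k → 0# ≤ f k) → ∀ k → f k ≤ partialSum f (suc k)
  term≤partialSum {f} 0≤f zero    = ≤-reflexive (sym (+-identityʳ (f 0)))
  term≤partialSum {f} 0≤f (suc k) =
    ≤-trans (term≤partialSum (λ j → 0≤f (suc j)) k)
      (≤-respˡ-≈ (+-identityˡ _) (+-monoˡ-≤ _ (0≤f 0)))

  partialSum-mono : ∀ {f} → (∀ k → 0# ≤ f k) → ∀ {M N} → M ℕ.≤ N → partialSum f M ≤ partialSum f N
  partialSum-mono 0≤f {N = N} ℕ.z≤n = sum-nonneg {N} (λ k → 0≤f (toℕ k))
  partialSum-mono 0≤f (ℕ.s≤s M≤N) = +-mono-≤ ≤-refl (partialSum-mono (λ k → 0≤f (suc k)) M≤N)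

  -- The positive part of y. Overlaps of intervals are expressed by its differences, which avoids
  -- distinguishing the relative positions of four endpoints.
  ramp : Carrier → Carrier
  ramp y with total 0# y
  ... | inj₁ _ = y
  ... | inj₂ _ = 0#

  ramp-cases : ∀ y → (0# ≤ y × ramp y ≈ y) ⊎ (y ≤ 0# × ramp y ≈ 0#)
  ramp-cases y with total 0# y
  ... | inj₁ 0≤y = inj₁ (0≤y , refl)
  ... | inj₂ y≤0 = inj₂ (y≤0 , refl)

  0≤ramp : ∀ y → 0# ≤ ramp y
  0≤ramp y with ramp-cases y
  ... | inj₁ (0≤y , eq) = ≤-respʳ-≈ (sym eq) 0≤y
  ... | inj₂ (_ , eq)   = ≤-reflexive (sym eq)

  y≤ramp : ∀ y → y ≤ ramp y
  y≤ramp y with ramp-cases y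
  ... | inj₁ (_ , eq)   = ≤-reflexive (sym eq)
  ... | inj₂ (y≤0 , eq) = ≤-respʳ-≈ (sym eq) y≤0

  ramp-nonneg : ∀ {y} → 0# ≤ y → ramp y ≈ y
  ramp-nonneg {y} 0≤y with ramp-cases y
  ... | inj₁ (_ , eq)   = eq
  ... | inj₂ (y≤0 , eq) = trans eq (antisym 0≤y y≤0)

  ramp-nonpos : ∀ {y} → y ≤ 0# → ramp y ≈ 0#
  ramp-nonpos {y} y≤0 with ramp-cases y
  ... | inj₁ (0≤y , eq) = trans eq (antisym y≤0 0≤y)
  ... | inj₂ (_ , eq)   = eq

  ramp-mono : ∀ {y z} → y ≤ z → ramp y ≤ ramp z
  ramp-mono {y} {z} y≤z with ramp-cases y
  ... | inj₁ (_ , eq) = ≤-respˡ-≈ (sym eq) (≤-trans y≤z (y≤ramp z))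
  ... | inj₂ (_ , eq) = ≤-respˡ-≈ (sym eq) (0≤ramp z)

  ramp-lipschitz : ∀ {y z} → y ≤ z → ramp z + y ≤ ramp y + z
  ramp-lipschitz {y} {z} y≤z with ramp-cases z
  ... | inj₁ (_ , eq) = ≤-respˡ-≈ (trans (+-comm y z) (+-congʳ (sym eq))) (+-monoˡ-≤ z (y≤ramp y))
  ... | inj₂ (_ , eq) = ≤-respˡ-≈ (+-congʳ (sym eq)) (+-mono-≤ (0≤ramp y) y≤z)

  -- The length of [l , u] ∩ [a , b], written as a second difference so that
  -- additivity in [a , b] is a ring identity.
  meet : (l u a b : Carrier) → Carrier
  meet l u a b = (ramp (u - a) - ramp (u - b)) - (ramp (l - a) - ramp (l - b))

  meet-additive : ∀ l u a m b → meet l u a m + meet l u m b ≈ meet l u a b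
  meet-additive l u a m b =
    solve 6 (λ ua um ub la lm lb →
        ((ua :- um) :- (la :- lm)) :+ ((um :- ub) :- (lm :- lb)) := (ua :- ub) :- (la :- lb))
      refl (ramp (u - a)) (ramp (u - m)) (ramp (u - b)) (ramp (l - a)) (ramp (l - m)) (ramp (l - b))

  private
    -mono : ∀ {y z} a → y ≤ z → y - a ≤ z - a
    -mono a y≤z = +-monoˡ-≤ (- a) y≤z

    -anti : ∀ {a b} y → a ≤ b → y - b ≤ y - a
    -anti y a≤b = +-mono-≤ ≤-refl (neg-mono-≤ a≤b)

  -- Convexity of `ramp`: u - b and l - a lie between l - b and u - a and have the same sum as these
  -- two.
  meet-nonneg : ∀ {l u a b} → l ≤ u → a ≤ b → 0# ≤ meet l u a b
  meet-nonneg {l} {u} {a} {b} l≤u a≤b =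
    ≤-respʳ-≈ (solve 4 (λ ua ub la lb → (ua :+ lb) :- (ub :+ la) := (ua :- ub) :- (la :- lb)) refl
      (ramp (u - a)) (ramp (u - b)) (ramp (l - a)) (ramp (l - b))) (0≤y-x convexity)
    where
    convexity : ramp (u - b) + ramp (l - a) ≤ ramp (u - a) + ramp (l - b)
    convexity with ramp-cases (u - b) | ramp-cases (l - a)
    ... | inj₁ (_ , ub) | inj₁ (_ , la) = ≤-respˡ-≈ (trans
            (solve 4 (λ l u a b → (u :- a) :+ (l :- b) := (u :- b) :+ (l :- a)) refl l u a b)
            (sym (+-cong ub la)))
          (+-mono-≤ (y≤ramp (u - a)) (y≤ramp (l - b)))
    ... | inj₁ (_ , ub) | inj₂ (_ , la) = ≤-respˡ-≈ (sym (+-cong ub la))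
          (+-mono-≤ (≤-trans (-anti u a≤b) (y≤ramp _)) (0≤ramp _))
    ... | inj₂ (_ , ub) | inj₁ (_ , la) = ≤-respˡ-≈ (sym (trans (+-cong ub la) (+-comm 0# _)))
          (+-mono-≤ (≤-trans (-mono a l≤u) (y≤ramp _)) (0≤ramp _))
    ... | inj₂ (_ , ub) | inj₂ (_ , la) = ≤-respˡ-≈ (sym (+-cong ub la))
          (+-mono-≤ (0≤ramp _) (0≤ramp _))

  -- The slack is a sum of two nonnegative parts: one from the Lipschitz bound at a, the other from
  -- monotonicity at b.
  meet≤length : ∀ {l u} a b → l ≤ u → meet l u a b ≤ u - l
  meet≤length {l} {u} a b l≤u = ≤-by-difference
    (+-nonneg (0≤y-x (ramp-lipschitz (-mono a l≤u))) (0≤y-x (ramp-mono (-mono b l≤u))))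
    (solve 7 (λ l u a ua ub la lb →
        (u :- l) :- ((ua :- ub) :- (la :- lb)) :=
        ((la :+ (u :- a)) :- (ua :+ (l :- a))) :+ (ub :- lb))
      refl l u a (ramp (u - a)) (ramp (u - b)) (ramp (l - a)) (ramp (l - b)))

  meet-inside : ∀ {l u a b} → l ≤ a → a ≤ b → b ≤ u → meet l u a b ≈ b - a
  meet-inside {l} {u} {a} {b} l≤a a≤b b≤u = trans
    (+-cong (+-cong (ramp-nonneg (0≤y-x (≤-trans a≤b b≤u))) (-‿cong (ramp-nonneg (0≤y-x b≤u))))
      (-‿cong (+-cong (ramp-nonpos (nonpos l≤a)) (-‿cong (ramp-nonpos (nonpos (≤-trans l≤a a≤b)))))))
    (solve 3 (λ u a b → ((u :- a) :- (u :- b)) :- (con (+ 0) :- con (+ 0)) := b :- a) refl u a b)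
    where
    nonpos : ∀ {y z} → y ≤ z → y - z ≤ 0#
    nonpos {y} {z} y≤z = ≤-respʳ-≈ (-‿inverseʳ z) (-mono z y≤z)

  indicator : Set → Carrier
  indicator P with em {P}
  ... | yes _ = 1#
  ... | no _  = 0#

  indicator-true : ∀ {P} → P → indicator P ≈ 1#
  indicator-true {P} p with em {P}
  ... | yes _ = refl
  ... | no ¬p = contradiction p ¬p

  indicator-false : ∀ {P} → ¬ P → indicator P ≈ 0#
  indicator-false {P} ¬p with em {P}
  ... | yes p = contradiction p ¬p
  ... | no _  = refl

  indicator-nonneg : ∀ P → 0# ≤ indicator P
  indicator-nonneg P with em {P}
  ... | yes _ = 0≤1
  ... | no _  = ≤-refl

  ½-antitone : ∀ {m n} → m ℕ.≤ n → ½ ↑ n ≤ ½ ↑ m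
  ½-antitone {n = zero}  ℕ.z≤n = ≤-refl
  ½-antitone {n = suc n} ℕ.z≤n = ≤-respʳ-≈ (*-identityˡ 1#)
    (*-mono-≤ 0≤½ ½≤1 (↑-nonneg n 0≤½) (½-antitone {n = n} ℕ.z≤n))
    where ½≤1 = ≤-respʳ-≈ ½+½≈1 (≤-respˡ-≈ (+-identityˡ ½) (+-monoˡ-≤ ½ 0≤½))
  ½-antitone (ℕ.s≤s m≤n) = *-monoˡ-≤ 0≤½ (½-antitone m≤n)

  eventually-all : (Q : ℕ → ℕ → Set) → (∀ k → ∃ λ n₀ → ∀ n → n₀ ℕ.≤ n → Q k n) →
                   ∀ N → ∃ λ n → ∀ (k : Fin N) → Q (toℕ k) n
  eventually-all Q ev N = proj₁ (bounded Q ev N) , λ k → proj₂ (bounded Q ev N) k _ ℕ.≤-refl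
    where
    bounded : (Q : ℕ → ℕ → Set) → (∀ k → ∃ λ n₀ → ∀ n → n₀ ℕ.≤ n → Q k n) →
              ∀ N → ∃ λ n₀ → ∀ (k : Fin N) n → n₀ ℕ.≤ n → Q (toℕ k) n
    bounded Q ev zero    = 0 , λ ()
    bounded Q ev (suc N) with ev 0 | bounded (λ k → Q (suc k)) (λ k → ev (suc k)) N
    ... | n₁ , h₁ | n₂ , h₂ = n₁ ℕ.⊔ n₂ , λ where
      zero    n le → h₁ n (ℕ.≤-trans (ℕ.m≤m⊔n n₁ n₂) le)
      (suc k) n le → h₂ k n (ℕ.≤-trans (ℕ.m≤n⊔m n₁ n₂) le)

  -- Bisecting [a , b], always keep a half on which the weighted intervals are
  -- at most as dense as they are on the whole of [a , b].
  module Bisection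
    (a b : Carrier) (a<b : a < b) (τ : Carrier)
    (l u weights : ℕ → Carrier) (l≤u : ∀ k → l k ≤ u k) (weights-nonneg : ∀ k → 0# ≤ weights k)
    (total≤τ : ∀ N → partialSum (λ k → (u k - l k) * weights k) N ≤ τ)
    where

    mass : Carrier → Carrier → ℕ → Carrier
    mass c d N = partialSum (λ k → meet (l k) (u k) c d * weights k) N

    -- The density bound mass / (d - c) ≤ τ / (b - a) with the divisions cleared. It is imposed on
    -- every partial sum, which replaces the value of an infinite series.
    Sparse : Carrier → Carrier → Set
    Sparse c d = ∀ N → (b - a) * mass c d N ≤ τ * (d - c)

    0≤b-a : 0# ≤ b - a
    0≤b-a = 0≤y-x (proj₁ a<b)

    mass-mono : ∀ {c d M N} → c ≤ d → M ℕ.≤ N → mass c d M ≤ mass c d N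
    mass-mono c≤d = partialSum-mono (λ k → *-nonneg (meet-nonneg (l≤u k) c≤d) (weights-nonneg k))

    mass-additive : ∀ c m d N → mass c m N + mass m d N ≈ mass c d N
    mass-additive c m d N = trans (sym (∑-distrib-+ {N} _ _)) (sum-cong-≋ {N} λ k →
      trans (sym (distribʳ _ _ _)) (*-congʳ (meet-additive (l (toℕ k)) (u (toℕ k)) c m d)))

    sparse-start : Sparse a b
    sparse-start N = ≤-respʳ-≈ (*-comm (b - a) τ) (*-monoˡ-≤ 0≤b-a (≤-trans
      (sum-mono-≤ {N} λ k → *-monoʳ-≤ (weights-nonneg (toℕ k)) (meet≤length a b (l≤u (toℕ k))))
      (total≤τ N)))

    sparse-half : ∀ {c m d} → c ≤ m → m ≤ d → Sparse c d → Sparse c m ⊎ Sparse m d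
    sparse-half {c} {m} {d} c≤m m≤d sparse
      with em {∃ λ N → τ * (m - c) < (b - a) * mass c m N}
         | em {∃ λ N → τ * (d - m) < (b - a) * mass m d N}
    ... | no none | _ = inj₁ λ N → ≮⇒≥ λ lt → none (N , lt)
    ... | yes _ | no none = inj₂ λ N → ≮⇒≥ λ lt → none (N , lt)
    -- Partial sums only grow, so both violations persist at M + N, where they add up to a violation
    -- on the whole of [c , d].
    ... | yes (M , lt₁) | yes (N , lt₂) = contradiction (sparse (M ℕ.+ N)) (<⇒≱ (begin-strict
      τ * (d - c)                                         ≈⟨ solve 4 (λ t c m d → t :* (d :- c) := t :* (m :- c) :+ t :* (d :- m)) refl τ c m d ⟩
      τ * (m - c) + τ * (d - m)                           ≤⟨ +-mono-≤ ≤-refl (proj₁ lt₂) ⟩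
      τ * (m - c) + (b - a) * mass m d N                  <⟨ <-by-difference (0<y-x lt₁) (solve 3 (λ p q r → (q :+ r) :- (p :+ r) := q :- p) refl _ _ _) ⟩
      (b - a) * mass c m M + (b - a) * mass m d N         ≈⟨ sym (distribˡ _ _ _) ⟩
      (b - a) * (mass c m M + mass m d N)                 ≤⟨ *-monoˡ-≤ 0≤b-a (+-mono-≤ (mass-mono c≤m (ℕ.m≤m+n M N)) (mass-mono m≤d (ℕ.m≤n+m N M))) ⟩
      (b - a) * (mass c m (M ℕ.+ N) + mass m d (M ℕ.+ N)) ≈⟨ *-congˡ (mass-additive c m d (M ℕ.+ N)) ⟩
      (b - a) * mass c d (M ℕ.+ N)                        ∎))
      where open ≤-Reasoning

    record Cell : Set where
      field
        left right : Carrier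
        left≤right : left ≤ right
        sparse     : Sparse left right

    open Cell

    middle : Cell → Carrier
    middle c = left c + ½ * (right c - left c)

    private
      half-nonneg : ∀ c → 0# ≤ ½ * (right c - left c)
      half-nonneg c = *-nonneg 0≤½ (0≤y-x (left≤right c))

      +-cancel : ∀ y h → (y + h) - y ≈ h
      +-cancel = solve 2 (λ y h → (y :+ h) :- y := h) refl

      upper-half : ∀ y r → r - (y + ½ * (r - y)) ≈ ½ * (r - y)
      upper-half y r = begin
        r - (y + ½ * (r - y))                      ≈⟨ solve 3 (λ y r h → r :- (y :+ h) := (r :- y) :- h) refl y r (½ * (r - y)) ⟩
        (r - y) - ½ * (r - y)                      ≈⟨ +-congʳ (sym (½x+½x≈x (r - y))) ⟩
        (½ * (r - y) + ½ * (r - y)) - ½ * (r - y)  ≈⟨ solve 1 (λ h → (h :+ h) :- h := h) refl (½ * (r - y)) ⟩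
        ½ * (r - y)                                ∎
        where open Relation.Binary.Reasoning.Setoid setoid

    left≤middle : ∀ c → left c ≤ middle c
    left≤middle c = ≤-by-difference (half-nonneg c) (+-cancel (left c) (½ * (right c - left c)))

    middle≤right : ∀ c → middle c ≤ right c
    middle≤right c = ≤-by-difference (half-nonneg c) (upper-half (left c) (right c))

    record Halves (c c′ : Cell) : Set where
      field
        left≤   : left c ≤ left c′
        right≥  : right c′ ≤ right c
        halved  : right c′ - left c′ ≈ ½ * (right c - left c)

    next : ∀ c → ∃ (Halves c)
    next c = choose (sparse-half (left≤middle c) (middle≤right c) (sparse c))
      where
      choose : Sparse (left c) (middle c) ⊎ Sparse (middle c) (right c) → ∃ (Halves c)
      choose (inj₁ sp) =
        record { left = left c ; right = middle c ; left≤right = left≤middle c ; sparse = sp } ,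
        record { left≤ = ≤-refl ; right≥ = middle≤right c
               ; halved = +-cancel (left c) (½ * (right c - left c)) }
      choose (inj₂ sp) =
        record { left = middle c ; right = right c ; left≤right = middle≤right c ; sparse = sp } ,
        record { left≤ = left≤middle c ; right≥ = ≤-refl ; halved = upper-half (left c) (right c) }

    cell : ℕ → Cell
    cell zero    = record { left≤right = proj₁ a<b ; sparse = sparse-start }
    cell (suc n) = proj₁ (next (cell n))

    module _ (n : ℕ) where
      open Halves (proj₂ (next (cell n))) public

    left-mono : ∀ {m n} → m ℕ.≤′ n → left (cell m) ≤ left (cell n)
    left-mono ℕ.≤′-refl              = ≤-refl
    left-mono {n = suc n} (ℕ.≤′-step m≤n) = ≤-trans (left-mono m≤n) (left≤ n)

    right-anti : ∀ {m n} → m ℕ.≤′ n → right (cell n) ≤ right (cell m)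
    right-anti ℕ.≤′-refl              = ≤-refl
    right-anti {n = suc n} (ℕ.≤′-step m≤n) = ≤-trans (right≥ n) (right-anti m≤n)

    left≤right′ : ∀ m n → left (cell m) ≤ right (cell n)
    left≤right′ m n with ℕ.≤-total m n
    ... | inj₁ m≤n = ≤-trans (left-mono (ℕ.≤⇒≤′ m≤n)) (left≤right (cell n))
    ... | inj₂ n≤m = ≤-trans (left≤right (cell m)) (right-anti (ℕ.≤⇒≤′ n≤m))

    width : ∀ n → right (cell n) - left (cell n) ≈ (b - a) * ½ ↑ n
    width zero    = sym (*-identityʳ _)
    width (suc n) = trans (halved n) (trans (*-congˡ (width n))
      (solve 3 (λ h w p → h :* (w :* p) := w :* (h :* p)) refl ½ (b - a) (½ ↑ n)))

    private
      IsLeft : Pred Carrier 0ℓ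
      IsLeft y = ∃ λ n → y ≈ left (cell n)

      abstract
        limit : ∃ λ y → UpperBound IsLeft y × (∀ z → UpperBound IsLeft z → y ≤ z)
        limit = supremum IsLeft (_ , 0 , refl) (b , λ y (n , eq) → ≤-respˡ-≈ (sym eq) (left≤right′ n 0))

    p : Carrier
    p = proj₁ limit

    left≤p : ∀ n → left (cell n) ≤ p
    left≤p n = proj₁ (proj₂ limit) _ (n , refl)

    p≤right : ∀ n → p ≤ right (cell n)
    p≤right n = proj₂ (proj₂ limit) _ λ y (m , eq) → ≤-respˡ-≈ (sym eq) (left≤right′ m n)

    -- Strict, so that every late enough cell around p lies within the k-th interval. Covering boxes
    -- are closed, and for this reason they are enlarged before the bisection is applied to them.
    Inside : ℕ → Set
    Inside k = l k < p × p < u k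

    private
      Dense : ℕ → ℕ → Set
      Dense k n = indicator (Inside k) * (right (cell n) - left (cell n)) ≤
                  meet (l k) (u k) (left (cell n)) (right (cell n))

      width≤ : ∀ {d} → 0# < d → ∃ λ n₀ → ∀ n → n₀ ℕ.≤ n → right (cell n) - left (cell n) ≤ d
      width≤ {d} 0<d = proj₁ small , λ n n₀≤n → ≤-respˡ-≈ (sym (width n))
          (≤-trans (*-monoˡ-≤ 0≤b-a (½-antitone n₀≤n)) (proj₁ (proj₂ small)))
        where
        small : ∃ λ n₀ → (b - a) * ½ ↑ n₀ < d
        small = archimedean-½ (b - a) 0<d

      module _ (k n : ℕ) where
        y = left (cell n)
        r = right (cell n)

        dense-outside : ¬ Inside k → Dense k n
        dense-outside outside = ≤-respˡ-≈ (sym (trans (*-congʳ (indicator-false outside)) (zeroˡ (r - y))))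
          (meet-nonneg (l≤u k) (left≤right (cell n)))

        dense-inside : Inside k → r - y ≤ p - l k → r - y ≤ u k - p → Dense k n
        dense-inside inside below above = ≤-reflexive (trans
          (trans (*-congʳ (indicator-true inside)) (*-identityˡ (r - y)))
          (sym (meet-inside
            (≤-by-difference (+-nonneg (0≤y-x below) (0≤y-x (p≤right n)))
              (solve 4 (λ y r l p → y :- l := ((p :- l) :- (r :- y)) :+ (r :- p)) refl y r (l k) p))
            (left≤right (cell n))
            (≤-by-difference (+-nonneg (0≤y-x above) (0≤y-x (left≤p n)))
              (solve 4 (λ y r u p → u :- r := ((u :- p) :- (r :- y)) :+ (p :- y)) refl y r (u k) p)))))

      dense : ∀ k → ∃ λ n₀ → ∀ n → n₀ ℕ.≤ n → Dense k n
      dense k = by-cases em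
        where
        by-cases : Dec (Inside k) → ∃ λ n₀ → ∀ n → n₀ ℕ.≤ n → Dense k n
        by-cases (no outside) = 0 , λ n _ → dense-outside k n outside
        by-cases (yes inside) = n₁ ℕ.⊔ n₂ , λ n le → dense-inside k n inside
            (proj₂ below n (ℕ.≤-trans (ℕ.m≤m⊔n n₁ n₂) le)) (proj₂ above n (ℕ.≤-trans (ℕ.m≤n⊔m n₁ n₂) le))
          where
          below = width≤ (0<y-x (proj₁ inside))
          above = width≤ (0<y-x (proj₂ inside))
          n₁ = proj₁ below
          n₂ = proj₁ above

    -- For fixed N there is one stage at which each of the first N intervals with p in its interior
    -- contains the whole cell. There the mass of the cell is at least its width times the weights
    -- of these intervals, and dividing the sparsity of the cell by its positive width gives the
    -- bound. No limit is interchanged with a sum.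
    inside-sparse : ∀ N → partialSum (λ k → (b - a) * indicator (Inside k) * weights k) N ≤ τ
    inside-sparse N = *-cancelˡ-≤ 0<w (begin
      w * partialSum (λ k → (b - a) * indicator (Inside k) * weights k) N
        ≈⟨ *-distribˡ-sum {N} w _ ⟩
      sum {N} (λ k → w * ((b - a) * indicator (Inside (toℕ k)) * weights (toℕ k)))
        ≤⟨ sum-mono-≤ {N} (λ k → ≤-respˡ-≈
             (solve 4 (λ w z i r → z :* (i :* w :* r) := w :* (z :* i :* r)) refl w (b - a) _ _)
             (*-monoˡ-≤ 0≤b-a (*-monoʳ-≤ (weights-nonneg (toℕ k)) (proj₂ good k)))) ⟩
      sum {N} (λ k → (b - a) * (meet (l (toℕ k)) (u (toℕ k)) (left (cell n)) (right (cell n)) * weights (toℕ k)))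
        ≈⟨ sym (*-distribˡ-sum {N} (b - a) _) ⟩
      (b - a) * mass (left (cell n)) (right (cell n)) N
        ≤⟨ sparse (cell n) N ⟩
      τ * w
        ≈⟨ *-comm τ w ⟩
      w * τ ∎)
      where
      open ≤-Reasoning
      good = eventually-all Dense dense N
      n = proj₁ good
      w = right (cell n) - left (cell n)
      0<w : 0# < w
      0<w = <-resp-≈ refl (sym (width n)) (*-pos (0<y-x a<b) (↑-pos n 0<½))

  open Box

  tailBox : ∀ {d} → Box (suc d) → Box d
  tailBox box = record
    { lower = λ i → lower box (suc i) ; upper = λ i → upper box (suc i) ; lower≤upper = λ i → lower≤upper box (suc i) }

  volume-nonneg : ∀ {d} (box : Box d) → 0# ≤ volume box
  volume-nonneg box = product-nonneg λ i → 0≤y-x (lower≤upper box i)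

  Interior : ∀ {d} → Box d → Pred (ℝ^ d) 0ℓ
  Interior box v = ∀ i → lower box i < v i × v i < upper box i

  -- The coordinates of p are found one at a time; slicing at each of them
  -- multiplies the weight of every box containing it by the side of [a , b].
  sparse-point : ∀ {d} (a b : ℝ^ d) → (∀ i → a i < b i) → (box : ℕ → Box d) →
    (weights : ℕ → Carrier) → (∀ k → 0# ≤ weights k) →
    ∀ τ → (∀ N → partialSum (λ k → volume (box k) * weights k) N ≤ τ) →
    ∃ λ p → (∀ i → a i ≤ p i × p i ≤ b i) ×
            (∀ k → Interior (box k) p → product (λ i → b i - a i) * weights k ≤ τ)
  -- Without coordinates every box has volume 1, the empty product, so the bound on the total weight
  -- bounds each single weight.
  sparse-point {zero} a b a<b box weights 0≤w τ total≤τ =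
    Vector.[] , (λ ()) , λ k _ → ≤-trans
      (term≤partialSum (λ j → *-nonneg 0≤1 (0≤w j)) k)
      (total≤τ (suc k))
  sparse-point {suc d} a b a<b box weights 0≤w τ total≤τ =
    point′ , bounds , estimate
    where
    tail-volume : ℕ → Carrier
    tail-volume k = volume (tailBox (box k))

    open Bisection (a zero) (b zero) (a<b zero) τ
      (λ k → lower (box k) zero) (λ k → upper (box k) zero) (λ k → tail-volume k * weights k)
      (λ k → lower≤upper (box k) zero) (λ k → *-nonneg (volume-nonneg (tailBox (box k))) (0≤w k))
      (λ N → ≤-respˡ-≈ (sum-cong-≋ {N} λ k → *-assoc _ _ _) (total≤τ N))

    sliced : ℕ → Carrier
    sliced k = (b zero - a zero) * indicator (Inside k) * weights k

    rest : ∃ λ p′ → (∀ i → a (suc i) ≤ p′ i × p′ i ≤ b (suc i)) ×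
           (∀ k → Interior (tailBox (box k)) p′ → product (λ i → b (suc i) - a (suc i)) * sliced k ≤ τ)
    rest = sparse-point (λ i → a (suc i)) (λ i → b (suc i)) (λ i → a<b (suc i)) (λ k → tailBox (box k))
      sliced (λ k → *-nonneg (*-nonneg 0≤b-a (indicator-nonneg (Inside k))) (0≤w k)) τ
      (λ N → ≤-respˡ-≈ (sum-cong-≋ {N} λ k →
          solve 3 (λ s v w → s :* (v :* w) := v :* (s :* w)) refl
            ((b zero - a zero) * indicator (Inside (toℕ k))) (tail-volume (toℕ k)) (weights (toℕ k)))
        (inside-sparse N))

    point′ : ℝ^ (suc d)
    point′ = p Vector.∷ proj₁ rest

    bounds : ∀ i → a i ≤ point′ i × point′ i ≤ b i
    bounds zero    = left≤p 0 , p≤right 0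
    bounds (suc i) = proj₁ (proj₂ rest) i

    estimate : ∀ k → Interior (box k) point′ → product (λ i → b i - a i) * weights k ≤ τ
    estimate k inside = ≤-respˡ-≈
      (trans (*-congˡ (*-congʳ (trans (*-congˡ (indicator-true (inside zero))) (*-identityʳ _))))
        (solve 3 (λ s v w → v :* (s :* w) := s :* v :* w) refl
          (b zero - a zero) (product (λ i → b (suc i) - a (suc i))) (weights k)))
      (proj₂ (proj₂ rest) k (λ i → inside (suc i)))

  -- Half of δ pays for the enlarged remaining factors multiplied by the first one, the other half
  -- for enlarging the first factor once the others are fixed. The divisors are 1 + `w₀` and 1 +
  -- `R′` because `w₀` and `R′` may vanish.
  fatten : ∀ {d} (w : ℝ^ d) → (∀ i → 0# ≤ w i) → ∀ {δ} → 0# < δ →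
           ∃ λ (η : ℝ^ d) → (∀ i → 0# < η i) × product (λ i → w i + η i) ≤ product w + δ
  fatten {zero} w 0≤w {δ} 0<δ = Vector.[] , (λ ()) , ≤-respˡ-≈ (+-identityʳ 1#) (+-mono-≤ ≤-refl (proj₁ 0<δ))
  fatten {suc d} w 0≤w {δ} 0<δ = η₀ Vector.∷ η′ , positive , estimate
    where
    w₀ = w zero
    w′ : ℝ^ d
    w′ i = w (suc i)
    inv₁ = inverse-pos (+-pos-nonneg 0<1 (0≤w zero))
    δ′ = ½ * δ * proj₁ inv₁
    rest = fatten w′ (λ i → 0≤w (suc i)) (*-pos (*-pos 0<½ 0<δ) (proj₁ (proj₂ inv₁)))
    η′ = proj₁ rest
    R = product w′
    R′ = product (λ i → w′ i + η′ i)
    0≤R′ : 0# ≤ R′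
    0≤R′ = product-nonneg λ i → +-nonneg (0≤w (suc i)) (proj₁ (proj₁ (proj₂ rest) i))
    inv₂ = inverse-pos (+-pos-nonneg 0<1 0≤R′)
    η₀ = ½ * δ * proj₁ inv₂

    positive : ∀ i → 0# < (η₀ Vector.∷ η′) i
    positive zero    = *-pos (*-pos 0<½ 0<δ) (proj₁ (proj₂ inv₂))
    positive (suc i) = proj₁ (proj₂ rest) i

    absorb : ∀ {y i} → 0# ≤ i → (1# + y) * i ≈ 1# → y * (½ * δ * i) ≤ ½ * δ
    absorb {y} {i} 0≤i eq = ≤-respʳ-≈
      (trans (*-congˡ eq) (*-identityʳ _))
      (≤-by-difference (*-nonneg (*-nonneg 0≤½ (proj₁ 0<δ)) 0≤i)
        (solve 3 (λ y h i → h :* ((con (+ 1) :+ y) :* i) :- y :* (h :* i) := h :* i) refl y (½ * δ) i))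

    estimate : (w₀ + η₀) * R′ ≤ w₀ * R + δ
    estimate = begin
      (w₀ + η₀) * R′                       ≈⟨ distribʳ R′ w₀ η₀ ⟩
      w₀ * R′ + η₀ * R′                    ≤⟨ +-mono-≤ (*-monoˡ-≤ (0≤w zero) (proj₂ (proj₂ rest))) (≤-reflexive (*-comm η₀ R′)) ⟩
      w₀ * (R + δ′) + R′ * η₀              ≈⟨ +-congʳ (distribˡ w₀ R δ′) ⟩
      (w₀ * R + w₀ * δ′) + R′ * η₀         ≤⟨ +-mono-≤ (+-mono-≤ ≤-refl (absorb (proj₁ (proj₁ (proj₂ inv₁))) (proj₂ (proj₂ inv₁))))
                                                       (absorb (proj₁ (proj₁ (proj₂ inv₂))) (proj₂ (proj₂ inv₂))) ⟩
      (w₀ * R + ½ * δ) + ½ * δ             ≈⟨ +-assoc _ _ _ ⟩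
      w₀ * R + (½ * δ + ½ * δ)             ≈⟨ +-congˡ (½x+½x≈x δ) ⟩
      w₀ * R + δ                           ∎
      where open ≤-Reasoning

  fattenBox : ∀ {d} (box : Box d) {δ} → 0# < δ →
              ∃ λ (box′ : Box d) → Contains box ⊆ Interior box′ × volume box′ ≤ volume box + δ
  fattenBox {d} box {δ} 0<δ = box′ , inside , ≤-respˡ-≈ (product-cong same) (proj₂ (proj₂ fat))
    where
    fat : ∃ λ (η : ℝ^ d) → (∀ i → 0# < η i) × product (λ i → (upper box i - lower box i) + η i) ≤ volume box + δ
    fat = fatten (λ i → upper box i - lower box i) (λ i → 0≤y-x (lower≤upper box i)) 0<δ
    margin : ℝ^ d
    margin i = ½ * proj₁ fat i
    0<margin : ∀ i → 0# < margin i
    0<margin i = *-pos 0<½ (proj₁ (proj₂ fat) i)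
    below : ∀ y i → y - margin i < y
    below y i = <-by-difference (0<margin i) (solve 2 (λ y m → y :- (y :- m) := m) refl y (margin i))
    above : ∀ y i → y < y + margin i
    above y i = <-by-difference (0<margin i) (solve 2 (λ y m → (y :+ m) :- y := m) refl y (margin i))
    box′ : Box d
    box′ = record
      { lower = λ i → lower box i - margin i ; upper = λ i → upper box i + margin i
      ; lower≤upper = λ i → ≤-trans (proj₁ (below (lower box i) i)) (≤-trans (lower≤upper box i) (proj₁ (above (upper box i) i))) }
    inside : Contains box ⊆ Interior box′
    inside {v} contains i = <-≤-trans (below (lower box i) i) (proj₁ (contains i)) ,
                            ≤-<-trans (proj₂ (contains i)) (above (upper box i) i)
    same : ∀ i → (upper box i - lower box i) + proj₁ fat i ≈ (upper box i + margin i) - (lower box i - margin i)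
    same i = trans (+-congˡ (sym (½x+½x≈x (proj₁ fat i))))
      (solve 3 (λ u l m → (u :- l) :+ (m :+ m) := (u :+ m) :- (l :- m)) refl (upper box i) (lower box i) (margin i))

  geometric : ∀ N {ε} → 0# ≤ ε → partialSum (λ k → ε * ½ ↑ suc k) N ≤ ε
  geometric zero    0≤ε = 0≤ε
  geometric (suc N) {ε} 0≤ε = begin
    ε * ½ ↑ 1 + partialSum (λ k → ε * ½ ↑ suc (suc k)) N        ≈⟨ +-cong (trans (*-congˡ (*-identityʳ ½)) (*-comm ε ½))
      (sum-cong-≋ {N} λ k → solve 3 (λ e h p → e :* (h :* p) := (h :* e) :* p) refl ε ½ (½ ↑ suc (toℕ k))) ⟩
    ½ * ε + partialSum (λ k → ½ * ε * ½ ↑ suc k) N              ≤⟨ +-mono-≤ ≤-refl (geometric N (*-nonneg 0≤½ 0≤ε)) ⟩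
    ½ * ε + ½ * ε                                               ≈⟨ ½x+½x≈x ε ⟩
    ε                                                           ∎
    where open ≤-Reasoning

  -- Let V be the volume of [a , b] and ε = V/2. Enlarging the k-th box of a cover by at most
  -- ε/2^(k+1) in volume turns a total of t into at most ε + t. The point given by `sparse-point`
  -- lies in some box of the cover, hence in the interior of the enlarged one, and the estimate
  -- there reads V ≤ ε + t, that is ε ≤ t.
  box-positive : ∀ {d} {S : Pred (ℝ^ d) 0ℓ} (a b : ℝ^ d) → (∀ i → a i < b i) →
                 (∀ v → (∀ i → a i ≤ v i × v i ≤ b i) → S v) → PositiveMeasure S
  box-positive {d} {S} a b a<b Q⊆S = ε , *-pos 0<½ 0<V , bound
    where
    V = product (λ i → b i - a i)
    0<V : 0# < V
    0<V = product-pos λ i → 0<y-x (a<b i)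
    ε = ½ * V

    bound : ∀ t → CoveredWithin S t → ε ≤ t
    bound t (box , covers , sums≤t) = +-cancelˡ-≤ ε
        (≤-respˡ-≈ (sym (½x+½x≈x V)) (≤-respˡ-≈ (*-identityʳ V)
          (proj₂ (proj₂ sparse) k (proj₁ (proj₂ (fat k)) (proj₂ hit)))))
      where
      fat : ∀ k → ∃ λ (box′ : Box d) → Contains (box k) ⊆ Interior box′ × volume box′ ≤ volume (box k) + ε * ½ ↑ suc k
      fat k = fattenBox (box k) (*-pos (*-pos 0<½ 0<V) (↑-pos (suc k) 0<½))

      sparse : ∃ λ p → (∀ i → a i ≤ p i × p i ≤ b i) ×
               (∀ k → Interior (proj₁ (fat k)) p → V * 1# ≤ ε + t)
      sparse = sparse-point a b a<b (λ k → proj₁ (fat k)) (λ _ → 1#) (λ _ → 0≤1) (ε + t) λ N → begin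
        partialSum (λ k → volume (proj₁ (fat k)) * 1#) N
          ≤⟨ sum-mono-≤ {N} (λ k → ≤-respˡ-≈ (sym (*-identityʳ _)) (proj₂ (proj₂ (fat (toℕ k))))) ⟩
        partialSum (λ k → volume (box k) + ε * ½ ↑ suc k) N
          ≈⟨ ∑-distrib-+ {N} _ _ ⟩
        partialSum (λ k → volume (box k)) N + partialSum (λ k → ε * ½ ↑ suc k) N
          ≤⟨ +-mono-≤ (sums≤t N) (geometric N (proj₁ (*-pos 0<½ 0<V))) ⟩
        t + ε
          ≈⟨ +-comm t ε ⟩
        ε + t ∎
        where open ≤-Reasoning

      hit : ∃ λ k → Contains (box k) (proj₁ sparse)
      hit = covers (proj₁ sparse) (Q⊆S (proj₁ sparse) (proj₁ (proj₂ sparse)))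
      k = proj₁ hit

-- Flat boxes and hyperplanes are null.

module NullSets (em : ExcludedMiddle 0ℓ) (ℝ : CompleteOrderedField) where

  open CompleteOrderedField ℝ hiding (zero)
  open Over ℝ
  open OrderedField em ℝ
  open PositiveBoxes em ℝ using (partialSum; volume-nonneg)
  open RingSolver ℝ
  open Box

  null⇒¬positive : ∀ {d} {S : Pred (ℝ^ d) 0ℓ} → (∀ {ε} → 0# < ε → CoveredWithin S ε) → ¬ PositiveMeasure S
  null⇒¬positive null (ε , 0<ε , bound) = <⇒≱ ½ε<ε (bound (½ * ε) (null 0<½ε))
    where
    0<½ε = *-pos 0<½ 0<ε
    ½ε<ε = <-by-difference 0<½ε (trans (+-congʳ (sym (½x+½x≈x ε)))
             (solve 1 (λ h → (h :+ h) :- h := h) refl (½ * ε)))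

  product-zero : ∀ {d} (u : ℝ^ d) i → u i ≈ 0# → product u ≈ 0#
  product-zero u zero    eq = trans (*-congʳ eq) (zeroˡ _)
  product-zero u (suc i) eq = trans (*-congˡ (product-zero (λ j → u (suc j)) i eq)) (zeroʳ _)

  flat-volume : ∀ {d} (box : Box d) i → lower box i ≈ upper box i → volume box ≈ 0#
  flat-volume box i eq = product-zero _ i (trans (+-congˡ (-‿cong eq)) (-‿inverseʳ _))

  flat⇒¬positive : ∀ {d} {S : Pred (ℝ^ d) 0ℓ} (box : Box d) i → lower box i ≈ upper box i →
                   (∀ v → S v → Contains box v) → ¬ PositiveMeasure S
  flat⇒¬positive box i eq S⊆ = null⇒¬positive λ {ε} 0<ε →
    (λ _ → box) , (λ v Sv → 0 , S⊆ v Sv) ,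
    λ N → ≤-respˡ-≈ (sym (trans (sum-cong-≋ {N} (λ _ → flat-volume box i eq)) (sum-replicate-zero N))) (proj₁ 0<ε)

  totalVolume : ∀ {d} → List (Box d) → Carrier
  totalVolume []           = 0#
  totalVolume (box ∷ boxes) = volume box + totalVolume boxes

  totalVolume-++ : ∀ {d} (xs ys : List (Box d)) → totalVolume (xs ++ ys) ≈ totalVolume xs + totalVolume ys
  totalVolume-++ []       ys = sym (+-identityˡ _)
  totalVolume-++ (b ∷ xs) ys = trans (+-congˡ (totalVolume-++ xs ys)) (sym (+-assoc _ _ _))

  FinitelyCovered : ∀ {d} → Pred (ℝ^ d) 0ℓ → Carrier → Set
  FinitelyCovered {d} S t = ∃ λ (boxes : List (Box d)) →
    (∀ v → S v → Any (λ box → Contains box v) boxes) × totalVolume boxes ≤ t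

  covered-∪ : ∀ {d} {S S₁ S₂ : Pred (ℝ^ d) 0ℓ} {t} → (∀ v → S v → S₁ v ⊎ S₂ v) →
    FinitelyCovered S₁ t → FinitelyCovered S₂ t → FinitelyCovered S (t + t)
  covered-∪ {S = S} S⊆ (xs , cov₁ , vol₁) (ys , cov₂ , vol₂) =
    xs ++ ys , (λ v Sv → pick v (S⊆ v Sv)) , ≤-respˡ-≈ (sym (totalVolume-++ xs ys)) (+-mono-≤ vol₁ vol₂)
    where
    pick : ∀ v → _ → Any (λ box → Contains box v) (xs ++ ys)
    pick v (inj₁ S₁v) = Any.++⁺ˡ (cov₁ v S₁v)
    pick v (inj₂ S₂v) = Any.++⁺ʳ xs (cov₂ v S₂v)

  -- Concatenates the lists boxes 0, boxes 1, …, separated by empty boxes so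
  -- that every step of the stream is productive.
  module Concatenation {d : ℕ} (boxes : ℕ → List (Box (suc d))) where

    -- The separator must cost nothing, hence the dimension `suc d`: in dimension 0 even a point has
    -- volume 1.
    point-box : Box (suc d)
    point-box = record { lower = λ _ → 0# ; upper = λ _ → 0# ; lower≤upper = λ _ → ≤-refl }

    stream : List (Box (suc d)) → ℕ → ℕ → Box (suc d)
    stream []       k zero    = point-box
    stream []       k (suc i) = stream (boxes k) (suc k) i
    stream (b ∷ bs) k zero    = b
    stream (b ∷ bs) k (suc i) = stream bs k i

    module _ {P : Pred (Box (suc d)) 0ℓ} where

      reach-list : ∀ {xs} k → Any P xs → ∃ λ i → P (stream xs k i)
      reach-list k (here p)   = 0 , p
      reach-list k (there ps) with reach-list k ps
      ... | i , p = suc i , p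

      reach : ∀ m k xs → Any P (boxes (m ℕ.+ k)) → ∃ λ i → P (stream xs k i)
      reach m       k (x ∷ xs) ps with reach m k xs ps
      ... | i , p = suc i , p
      reach zero    k [] ps with reach-list (suc k) ps
      ... | i , p = suc i , p
      reach (suc m) k [] ps with reach m (suc k) (boxes k) (≡.subst (λ j → Any P (boxes j)) (≡.sym (ℕ.+-suc m k)) ps)
      ... | i , p = suc i , p

    -- The summand ε/2^k is the tail of the geometric series that pays for all lists from the k-th
    -- on; opening the k-th list spends half of it.
    stream-volume : ∀ {ε} → 0# ≤ ε → (∀ k → totalVolume (boxes k) ≤ ε * ½ ↑ suc k) →
      ∀ N xs k → partialSum (λ i → volume (stream xs k i)) N ≤ totalVolume xs + ε * ½ ↑ k
    stream-volume {ε} 0≤ε small zero xs k = +-nonneg (totalVolume-nonneg xs) (*-nonneg 0≤ε (↑-nonneg k 0≤½))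
      where
      totalVolume-nonneg : ∀ xs → 0# ≤ totalVolume xs
      totalVolume-nonneg []       = ≤-refl
      totalVolume-nonneg (b ∷ xs) = +-nonneg (volume-nonneg b) (totalVolume-nonneg xs)
    stream-volume {ε} 0≤ε small (suc N) (b ∷ xs) k =
      ≤-respʳ-≈ (sym (+-assoc _ _ _)) (+-mono-≤ ≤-refl (stream-volume 0≤ε small N xs k))
    stream-volume {ε} 0≤ε small (suc N) [] k = begin
      volume point-box + partialSum (λ i → volume (stream (boxes k) (suc k) i)) N
        ≤⟨ +-mono-≤ (≤-reflexive (flat-volume point-box zero refl)) (stream-volume 0≤ε small N (boxes k) (suc k)) ⟩
      0# + (totalVolume (boxes k) + ε * ½ ↑ suc k)
        ≤⟨ +-mono-≤ ≤-refl (+-mono-≤ (small k) ≤-refl) ⟩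
      0# + (ε * ½ ↑ suc k + ε * ½ ↑ suc k)
        ≈⟨ +-congˡ (trans (solve 3 (λ e h p → e :* (h :* p) :+ e :* (h :* p) := (h :+ h) :* (e :* p)) refl ε ½ (½ ↑ k))
             (trans (*-congʳ ½+½≈1) (*-identityˡ _))) ⟩
      0# + ε * ½ ↑ k ∎
      where open ≤-Reasoning

  countably-covered : ∀ {d} {S : Pred (ℝ^ (suc d)) 0ℓ} (piece : ℕ → Pred (ℝ^ (suc d)) 0ℓ) →
    (∀ v → S v → ∃ λ k → piece k v) → ∀ {ε} → 0# ≤ ε →
    (∀ k → FinitelyCovered (piece k) (ε * ½ ↑ suc k)) → CoveredWithin S ε
  countably-covered {S = S} piece S⊆ {ε} 0≤ε cover =
    stream [] 0 , (λ v Sv → hit v (S⊆ v Sv)) ,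
    λ N → ≤-respʳ-≈ (trans (+-identityˡ _) (*-identityʳ ε)) (stream-volume 0≤ε (λ k → proj₂ (proj₂ (cover k))) N [] 0)
    where
    open Concatenation (λ k → proj₁ (cover k))
    hit : ∀ v → (∃ λ k → piece k v) → ∃ λ i → Contains (stream [] 0 i) v
    hit v (k , pv) = reach k 0 [] (≡.subst (λ j → Any (λ box → Contains box v) (proj₁ (cover j)))
      (≡.sym (ℕ.+-identityʳ k)) (proj₁ (proj₂ (cover k)) v pv))

  Within : Carrier → Carrier → Carrier → Set
  Within y a h = a ≤ y × y ≤ a + h

  within-split : ∀ {y a h} → Within y a h → Within y a (½ * h) ⊎ Within y (a + ½ * h) (½ * h)
  within-split {y} {a} {h} (a≤y , y≤a+h) with total y (a + ½ * h)
  ... | inj₁ y≤m = inj₁ (a≤y , y≤m)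
  ... | inj₂ m≤y = inj₂ (m≤y , ≤-respʳ-≈ (trans (+-congˡ (sym (½x+½x≈x h))) (sym (+-assoc _ _ _))) y≤a+h)

  absolute : ∀ g → ∃ λ s → 0# ≤ s × (∀ {y h} → 0# ≤ y → y ≤ h → g * y ≤ s * h × - (s * h) ≤ g * y)
  absolute g with total 0# g
  ... | inj₁ 0≤g = g , 0≤g , λ {y} {h} 0≤y y≤h → *-monoˡ-≤ 0≤g y≤h ,
    ≤-trans (≤-by-difference (*-nonneg 0≤g (≤-trans 0≤y y≤h)) (solve 1 (λ p → con (+ 0) :- :- p := p) refl (g * h))) (*-nonneg 0≤g 0≤y)
  ... | inj₂ g≤0 = - g , 0≤-g , λ {y} {h} 0≤y y≤h →
    ≤-trans (≤-by-difference (*-nonneg 0≤-g 0≤y) (solve 2 (λ g y → con (+ 0) :- g :* y := :- g :* y) refl g y)) (*-nonneg 0≤-g (≤-trans 0≤y y≤h)) ,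
    ≤-by-difference (*-nonneg 0≤-g (0≤y-x y≤h)) (solve 3 (λ g y h → g :* y :- :- (:- g :* h) := :- g :* (h :- y)) refl g y h)
    where
    0≤-g : 0# ≤ - g
    0≤-g = ≤-respʳ-≈ (+-identityˡ (- g)) (0≤y-x g≤0)

  punchIn-cases : ∀ {d} {P : Fin (suc d) → Set} j → P j → (∀ i → P (punchIn j i)) → ∀ i → P i
  punchIn-cases {P = P} j pj rest i with j Fin.≟ i
  ... | yes ≡.refl = pj
  ... | no j≢i     = ≡.subst P (Fin.punchIn-punchOut j≢i) (rest (punchOut j≢i))

  -- A hyperplane of ℝ⁴ that is the graph of a linear function of the
  -- coordinates other than the j-th: halving the side of a cube divides the
  -- volume of the box over it by 16, but only multiplies their number by 8.
  module Graph (j : Fin 4) (g₀ g₁ g₂ : Carrier) where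

    OnGraph : Pred (ℝ^ 4) 0ℓ
    OnGraph v = v j ≈ g₀ * v (punchIn j 0F) + g₁ * v (punchIn j 1F) + g₂ * v (punchIn j 2F)

    Slab : (a₀ a₁ a₂ h₀ h₁ h₂ : Carrier) → Pred (ℝ^ 4) 0ℓ
    Slab a₀ a₁ a₂ h₀ h₁ h₂ v =
      OnGraph v × Within (v (punchIn j 0F)) a₀ h₀ × Within (v (punchIn j 1F)) a₁ h₁ × Within (v (punchIn j 2F)) a₂ h₂

    -- A Lipschitz constant for the maximum norm: over a cube of side h the graph stays within
    -- `slope` times h of its value at the lower corner.
    s₀ s₁ s₂ slope : Carrier
    s₀ = proj₁ (absolute g₀)
    s₁ = proj₁ (absolute g₁)
    s₂ = proj₁ (absolute g₂)
    slope = s₀ + s₁ + s₂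

    0≤slope : 0# ≤ slope
    0≤slope = +-nonneg (+-nonneg (proj₁ (proj₂ (absolute g₀))) (proj₁ (proj₂ (absolute g₁)))) (proj₁ (proj₂ (absolute g₂)))

    module OneBox (a₀ a₁ a₂ h : Carrier) (0≤h : 0# ≤ h) where

      height : Carrier
      height = g₀ * a₀ + g₁ * a₁ + g₂ * a₂

      corner corner′ : ℝ^ 3
      corner  = a₀ Vector.∷ a₁ Vector.∷ a₂ Vector.∷ Vector.[]
      corner′ = (a₀ + h) Vector.∷ (a₁ + h) Vector.∷ (a₂ + h) Vector.∷ Vector.[]

      low high : ℝ^ 4
      low  = Vector.insertAt corner j (height - slope * h)
      high = Vector.insertAt corner′ j (height + slope * h)

      low-j : low j ≡ height - slope * h
      low-j = Vector.insertAt-lookup corner j (height - slope * h)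

      high-j : high j ≡ height + slope * h
      high-j = Vector.insertAt-lookup corner′ j (height + slope * h)

      low-in : ∀ i → low (punchIn j i) ≡ corner i
      low-in = Vector.insertAt-punchIn corner j (height - slope * h)

      high-in : ∀ i → high (punchIn j i) ≡ corner′ i
      high-in = Vector.insertAt-punchIn corner′ j (height + slope * h)

      0≤sh : 0# ≤ slope * h
      0≤sh = *-nonneg 0≤slope 0≤h

      corner≤ : ∀ i → corner i ≤ corner′ i
      corner≤ 0F = ≤-by-difference 0≤h (solve 2 (λ a h → (a :+ h) :- a := h) refl a₀ h)
      corner≤ 1F = ≤-by-difference 0≤h (solve 2 (λ a h → (a :+ h) :- a := h) refl a₁ h)
      corner≤ 2F = ≤-by-difference 0≤h (solve 2 (λ a h → (a :+ h) :- a := h) refl a₂ h)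

      box : Box 4
      box = record { lower = low ; upper = high ; lower≤upper = punchIn-cases j
        (≡.subst₂ _≤_ (≡.sym low-j) (≡.sym high-j) (≤-by-difference (+-nonneg 0≤sh 0≤sh)
          (solve 2 (λ t s → (t :+ s) :- (t :- s) := s :+ s) refl height (slope * h))))
        (λ i → ≡.subst₂ _≤_ (≡.sym (low-in i)) (≡.sym (high-in i)) (corner≤ i)) }

      contains : ∀ v → Slab a₀ a₁ a₂ h h h v → Contains box v
      contains v (eq , (b₀ , t₀) , (b₁ , t₁) , (b₂ , t₂)) = punchIn-cases j
        (≡.subst₂ (λ y z → y ≤ v j × v j ≤ z) (≡.sym low-j) (≡.sym high-j) (≥low , ≤high))
        (λ i → ≡.subst₂ (λ y z → y ≤ v (punchIn j i) × v (punchIn j i) ≤ z) (≡.sym (low-in i)) (≡.sym (high-in i)) (inner i))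
        where
        inner : ∀ i → corner i ≤ v (punchIn j i) × v (punchIn j i) ≤ corner′ i
        inner 0F = b₀ , t₀
        inner 1F = b₁ , t₁
        inner 2F = b₂ , t₂
        r₀ = v (punchIn j 0F)
        r₁ = v (punchIn j 1F)
        r₂ = v (punchIn j 2F)
        move : ∀ {y a} → y ≤ a + h → y - a ≤ h
        move {y} {a} le = ≤-by-difference (0≤y-x le) (solve 3 (λ y a h → h :- (y :- a) := (a :+ h) :- y) refl y a h)
        d₀ = proj₂ (proj₂ (absolute g₀)) (0≤y-x b₀) (move t₀)
        d₁ = proj₂ (proj₂ (absolute g₁)) (0≤y-x b₁) (move t₁)
        d₂ = proj₂ (proj₂ (absolute g₂)) (0≤y-x b₂) (move t₂)
        deviation : v j ≈ height + (g₀ * (r₀ - a₀) + g₁ * (r₁ - a₁) + g₂ * (r₂ - a₂))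
        deviation = trans eq (solve 9 (λ g₀ g₁ g₂ r₀ r₁ r₂ a₀ a₁ a₂ →
            g₀ :* r₀ :+ g₁ :* r₁ :+ g₂ :* r₂ :=
            (g₀ :* a₀ :+ g₁ :* a₁ :+ g₂ :* a₂) :+ (g₀ :* (r₀ :- a₀) :+ g₁ :* (r₁ :- a₁) :+ g₂ :* (r₂ :- a₂)))
          refl g₀ g₁ g₂ r₀ r₁ r₂ a₀ a₁ a₂)
        ≤high : v j ≤ height + slope * h
        ≤high = ≤-respˡ-≈ (sym deviation) (+-mono-≤ ≤-refl (≤-respʳ-≈
          (solve 4 (λ p q r h → p :* h :+ q :* h :+ r :* h := (p :+ q :+ r) :* h) refl s₀ s₁ s₂ h)
          (+-mono-≤ (+-mono-≤ (proj₁ d₀) (proj₁ d₁)) (proj₁ d₂))))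
        ≥low : height - slope * h ≤ v j
        ≥low = ≤-respʳ-≈ (sym deviation) (+-mono-≤ ≤-refl (≤-respˡ-≈
          (solve 4 (λ p q r h → :- (p :* h) :+ :- (q :* h) :+ :- (r :* h) := :- ((p :+ q :+ r) :* h)) refl s₀ s₁ s₂ h)
          (+-mono-≤ (+-mono-≤ (proj₂ d₀) (proj₂ d₁)) (proj₂ d₂))))

      volume-box : volume box ≈ (slope + slope) * (h ↑ 4)
      volume-box = begin
        product (λ i → high i - low i)
          ≈⟨ Algebra.Properties.CommutativeMonoid.Sum.sum-remove *-commutativeMonoid {i = j} (λ i → high i - low i) ⟩
        (high j - low j) * product (λ i → high (punchIn j i) - low (punchIn j i))
          ≡⟨ ≡.cong₂ (λ y z → (y - z) * product (λ i → high (punchIn j i) - low (punchIn j i))) high-j low-j ⟩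
        ((height + slope * h) - (height - slope * h)) * product (λ i → high (punchIn j i) - low (punchIn j i))
          ≡⟨ ≡.cong (((height + slope * h) - (height - slope * h)) *_)
               (Algebra.Properties.CommutativeMonoid.Sum.sum-cong-≗ *-commutativeMonoid (λ i → ≡.cong₂ _-_ (high-in i) (low-in i))) ⟩
        ((height + slope * h) - (height - slope * h)) * (((a₀ + h) - a₀) * (((a₁ + h) - a₁) * (((a₂ + h) - a₂) * 1#)))
          ≈⟨ solve 6 (λ t s h a₀ a₁ a₂ →
               ((t :+ s :* h) :- (t :- s :* h)) :* (((a₀ :+ h) :- a₀) :* (((a₁ :+ h) :- a₁) :* (((a₂ :+ h) :- a₂) :* con (+ 1)))) :=
               (s :+ s) :* (h :* (h :* (h :* (h :* con (+ 1)))))) refl height slope h a₀ a₁ a₂ ⟩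
        (slope + slope) * (h ↑ 4) ∎
        where open Relation.Binary.Reasoning.Setoid setoid

    halve₀ : ∀ {h₀ h₁ h₂ t} → (∀ a₀ a₁ a₂ → FinitelyCovered (Slab a₀ a₁ a₂ (½ * h₀) h₁ h₂) t) →
             ∀ a₀ a₁ a₂ → FinitelyCovered (Slab a₀ a₁ a₂ h₀ h₁ h₂) (t + t)
    halve₀ {h₀} cover a₀ a₁ a₂ = covered-∪ split (cover a₀ a₁ a₂) (cover (a₀ + ½ * h₀) a₁ a₂)
      where
      split : ∀ v → _ → _
      split v (eq , w₀ , w₁ , w₂) with within-split w₀
      ... | inj₁ w = inj₁ (eq , w , w₁ , w₂)
      ... | inj₂ w = inj₂ (eq , w , w₁ , w₂)

    halve₁ : ∀ {h₀ h₁ h₂ t} → (∀ a₀ a₁ a₂ → FinitelyCovered (Slab a₀ a₁ a₂ h₀ (½ * h₁) h₂) t) →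
             ∀ a₀ a₁ a₂ → FinitelyCovered (Slab a₀ a₁ a₂ h₀ h₁ h₂) (t + t)
    halve₁ {h₁ = h₁} cover a₀ a₁ a₂ = covered-∪ split (cover a₀ a₁ a₂) (cover a₀ (a₁ + ½ * h₁) a₂)
      where
      split : ∀ v → _ → _
      split v (eq , w₀ , w₁ , w₂) with within-split w₁
      ... | inj₁ w = inj₁ (eq , w₀ , w , w₂)
      ... | inj₂ w = inj₂ (eq , w₀ , w , w₂)

    halve₂ : ∀ {h₀ h₁ h₂ t} → (∀ a₀ a₁ a₂ → FinitelyCovered (Slab a₀ a₁ a₂ h₀ h₁ (½ * h₂)) t) →
             ∀ a₀ a₁ a₂ → FinitelyCovered (Slab a₀ a₁ a₂ h₀ h₁ h₂) (t + t)
    halve₂ {h₂ = h₂} cover a₀ a₁ a₂ = covered-∪ split (cover a₀ a₁ a₂) (cover a₀ a₁ (a₂ + ½ * h₂))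
      where
      split : ∀ v → _ → _
      split v (eq , w₀ , w₁ , w₂) with within-split w₂
      ... | inj₁ w = inj₁ (eq , w₀ , w₁ , w)
      ... | inj₂ w = inj₂ (eq , w₀ , w₁ , w)

    slab-cover : ∀ n {h} → 0# ≤ h → ∀ a₀ a₁ a₂ →
      FinitelyCovered (Slab a₀ a₁ a₂ h h h) ((slope + slope) * h ↑ 4 * ½ ↑ n)
    slab-cover zero {h} 0≤h a₀ a₁ a₂ = box ∷ [] , (λ v s → here (contains v s)) ,
      ≤-reflexive (trans (+-identityʳ _) (trans volume-box (sym (*-identityʳ _))))
      where open OneBox a₀ a₁ a₂ h 0≤h
    slab-cover (suc n) {h} 0≤h a₀ a₁ a₂ = proj₁ cover , proj₁ (proj₂ cover) , ≤-respʳ-≈ eq (proj₂ (proj₂ cover))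
      where
      t = (slope + slope) * (½ * h) ↑ 4 * ½ ↑ n
      cover : FinitelyCovered (Slab a₀ a₁ a₂ h h h) (((t + t) + (t + t)) + ((t + t) + (t + t)))
      cover = halve₀ (halve₁ (halve₂ (slab-cover n (*-nonneg 0≤½ 0≤h)))) a₀ a₁ a₂
      eq : ((t + t) + (t + t)) + ((t + t) + (t + t)) ≈ (slope + slope) * h ↑ 4 * ½ ↑ suc n
      eq = begin
        ((t + t) + (t + t)) + ((t + t) + (t + t))
          ≈⟨ solve 4 (λ s h p q → (let u = s :* ((p :* h) :* ((p :* h) :* ((p :* h) :* ((p :* h) :* con (+ 1))))) :* q in
               ((u :+ u) :+ (u :+ u)) :+ ((u :+ u) :+ (u :+ u))) :=
               (p :+ p) :* ((p :+ p) :* ((p :+ p) :* (s :* (h :* (h :* (h :* (h :* con (+ 1))))) :* (p :* q)))))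
             refl (slope + slope) h ½ (½ ↑ n) ⟩
        (½ + ½) * ((½ + ½) * ((½ + ½) * ((slope + slope) * h ↑ 4 * ½ ↑ suc n)))
          ≈⟨ *-cong ½+½≈1 (*-cong ½+½≈1 (*-congʳ ½+½≈1)) ⟩
        1# * (1# * (1# * ((slope + slope) * h ↑ 4 * ½ ↑ suc n)))
          ≈⟨ trans (*-identityˡ _) (trans (*-identityˡ _) (*-identityˡ _)) ⟩
        (slope + slope) * h ↑ 4 * ½ ↑ suc n ∎
        where open Relation.Binary.Reasoning.Setoid setoid

    side : ℕ → Carrier
    side k = 2# ↑ k + 2# ↑ k

    piece : ℕ → Pred (ℝ^ 4) 0ℓ
    piece k = Slab (- (2# ↑ k)) (- (2# ↑ k)) (- (2# ↑ k)) (side k) (side k) (side k)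

    2↑-mono : ∀ {m n} → m ℕ.≤ n → 2# ↑ m ≤ 2# ↑ n
    2↑-mono {n = zero}  ℕ.z≤n = ≤-refl
    2↑-mono {n = suc n} ℕ.z≤n = ≤-respˡ-≈ (*-identityˡ 1#)
      (*-mono-≤ 0≤1 (≤-by-difference 0≤1 (solve 0 ((con (+ 1) :+ con (+ 1)) :- con (+ 1) := con (+ 1)) refl))
        0≤1 (2↑-mono {n = n} ℕ.z≤n))
    2↑-mono (ℕ.s≤s m≤n) = *-monoˡ-≤ (proj₁ 0<2) (2↑-mono m≤n)

    within-eventually : ∀ y → ∃ λ k₀ → ∀ k → k₀ ℕ.≤ k → Within y (- (2# ↑ k)) (side k)
    within-eventually y = proj₁ above ℕ.⊔ proj₁ below , λ k le →
        let p = 2# ↑ k in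
        ≤-by-difference (0≤y-x (≤-trans (bound below) (2↑-mono (ℕ.≤-trans (ℕ.m≤n⊔m (proj₁ above) (proj₁ below)) le))))
          (solve 2 (λ y p → y :- :- p := p :- :- y) refl y p) ,
        ≤-by-difference (0≤y-x (≤-trans (bound above) (2↑-mono (ℕ.≤-trans (ℕ.m≤m⊔n (proj₁ above) (proj₁ below)) le))))
          (solve 2 (λ y p → :- p :+ (p :+ p) :- y := p :- y) refl y p)
      where
      above = archimedean y 0<1
      below = archimedean (- y) 0<1
      bound : ∀ {z} (a : ∃ λ k → z < 2# ↑ k * 1#) → z ≤ 2# ↑ proj₁ a
      bound (k , lt) = ≤-respʳ-≈ (*-identityʳ _) (proj₁ lt)

    exhaust : ∀ v → OnGraph v → ∃ λ k → piece k v
    exhaust v eq = k , eq , proj₂ e₀ k (ℕ.≤-trans (ℕ.m≤m⊔n _ _) (ℕ.m≤m⊔n _ _)) ,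
                   proj₂ e₁ k (ℕ.≤-trans (ℕ.m≤n⊔m (proj₁ e₀) _) (ℕ.m≤m⊔n _ _)) ,
                   proj₂ e₂ k (ℕ.m≤n⊔m (proj₁ e₀ ℕ.⊔ proj₁ e₁) _)
      where
      e₀ = within-eventually (v (punchIn j 0F))
      e₁ = within-eventually (v (punchIn j 1F))
      e₂ = within-eventually (v (punchIn j 2F))
      k = proj₁ e₀ ℕ.⊔ proj₁ e₁ ℕ.⊔ proj₁ e₂

    graph-null : ∀ {ε} → 0# < ε → CoveredWithin OnGraph ε
    graph-null {ε} 0<ε = countably-covered piece exhaust (proj₁ 0<ε) λ k →
      let depth = archimedean-½ ((slope + slope) * side k ↑ 4) (*-pos 0<ε (↑-pos (suc k) 0<½))
          0≤2ᵏ = ↑-nonneg k (proj₁ 0<2)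
          cover = slab-cover (proj₁ depth) (+-nonneg 0≤2ᵏ 0≤2ᵏ) (- (2# ↑ k)) (- (2# ↑ k)) (- (2# ↑ k))
      in proj₁ cover , proj₁ (proj₂ cover) , ≤-trans (proj₂ (proj₂ cover)) (proj₁ (proj₂ depth))

  hyperplane⇒¬positive : ∀ {S : Pred (ℝ^ 4) 0ℓ} (c : ℝ^ 4) j → ¬ c j ≈ 0# →
                         (∀ v → S v → c ∙ v ≈ 0#) → ¬ PositiveMeasure S
  hyperplane⇒¬positive {S} c j cⱼ≉0 S⊆ = null⇒¬positive λ 0<ε →
      let boxes , covers , sums = graph-null 0<ε in boxes , (λ v Sv → covers v (on-graph v (S⊆ v Sv))) , sums
    where
    i = proj₁ (inverse (c j) cⱼ≉0)
    c₀ = c (punchIn j 0F)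
    c₁ = c (punchIn j 1F)
    c₂ = c (punchIn j 2F)
    open Graph j (- (i * c₀)) (- (i * c₁)) (- (i * c₂))
    on-graph : ∀ v → c ∙ v ≈ 0# → OnGraph v
    on-graph v eq = begin
      v j
        ≈⟨ sym (*-identityˡ (v j)) ⟩
      1# * v j
        ≈⟨ *-congʳ (sym (proj₂ (inverse (c j) cⱼ≉0))) ⟩
      c j * i * v j
        ≈⟨ solve 9 (λ c₀ c₁ c₂ v₀ v₁ v₂ cⱼ i vⱼ → cⱼ :* i :* vⱼ :=
             i :* (cⱼ :* vⱼ :+ (c₀ :* v₀ :+ (c₁ :* v₁ :+ (c₂ :* v₂ :+ con (+ 0))))) :+
             (:- (i :* c₀) :* v₀ :+ :- (i :* c₁) :* v₁ :+ :- (i :* c₂) :* v₂)) refl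
             c₀ c₁ c₂ (v (punchIn j 0F)) (v (punchIn j 1F)) (v (punchIn j 2F)) (c j) i (v j) ⟩
      i * (c j * v j + sum (λ k → c (punchIn j k) * v (punchIn j k))) + rest
        ≈⟨ +-congʳ (*-congˡ (sym (Algebra.Properties.CommutativeMonoid.Sum.sum-remove +-commutativeMonoid {i = j} (λ k → c k * v k)))) ⟩
      i * (c ∙ v) + rest
        ≈⟨ +-congʳ (trans (*-congˡ eq) (zeroʳ i)) ⟩
      0# + rest
        ≈⟨ +-identityˡ rest ⟩
      rest ∎
      where
      open Relation.Binary.Reasoning.Setoid setoid
      rest = - (i * c₀) * v (punchIn j 0F) + - (i * c₁) * v (punchIn j 1F) + - (i * c₂) * v (punchIn j 2F)

-- Transition counts of sequences.

module TransitionCounts where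

  open import Data.Nat using (_+_; _*_; _∸_; _<_; _≤_; s≤s; z≤n)
  open import Relation.Binary.PropositionalEquality using (refl; sym; trans; cong; cong₂; subst)

  occurrences : State → State → List (State × State) → ℕ
  occurrences i j ts = length (filter (≡-dec Fin._≟_ Fin._≟_ (i , j)) ts)

  module _ {c ℓ} (M : CommutativeMonoid c ℓ) where

    open CommutativeMonoid M renaming (refl to ≈-refl; trans to ≈-trans)
    open Algebra.Definitions.RawMonoid rawMonoid using () renaming (_×_ to _·_)
    open Algebra.Solver.CommutativeMonoid M

    -- Needed in two monoids: additively for weights and multiplicatively for path probabilities. In
    -- both only the four counts matter.
    foldr-occurrences : (f : State × State → Carrier) (ts : List (State × State)) →
      foldr _∙_ ε (map f ts) ≈
        (occurrences 𝟎 𝟎 ts · f (𝟎 , 𝟎) ∙ occurrences 𝟎 𝟏 ts · f (𝟎 , 𝟏)) ∙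
        (occurrences 𝟏 𝟎 ts · f (𝟏 , 𝟎) ∙ occurrences 𝟏 𝟏 ts · f (𝟏 , 𝟏))
    foldr-occurrences f [] = solve 0 (id ⊜ (id ⊕ id) ⊕ (id ⊕ id)) ≈-refl
    foldr-occurrences f ((𝟎 , 𝟎) ∷ ts) = ≈-trans (∙-congˡ (foldr-occurrences f ts))
      (solve 5 (λ t p q r s → t ⊕ ((p ⊕ q) ⊕ (r ⊕ s)) ⊜ ((t ⊕ p) ⊕ q) ⊕ (r ⊕ s)) ≈-refl _ _ _ _ _)
    foldr-occurrences f ((𝟎 , 𝟏) ∷ ts) = ≈-trans (∙-congˡ (foldr-occurrences f ts))
      (solve 5 (λ t p q r s → t ⊕ ((p ⊕ q) ⊕ (r ⊕ s)) ⊜ (p ⊕ (t ⊕ q)) ⊕ (r ⊕ s)) ≈-refl _ _ _ _ _)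
    foldr-occurrences f ((𝟏 , 𝟎) ∷ ts) = ≈-trans (∙-congˡ (foldr-occurrences f ts))
      (solve 5 (λ t p q r s → t ⊕ ((p ⊕ q) ⊕ (r ⊕ s)) ⊜ (p ⊕ q) ⊕ ((t ⊕ r) ⊕ s)) ≈-refl _ _ _ _ _)
    foldr-occurrences f ((𝟏 , 𝟏) ∷ ts) = ≈-trans (∙-congˡ (foldr-occurrences f ts))
      (solve 5 (λ t p q r s → t ⊕ ((p ⊕ q) ⊕ (r ⊕ s)) ⊜ (p ⊕ q) ⊕ (r ⊕ (t ⊕ s))) ≈-refl _ _ _ _ _)

  sorted : ℕ → ℕ → ℕ → ℕ → List (State × State)
  sorted k l m n = replicate k (𝟎 , 𝟎) ++ replicate l (𝟎 , 𝟏) ++ replicate m (𝟏 , 𝟎) ++ replicate n (𝟏 , 𝟏)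

  -- A normal form: transition lists with the same four counts are permutations of one common list,
  -- so equivalence of paths from 0 can be tested on counts.
  sorted-↭ : ∀ ts → ts ↭ sorted (occurrences 𝟎 𝟎 ts) (occurrences 𝟎 𝟏 ts) (occurrences 𝟏 𝟎 ts) (occurrences 𝟏 𝟏 ts)
  sorted-↭ []               = Perm.refl
  sorted-↭ ((𝟎 , 𝟎) ∷ ts) = prep _ (sorted-↭ ts)
  sorted-↭ ((𝟎 , 𝟏) ∷ ts) = ↭-trans (prep _ (sorted-↭ ts))
    (↭-sym (Perm.shift (𝟎 , 𝟏) (replicate (occurrences 𝟎 𝟎 ts) (𝟎 , 𝟎)) _))
  sorted-↭ ((𝟏 , 𝟎) ∷ ts) = ↭-trans (prep _ (sorted-↭ ts)) (↭-sym (↭-trans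
    (Perm.++⁺ˡ (replicate (occurrences 𝟎 𝟎 ts) (𝟎 , 𝟎)) (Perm.shift (𝟏 , 𝟎) (replicate (occurrences 𝟎 𝟏 ts) (𝟎 , 𝟏)) _))
    (Perm.shift (𝟏 , 𝟎) (replicate (occurrences 𝟎 𝟎 ts) (𝟎 , 𝟎)) _)))
  sorted-↭ ((𝟏 , 𝟏) ∷ ts) = ↭-trans (prep _ (sorted-↭ ts)) (↭-sym (↭-trans
    (Perm.++⁺ˡ (replicate (occurrences 𝟎 𝟎 ts) (𝟎 , 𝟎)) (↭-trans
      (Perm.++⁺ˡ (replicate (occurrences 𝟎 𝟏 ts) (𝟎 , 𝟏)) (Perm.shift (𝟏 , 𝟏) (replicate (occurrences 𝟏 𝟎 ts) (𝟏 , 𝟎)) _))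
      (Perm.shift (𝟏 , 𝟏) (replicate (occurrences 𝟎 𝟏 ts) (𝟎 , 𝟏)) _)))
    (Perm.shift (𝟏 , 𝟏) (replicate (occurrences 𝟎 𝟎 ts) (𝟎 , 𝟎)) _)))

  counts : List State → Fin 4 → ℕ
  counts s = x 𝟎 𝟎 s Vector.∷ x 𝟎 𝟏 s Vector.∷ x 𝟏 𝟎 s Vector.∷ x 𝟏 𝟏 s Vector.∷ Vector.[]

  SameCounts : List State → List State → Set
  SameCounts s t = ∀ k → counts s k ≡ counts t k

  sameCounts⇒↭ : ∀ s t → SameCounts s t → transitions s ↭ transitions t
  sameCounts⇒↭ s t eq = ↭-trans (sorted-↭ (transitions s)) (↭-trans
    (↭-reflexive (trans (cong₂ (λ k l → sorted k l (x 𝟏 𝟎 s) (x 𝟏 𝟏 s)) (eq 0F) (eq 1F))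
                        (cong₂ (λ m n → sorted (x 𝟎 𝟎 t) (x 𝟎 𝟏 t) m n) (eq 2F) (eq 3F))))
    (↭-sym (sorted-↭ (transitions t))))

  ↭⇒sameCounts : ∀ s t → transitions s ↭ transitions t → SameCounts s t
  ↭⇒sameCounts s t p = λ where
      0F → count (𝟎 , 𝟎)
      1F → count (𝟎 , 𝟏)
      2F → count (𝟏 , 𝟎)
      3F → count (𝟏 , 𝟏)
    where
    count : ∀ ij → length (filter (≡-dec Fin._≟_ Fin._≟_ ij) (transitions s)) ≡
                   length (filter (≡-dec Fin._≟_ Fin._≟_ ij) (transitions t))
    count ij = Perm.↭-length (Perm.filter-↭ (≡-dec Fin._≟_ Fin._≟_ ij) p)

  -- The possible values of (x₀₀ , x₀₁ , x₁₀ , x₁₁) on sequences starting with 0: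
  -- returns counts sequences ending with 0, leaves those ending with 1.
  data Shape (n : ℕ) : (x₀₀ x₀₁ x₁₀ x₁₁ : ℕ) → Set where
    stays   : Shape n n 0 0 0
    returns : ∀ {a b} j → (a + b) + (2 * j + 2) ≡ n → Shape n a (suc j) (suc j) b
    leaves  : ∀ {a b} j → (a + b) + (2 * j + 1) ≡ n → Shape n a (suc j) j b

  extend-same : ∀ {n a p q b} → Shape n a p q b → Shape (suc n) (suc a) p q b
  extend-same stays          = stays
  extend-same (returns j eq) = returns j (cong suc eq)
  extend-same (leaves j eq)  = leaves j (cong suc eq)

  -- After a transition from 0 to 1 the rest of the sequence has one of the shapes with the roles of
  -- the states exchanged. Ending in its own first state 1 then means leaving 0 for the whole
  -- sequence, which is why `returns` and `leaves` trade places.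
  extend-switch : ∀ {n a p q b} → Shape n b q p a → Shape (suc n) a (suc p) q b
  extend-switch {n} stays = leaves 0 (ℕ.+-comm n 1)
  extend-switch {a = a} {b = b} (returns j refl) = leaves (suc j) (identity a b j)
    where
    identity : ∀ a b j → (a + b) + (2 * suc j + 1) ≡ suc ((b + a) + (2 * j + 2))
    identity = solve-∀
  extend-switch {a = a} {b = b} (leaves j refl) = returns j (identity a b j)
    where
    identity : ∀ a b j → (a + b) + (2 * j + 2) ≡ suc ((b + a) + (2 * j + 1))
    identity = solve-∀

  mutual
    shape₀ : ∀ s → Shape (length s) (x 𝟎 𝟎 (𝟎 ∷ s)) (x 𝟎 𝟏 (𝟎 ∷ s)) (x 𝟏 𝟎 (𝟎 ∷ s)) (x 𝟏 𝟏 (𝟎 ∷ s))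
    shape₀ []        = stays
    shape₀ (𝟎 ∷ s) = extend-same (shape₀ s)
    shape₀ (𝟏 ∷ s) = extend-switch (shape₁ s)

    shape₁ : ∀ s → Shape (length s) (x 𝟏 𝟏 (𝟏 ∷ s)) (x 𝟏 𝟎 (𝟏 ∷ s)) (x 𝟎 𝟏 (𝟏 ∷ s)) (x 𝟎 𝟎 (𝟏 ∷ s))
    shape₁ []        = stays
    shape₁ (𝟏 ∷ s) = extend-same (shape₁ s)
    shape₁ (𝟎 ∷ s) = extend-switch (shape₀ s)

  pathShape : ∀ {n} s → PathFrom0 n s → Shape n (x 𝟎 𝟎 s) (x 𝟎 𝟏 s) (x 𝟏 𝟎 s) (x 𝟏 𝟏 s)
  pathShape (𝟎 ∷ s) (refl , refl) = shape₀ s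

open TransitionCounts

-- Polynomial tables for the polytope and their decidable validity.

module Tables where

  open import Data.Nat using (_+_; _*_; _∸_; _<_; _≤_; s≤s; z≤n)
  open import Relation.Binary.PropositionalEquality using (refl; sym; trans; cong; cong₂; subst)

  -- Coefficients, with the constant term first.
  Poly : Set
  Poly = List ℕ

  eval : Poly → ℕ → ℕ
  eval []      r = 0
  eval (a ∷ p) r = a + r * eval p r

  infixl 6 _⊕_
  infixl 7 _⊗_

  _⊕_ : Poly → Poly → Poly
  []      ⊕ q       = q
  (a ∷ p) ⊕ []      = a ∷ p
  (a ∷ p) ⊕ (b ∷ q) = (a + b) ∷ (p ⊕ q)

  _⊗_ : Poly → Poly → Poly
  []      ⊗ q = []
  (a ∷ p) ⊗ q = map (a *_) q ⊕ (0 ∷ p ⊗ q)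

  eval-⊕ : ∀ p q r → eval (p ⊕ q) r ≡ eval p r + eval q r
  eval-⊕ []      q       r = refl
  eval-⊕ (a ∷ p) []      r = sym (ℕ.+-identityʳ _)
  eval-⊕ (a ∷ p) (b ∷ q) r = trans (cong (λ e → a + b + r * e) (eval-⊕ p q r)) (identity a b r (eval p r) (eval q r))
    where
    identity : ∀ a b r e f → a + b + r * (e + f) ≡ a + r * e + (b + r * f)
    identity = solve-∀

  eval-scale : ∀ a q r → eval (map (a *_) q) r ≡ a * eval q r
  eval-scale a []      r = sym (ℕ.*-zeroʳ a)
  eval-scale a (b ∷ q) r = trans (cong (λ e → a * b + r * e) (eval-scale a q r)) (identity a b r (eval q r))
    where
    identity : ∀ a b r e → a * b + r * (a * e) ≡ a * (b + r * e)
    identity = solve-∀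

  eval-⊗ : ∀ p q r → eval (p ⊗ q) r ≡ eval p r * eval q r
  eval-⊗ []      q r = refl
  eval-⊗ (a ∷ p) q r = trans (eval-⊕ (map (a *_) q) (0 ∷ p ⊗ q) r)
    (trans (cong₂ _+_ (eval-scale a q r) (cong (r *_) (eval-⊗ p q r))) (identity a r (eval p r) (eval q r)))
    where
    identity : ∀ a r e f → a * f + r * (e * f) ≡ (a + r * e) * f
    identity = solve-∀

  infix 4 _≼_ _≼?_

  -- Comparison of coefficients: decidable, and sufficient for the values at every natural number.
  -- The constructor `0≼[]` makes trailing zeros harmless, so that computed sums and products can be
  -- compared with hand-written entries.
  data _≼_ : Poly → Poly → Set where
    []≼  : ∀ {q} → [] ≼ q
    0≼[] : ∀ {p} → p ≼ [] → 0 ∷ p ≼ []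
    _∷≼_ : ∀ {a b p q} → a ≤ b → p ≼ q → a ∷ p ≼ b ∷ q

  _≼?_ : ∀ p q → Dec (p ≼ q)
  []          ≼? q       = yes []≼
  (zero ∷ p)  ≼? []      = map′ 0≼[] (λ { (0≼[] p≼) → p≼ }) (p ≼? [])
  (suc _ ∷ p) ≼? []      = no λ ()
  (a ∷ p)     ≼? (b ∷ q) = map′ (λ (a≤b , p≼q) → a≤b ∷≼ p≼q) (λ { (a≤b ∷≼ p≼q) → a≤b , p≼q }) (a ℕ.≤? b ×-dec p ≼? q)

  eval-mono : ∀ {p q} r → p ≼ q → eval p r ≤ eval q r
  eval-mono r []≼          = z≤n
  eval-mono r (0≼[] p≼)    = ℕ.≤-trans (ℕ.*-monoʳ-≤ r (eval-mono r p≼)) (ℕ.≤-reflexive (ℕ.*-zeroʳ r))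
  eval-mono r (a≤b ∷≼ p≼q) = ℕ.+-mono-≤ a≤b (ℕ.*-monoʳ-≤ r (eval-mono r p≼q))

  infix 4 _≃_ _≺_

  _≃_ : Poly → Poly → Set
  p ≃ q = p ≼ q × q ≼ p

  _≺_ : Poly → Poly → Set
  p ≺ q = (1 ∷ []) ⊕ p ≼ q

  eval-≃ : ∀ {p q} r → p ≃ q → eval p r ≡ eval q r
  eval-≃ r (p≼q , q≼p) = ℕ.≤-antisym (eval-mono r p≼q) (eval-mono r q≼p)

  eval-≺ : ∀ {p q} r → p ≺ q → eval p r < eval q r
  eval-≺ {p} r p≺q = ℕ.≤-trans (ℕ.≤-reflexive (sym (trans (eval-⊕ (1 ∷ []) p r)
    (cong (_+ eval p r) (cong suc (ℕ.*-zeroʳ r)))))) (eval-mono r p≺q)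

  sumₚ : ∀ {k} → Vector Poly k → Poly
  sumₚ = Vector.foldr _⊕_ []

  eval-sum : ∀ {k} (f : Vector Poly k) r → eval (sumₚ f) r ≡ sumℕ (λ i → eval (f i) r)
  eval-sum {zero}  f r = refl
  eval-sum {suc k} f r = trans (eval-⊕ (f zero) _ r) (cong (λ e → eval (f zero) r + e) (eval-sum (f ∘ suc) r))

  sumℕ-cong : ∀ {k} {f g : Vector ℕ k} → (∀ i → f i ≡ g i) → sumℕ f ≡ sumℕ g
  sumℕ-cong {zero}  eq = refl
  sumℕ-cong {suc k} eq = cong₂ _+_ (eq zero) (sumℕ-cong (eq ∘ suc))

  infix 8 _•_ _•ₚ_

  _•_ : ∀ {k} → Vector ℕ k → Vector ℕ k → ℕ
  v • w = sumℕ λ i → v i * w i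

  _•ₚ_ : ∀ {k} → Vector Poly k → Vector Poly k → Poly
  v •ₚ w = sumₚ λ i → v i ⊗ w i

  eval-• : ∀ {k} (v w : Vector Poly k) r → eval (v •ₚ w) r ≡ (λ i → eval (v i) r) • (λ i → eval (w i) r)
  eval-• v w r = trans (eval-sum (λ i → v i ⊗ w i) r) (sumℕ-cong λ i → eval-⊗ (v i) (w i) r)

  ⟨_,_,_,_⟩ : Poly → Poly → Poly → Poly → Vector Poly 4
  ⟨ p , q , s , t ⟩ = p Vector.∷ q Vector.∷ s Vector.∷ t Vector.∷ Vector.[]

  ⟪_,_,_,_,_,_,_⟫ : Poly → Poly → Poly → Poly → Poly → Poly → Poly → Vector Poly 7
  ⟪ p , q , s , t , u , v , w ⟫ =
    p Vector.∷ q Vector.∷ s Vector.∷ t Vector.∷ u Vector.∷ v Vector.∷ w Vector.∷ Vector.[]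

  -- All data of the polytope as polynomials in r, where m = 2 + r.
  record Table : Set where
    field
      size    : Poly
      vertex  : Fin 7 → Vector Poly 4
      weights : Fin 7 → Vector Poly 4
      facet   : Fin 7 → Vector Poly 4
      offset  : Fin 7 → Poly
      edge    : Fin 12 → Fin 7 × Fin 7
      -- Affine dependencies between the vertices: a face contains all vertices
      -- on one side of such a relation iff it contains all on the other.
      circuits : List (Vector Poly 7 × Vector Poly 7)

    OnFacet : Fin 7 → Fin 7 → Set
    OnFacet f i = facet f •ₚ vertex i ≃ offset f

    onFacet? : ∀ f i → Dec (OnFacet f i)
    onFacet? f i = (facet f •ₚ vertex i ≼? offset f) ×-dec (offset f ≼? facet f •ₚ vertex i)

    onFacet : Fin 7 → Fin 7 → Bool
    onFacet f i = does (onFacet? f i)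

    onEdge : Fin 12 → Fin 7 → Bool
    onEdge e i = onFacet (proj₁ (edge e)) i ∧ onFacet (proj₂ (edge e)) i

    inSupport : Vector Poly 7 → Fin 7 → Bool
    inSupport α i = not (does (α i ≼? []))

    SupportWithin : Vector Poly 7 → (Fin 7 → Bool) → Set
    SupportWithin α z = ∀ i → inSupport α i ≡ true → z i ≡ true

    supportWithin? : ∀ α z → Dec (SupportWithin α z)
    supportWithin? α z = Fin.all? λ i → (inSupport α i Bool.≟ true) →-dec (z i Bool.≟ true)

    Closed : (Fin 7 → Bool) → Set
    Closed z = All (λ (α , β) → (SupportWithin α z → SupportWithin β z) × (SupportWithin β z → SupportWithin α z)) circuits

    data FacePattern (z : Fin 7 → Bool) : Set where
      isEmpty  : (∀ i → z i ≡ false) → FacePattern z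
      isVertex : ∀ j → (∀ i → z i ≡ does (j Fin.≟ i)) → FacePattern z
      isEdge   : ∀ e → (∀ i → z i ≡ onEdge e i) → FacePattern z
      isFacet  : ∀ f → (∀ i → z i ≡ onFacet f i) → FacePattern z
      isWhole  : (∀ i → z i ≡ true) → FacePattern z

    private
      same? : (z z′ : Fin 7 → Bool) → Dec (∀ i → z i ≡ z′ i)
      same? z z′ = Fin.all? λ i → z i Bool.≟ z′ i

    facePattern? : ∀ z → Dec (FacePattern z)
    facePattern? z = map′
      (λ { (inj₁ h) → isEmpty h ; (inj₂ (inj₁ (j , h))) → isVertex j h ; (inj₂ (inj₂ (inj₁ (e , h)))) → isEdge e h
         ; (inj₂ (inj₂ (inj₂ (inj₁ (f , h))))) → isFacet f h ; (inj₂ (inj₂ (inj₂ (inj₂ h)))) → isWhole h })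
      (λ { (isEmpty h) → inj₁ h ; (isVertex j h) → inj₂ (inj₁ (j , h)) ; (isEdge e h) → inj₂ (inj₂ (inj₁ (e , h)))
         ; (isFacet f h) → inj₂ (inj₂ (inj₂ (inj₁ (f , h)))) ; (isWhole h) → inj₂ (inj₂ (inj₂ (inj₂ h))) })
      (same? z (λ _ → false) ⊎-dec (Fin.any? λ j → same? z λ i → does (j Fin.≟ i)) ⊎-dec
       (Fin.any? λ e → same? z (onEdge e)) ⊎-dec (Fin.any? λ f → same? z (onFacet f)) ⊎-dec same? z (λ _ → true))

    -- The vertices climb a chain vertex, edge, facet, polytope: each new one violates an equation
    -- or bound attained by all earlier ones. This gives affinely independent families of 2, 3 and 4
    -- points for the lower bounds on dimension; v₂ and v₃ serve the upper bounds as well, as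
    -- additional points off the edge and off the facet.
    record Flag (e : Fin 12) : Set where
      field
        v₀ v₁ v₂ v₃ : Fin 7
        v₀≢v₁ : ¬ v₀ ≡ v₁
        v₀-on : onEdge e v₀ ≡ true
        v₁-on : onEdge e v₁ ≡ true
        v₂-on₁ : onFacet (proj₁ (edge e)) v₂ ≡ true
        v₂-off₂ : onFacet (proj₂ (edge e)) v₂ ≡ false
        v₃-off₁ : onFacet (proj₁ (edge e)) v₃ ≡ false

    flag? : ∀ e → Dec (Flag e)
    flag? e = map′
      (λ ((i , on , j , i≢j , on′) , (k , on₁ , off₂) , (l , off₁)) → record
        { v₀ = i ; v₁ = j ; v₂ = k ; v₃ = l ; v₀≢v₁ = i≢j ; v₀-on = on ; v₁-on = on′
        ; v₂-on₁ = on₁ ; v₂-off₂ = off₂ ; v₃-off₁ = off₁ })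
      (λ f → let open Flag f in
        (v₀ , v₀-on , v₁ , v₀≢v₁ , v₁-on) , (v₂ , v₂-on₁ , v₂-off₂) , (v₃ , v₃-off₁))
      ((Fin.any? λ i → (onEdge e i Bool.≟ true) ×-dec Fin.any? λ j → ¬? (i Fin.≟ j) ×-dec (onEdge e j Bool.≟ true)) ×-dec
       (Fin.any? λ k → (onFacet (proj₁ (edge e)) k Bool.≟ true) ×-dec (onFacet (proj₂ (edge e)) k Bool.≟ false)) ×-dec
       (Fin.any? λ l → onFacet (proj₁ (edge e)) l Bool.≟ false))

    record CircuitValid (c : Vector Poly 7 × Vector Poly 7) : Set where
      field
        positiveˡ : ∀ i → inSupport (proj₁ c) i ≡ true → [] ≺ proj₁ c i
        positiveʳ : ∀ i → inSupport (proj₂ c) i ≡ true → [] ≺ proj₂ c i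
        balanced  : sumₚ (proj₁ c) ≃ sumₚ (proj₂ c)
        dependent : ∀ k → (proj₁ c •ₚ λ i → vertex i k) ≃ (proj₂ c •ₚ λ i → vertex i k)

    record Valid : Set where
      field
        vertex-size     : ∀ i → sumₚ (vertex i) ≃ size
        weights-minimal : ∀ i j → i ≡ j ⊎ weights i •ₚ vertex i ≺ weights i •ₚ vertex j
        offset-minimal  : ∀ f i → OnFacet f i ⊎ offset f ≺ facet f •ₚ vertex i
        facets-distinct : ∀ f f′ → (∀ i → onFacet f i ≡ onFacet f′ i) → f ≡ f′
        edges-distinct  : ∀ e e′ → (∀ i → onEdge e i ≡ onEdge e′ i) → e ≡ e′
        flags           : ∀ e → Flag e
        facet-edge      : ∀ f → ∃ λ e → proj₁ (edge e) ≡ f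
        circuits-valid  : All CircuitValid circuits
        -- Quantified over vectors because these 128 can be enumerated, whereas functions are
        -- determined only up to pointwise equality.
        classification  : ∀ (z : Vec Bool 7) → Closed (lookup z) → FacePattern (lookup z)

    allVec? : ∀ {k} {P : Vec Bool k → Set} → (∀ z → Dec (P z)) → Dec (∀ z → P z)
    allVec? {zero}  P? = map′ (λ { p Vec.[] → p }) (λ p → p Vec.[]) (P? Vec.[])
    allVec? {suc k} P? = map′
      (λ { (p , q) (true Vec.∷ z) → p z ; (p , q) (false Vec.∷ z) → q z })
      (λ p → (λ z → p (true Vec.∷ z)) , λ z → p (false Vec.∷ z))
      (allVec? (λ z → P? (true Vec.∷ z)) ×-dec allVec? (λ z → P? (false Vec.∷ z)))

    valid? : Dec Valid
    valid? = map′
      (λ (a , b , c , d , e , f , g , h , i) → record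
        { vertex-size = a ; weights-minimal = b ; offset-minimal = c ; facets-distinct = d ; edges-distinct = e
        ; flags = f ; facet-edge = g ; circuits-valid = h ; classification = i })
      (λ v → let open Valid v in
        vertex-size , weights-minimal , offset-minimal , facets-distinct , edges-distinct , flags , facet-edge ,
        circuits-valid , classification)
      ((Fin.all? λ i → ≃? (sumₚ (vertex i)) size) ×-dec
       (Fin.all? λ i → Fin.all? λ j → (i Fin.≟ j) ⊎-dec ≺? (weights i •ₚ vertex i) (weights i •ₚ vertex j)) ×-dec
       (Fin.all? λ f → Fin.all? λ i → onFacet? f i ⊎-dec ≺? (offset f) (facet f •ₚ vertex i)) ×-dec
       (Fin.all? λ f → Fin.all? λ f′ → same? (onFacet f) (onFacet f′) →-dec (f Fin.≟ f′)) ×-dec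
       (Fin.all? λ e → Fin.all? λ e′ → same? (onEdge e) (onEdge e′) →-dec (e Fin.≟ e′)) ×-dec
       Fin.all? flag? ×-dec
       (Fin.all? λ f → Fin.any? λ e → proj₁ (edge e) Fin.≟ f) ×-dec
       All.all? circuitValid? circuits ×-dec
       allVec? (λ z → All.all? (λ (α , β) →
           (supportWithin? α (lookup z) →-dec supportWithin? β (lookup z)) ×-dec
           (supportWithin? β (lookup z) →-dec supportWithin? α (lookup z))) circuits
         →-dec facePattern? (lookup z)))
      where
      ≃? : ∀ p q → Dec (p ≃ q)
      ≃? p q = (p ≼? q) ×-dec (q ≼? p)
      ≺? : ∀ p q → Dec (p ≺ q)
      ≺? p q = (1 ∷ []) ⊕ p ≼? q
      circuitValid? : ∀ c → Dec (CircuitValid c)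
      circuitValid? (α , β) = map′
        (λ (p , q , b , d) → record { positiveˡ = p ; positiveʳ = q ; balanced = b ; dependent = d })
        (λ v → let open CircuitValid v in positiveˡ , positiveʳ , balanced , dependent)
        ((Fin.all? λ i → (inSupport α i Bool.≟ true) →-dec ≺? [] (α i)) ×-dec
         (Fin.all? λ i → (inSupport β i Bool.≟ true) →-dec ≺? [] (β i)) ×-dec
         ≃? (sumₚ α) (sumₚ β) ×-dec
         (Fin.all? λ k → ≃? (α •ₚ λ i → vertex i k) (β •ₚ λ i → vertex i k)))

  0ₚ 1ₚ 2ₚ : Poly
  0ₚ = []
  1ₚ = 1 ∷ []
  2ₚ = 2 ∷ []

  _+_X : ℕ → ℕ → Poly
  a + b X = a ∷ b ∷ []

  _+_X+_X² : ℕ → ℕ → ℕ → Poly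
  a + b X+ c X² = a ∷ b ∷ c ∷ []

  -- Since the counts add up to n, the facets other than the three coordinate ones are x₀₀ + n x₀₁ ≥
  -- n, which is the plane through A, F and G, then x₁₀ ≤ x₀₁, x₀₁ ≤ x₁₀ + 1 and x₀₁ ≤ m. Multiples
  -- of the constant sum have been added to keep the coefficients natural. The facet x₀₁ = x₁₀ is
  -- the triangle A E F, and x₀₁ = x₁₀ + 1 is the quadrilateral B C D G.
  evenTable : Table
  evenTable = record
    { size = 4 + 2 X
    ; vertex = λ where
        A → ⟨ 4 + 2 X , 0ₚ , 0ₚ , 0ₚ ⟩
        B → ⟨ 3 + 2 X , 1ₚ , 0ₚ , 0ₚ ⟩
        C → ⟨ 1ₚ , 2 + 1 X , 1 + 1 X , 0ₚ ⟩
        D → ⟨ 0ₚ , 2 + 1 X , 1 + 1 X , 1ₚ ⟩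
        E → ⟨ 0ₚ , 2 + 1 X , 2 + 1 X , 0ₚ ⟩
        F → ⟨ 0ₚ , 1ₚ , 1ₚ , 2 + 2 X ⟩
        G → ⟨ 0ₚ , 1ₚ , 0ₚ , 3 + 2 X ⟩
    ; weights = λ where
        A → ⟨ 0ₚ , 1ₚ , 1ₚ , 1ₚ ⟩
        B → ⟨ 1ₚ , 0ₚ , 4 ∷ [] , 2ₚ ⟩
        C → ⟨ 3 ∷ [] , 0ₚ , 4 ∷ [] , 4 ∷ [] ⟩
        D → ⟨ 4 ∷ [] , 0ₚ , 4 ∷ [] , 3 ∷ [] ⟩
        E → ⟨ 1ₚ , 0ₚ , 0ₚ , 1ₚ ⟩
        F → ⟨ 2ₚ , 4 ∷ [] , 0ₚ , 1ₚ ⟩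
        G → ⟨ 1ₚ , 1ₚ , 1ₚ , 0ₚ ⟩
    ; facet = λ where
        0F → ⟨ 1ₚ , 0ₚ , 0ₚ , 0ₚ ⟩
        1F → ⟨ 0ₚ , 0ₚ , 0ₚ , 1ₚ ⟩
        2F → ⟨ 0ₚ , 0ₚ , 1ₚ , 0ₚ ⟩
        3F → ⟨ 1ₚ , 4 + 2 X , 0ₚ , 0ₚ ⟩
        4F → ⟨ 1ₚ , 2ₚ , 0ₚ , 1ₚ ⟩
        5F → ⟨ 1ₚ , 0ₚ , 2ₚ , 1ₚ ⟩
        6F → ⟨ 1ₚ , 0ₚ , 1ₚ , 1ₚ ⟩
    ; offset = ⟪ 0ₚ , 0ₚ , 0ₚ , 4 + 2 X , 4 + 2 X , 3 + 2 X , 2 + 1 X ⟫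
    ; edge = lookup ((0F , 3F) Vec.∷ (0F , 4F) Vec.∷ (1F , 2F) Vec.∷ (1F , 5F) Vec.∷ (1F , 6F) Vec.∷ (2F , 3F) Vec.∷
                     (2F , 5F) Vec.∷ (3F , 4F) Vec.∷ (4F , 1F) Vec.∷ (5F , 0F) Vec.∷ (6F , 0F) Vec.∷ (6F , 5F) Vec.∷ Vec.[])
    ; circuits =
        (⟪ 1 + 1 X , 0ₚ , 2 + 1 X , 0ₚ , 0ₚ , 0ₚ , 0ₚ ⟫ , ⟪ 0ₚ , 2 + 1 X , 0ₚ , 0ₚ , 1 + 1 X , 0ₚ , 0ₚ ⟫) ∷
        (⟪ 0ₚ , 0ₚ , 0ₚ , 1ₚ , 0ₚ , 1ₚ , 0ₚ ⟫ , ⟪ 0ₚ , 0ₚ , 0ₚ , 0ₚ , 1ₚ , 0ₚ , 1ₚ ⟫) ∷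
        (⟪ 0ₚ , 1ₚ , 0ₚ , 3 + 2 X , 0ₚ , 0ₚ , 0ₚ ⟫ , ⟪ 0ₚ , 0ₚ , 3 + 2 X , 0ₚ , 0ₚ , 0ₚ , 1ₚ ⟫) ∷
        (⟪ 3 + 5 X+ 2 X² , 0ₚ , 0ₚ , 3 + 2 X , 0ₚ , 0ₚ , 1 + 4 X+ 2 X² ⟫ ,
         ⟪ 0ₚ , 4 + 6 X+ 2 X² , 0ₚ , 0ₚ , 0ₚ , 3 + 5 X+ 2 X² , 0ₚ ⟫) ∷
        (⟪ 1 + 1 X , 0ₚ , 0ₚ , 4 + 6 X+ 2 X² , 1ₚ , 0ₚ , 0ₚ ⟫ , ⟪ 0ₚ , 0ₚ , 4 + 6 X+ 2 X² , 0ₚ , 0ₚ , 2 + 1 X , 0ₚ ⟫) ∷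
        (⟪ 1 + 1 X , 0ₚ , 0ₚ , 2 + 4 X+ 2 X² , 0ₚ , 0ₚ , 0ₚ ⟫ , ⟪ 0ₚ , 1ₚ , 1 + 4 X+ 2 X² , 0ₚ , 0ₚ , 1 + 1 X , 0ₚ ⟫) ∷ []
    }

  -- For odd n the alternating sequence E has m + 1 transitions from 0 to 1, and the last facet
  -- becomes x₁₀ ≤ m, still through C, D and E. The quadrilateral A C D F now lies in x₀₁ = x₁₀ and
  -- the triangle B E G in the other plane.
  oddTable : Table
  oddTable = record
    { size = 5 + 2 X
    ; vertex = λ where
        A → ⟨ 5 + 2 X , 0ₚ , 0ₚ , 0ₚ ⟩
        B → ⟨ 4 + 2 X , 1ₚ , 0ₚ , 0ₚ ⟩
        C → ⟨ 1ₚ , 2 + 1 X , 2 + 1 X , 0ₚ ⟩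
        D → ⟨ 0ₚ , 2 + 1 X , 2 + 1 X , 1ₚ ⟩
        E → ⟨ 0ₚ , 3 + 1 X , 2 + 1 X , 0ₚ ⟩
        F → ⟨ 0ₚ , 1ₚ , 1ₚ , 3 + 2 X ⟩
        G → ⟨ 0ₚ , 1ₚ , 0ₚ , 4 + 2 X ⟩
    ; weights = λ where
        A → ⟨ 0ₚ , 1ₚ , 1ₚ , 1ₚ ⟩
        B → ⟨ 1ₚ , 0ₚ , 4 ∷ [] , 2ₚ ⟩
        C → ⟨ 3 ∷ [] , 4 ∷ [] , 0ₚ , 4 ∷ [] ⟩
        D → ⟨ 4 ∷ [] , 4 ∷ [] , 0ₚ , 3 ∷ [] ⟩
        E → ⟨ 1ₚ , 0ₚ , 0ₚ , 1ₚ ⟩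
        F → ⟨ 2ₚ , 4 ∷ [] , 0ₚ , 1ₚ ⟩
        G → ⟨ 1ₚ , 1ₚ , 1ₚ , 0ₚ ⟩
    ; facet = λ where
        0F → ⟨ 1ₚ , 0ₚ , 0ₚ , 0ₚ ⟩
        1F → ⟨ 0ₚ , 0ₚ , 0ₚ , 1ₚ ⟩
        2F → ⟨ 0ₚ , 0ₚ , 1ₚ , 0ₚ ⟩
        3F → ⟨ 1ₚ , 5 + 2 X , 0ₚ , 0ₚ ⟩
        4F → ⟨ 1ₚ , 2ₚ , 0ₚ , 1ₚ ⟩
        5F → ⟨ 1ₚ , 0ₚ , 2ₚ , 1ₚ ⟩
        6F → ⟨ 1ₚ , 1ₚ , 0ₚ , 1ₚ ⟩
    ; offset = ⟪ 0ₚ , 0ₚ , 0ₚ , 5 + 2 X , 5 + 2 X , 4 + 2 X , 3 + 1 X ⟫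
    ; edge = lookup ((0F , 3F) Vec.∷ (0F , 4F) Vec.∷ (1F , 2F) Vec.∷ (1F , 5F) Vec.∷ (1F , 6F) Vec.∷ (2F , 3F) Vec.∷
                     (2F , 5F) Vec.∷ (3F , 4F) Vec.∷ (4F , 1F) Vec.∷ (5F , 0F) Vec.∷ (6F , 0F) Vec.∷ (6F , 4F) Vec.∷ Vec.[])
    ; circuits =
        (⟪ 1ₚ , 0ₚ , 0ₚ , 0ₚ , 1ₚ , 0ₚ , 0ₚ ⟫ , ⟪ 0ₚ , 1ₚ , 1ₚ , 0ₚ , 0ₚ , 0ₚ , 0ₚ ⟫) ∷
        (⟪ 0ₚ , 1ₚ , 0ₚ , 4 + 2 X , 0ₚ , 0ₚ , 0ₚ ⟫ , ⟪ 0ₚ , 0ₚ , 4 + 2 X , 0ₚ , 0ₚ , 0ₚ , 1ₚ ⟫) ∷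
        (⟪ 0ₚ , 0ₚ , 0ₚ , 2 + 1 X , 0ₚ , 0ₚ , 1 + 1 X ⟫ , ⟪ 0ₚ , 0ₚ , 0ₚ , 0ₚ , 1 + 1 X , 2 + 1 X , 0ₚ ⟫) ∷
        (⟪ 1 + 1 X , 0ₚ , 0ₚ , 6 + 7 X+ 2 X² , 0ₚ , 0ₚ , 0ₚ ⟫ , ⟪ 0ₚ , 0ₚ , 5 + 7 X+ 2 X² , 0ₚ , 0ₚ , 2 + 1 X , 0ₚ ⟫) ∷
        (⟪ 2 + 2 X , 0ₚ , 2ₚ , 0ₚ , 0ₚ , 0ₚ , 3 + 2 X ⟫ , ⟪ 0ₚ , 3 + 2 X , 0ₚ , 0ₚ , 0ₚ , 4 + 2 X , 0ₚ ⟫) ∷ []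
    }

  abstract
    evenValid : Table.Valid evenTable
    evenValid = from-yes (Table.valid? evenTable)

    oddValid : Table.Valid oddTable
    oddValid = from-yes (Table.valid? oddTable)

open Tables

-- Counts of the seven sequences, and all other points as their means.

module SevenSequences where

  open import Data.Nat using (_+_; _*_; _∸_; _<_; _≤_; s≤s; z≤n)
  open import Relation.Binary.PropositionalEquality using (refl; sym; trans; cong; cong₂; subst)

  record CountsAre (s : List State) (x₀₀ x₀₁ x₁₀ x₁₁ : ℕ) : Set where
    constructor countsAre
    field
      at : ∀ k → counts s k ≡ (x₀₀ Vector.∷ x₀₁ Vector.∷ x₁₀ Vector.∷ x₁₁ Vector.∷ Vector.[]) k

  open CountsAre

  counts-0ᵏ : ∀ k → CountsAre (𝟎 ^ suc k) k 0 0 0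
  counts-0ᵏ zero    = countsAre λ { 0F → refl ; 1F → refl ; 2F → refl ; 3F → refl }
  counts-0ᵏ (suc k) = countsAre λ { 0F → cong suc (at (counts-0ᵏ k) 0F) ; 1F → at (counts-0ᵏ k) 1F ; 2F → at (counts-0ᵏ k) 2F ; 3F → at (counts-0ᵏ k) 3F }

  counts-0ᵏ1 : ∀ k → CountsAre (𝟎 ^ suc k ++ 𝟏 ∷ []) k 1 0 0
  counts-0ᵏ1 zero    = countsAre λ { 0F → refl ; 1F → refl ; 2F → refl ; 3F → refl }
  counts-0ᵏ1 (suc k) = countsAre λ { 0F → cong suc (at (counts-0ᵏ1 k) 0F) ; 1F → at (counts-0ᵏ1 k) 1F ; 2F → at (counts-0ᵏ1 k) 2F ; 3F → at (counts-0ᵏ1 k) 3F }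

  counts-01ᵏ : ∀ k → CountsAre (𝟎 ∷ 𝟏 ^ suc k) 0 1 0 k
  counts-01ᵏ zero    = countsAre λ { 0F → refl ; 1F → refl ; 2F → refl ; 3F → refl }
  counts-01ᵏ (suc k) = countsAre λ { 0F → at (counts-01ᵏ k) 0F ; 1F → at (counts-01ᵏ k) 1F ; 2F → at (counts-01ᵏ k) 2F ; 3F → cong suc (at (counts-01ᵏ k) 3F) }

  counts-01ᵏ0 : ∀ k → CountsAre (𝟎 ∷ 𝟏 ^ suc k ++ 𝟎 ∷ []) 0 1 1 k
  counts-01ᵏ0 zero    = countsAre λ { 0F → refl ; 1F → refl ; 2F → refl ; 3F → refl }
  counts-01ᵏ0 (suc k) = countsAre λ { 0F → at (counts-01ᵏ0 k) 0F ; 1F → at (counts-01ᵏ0 k) 1F ; 2F → at (counts-01ᵏ0 k) 2F ; 3F → cong suc (at (counts-01ᵏ0 k) 3F) }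

  counts-[01]ᵏ : ∀ k t {x₀₀ x₀₁ x₁₀ x₁₁} → CountsAre (𝟎 ∷ 𝟏 ∷ t) x₀₀ x₀₁ x₁₀ x₁₁ →
                 CountsAre ([01]^ (suc k) ++ t) x₀₀ (k + x₀₁) (k + x₁₀) x₁₁
  counts-[01]ᵏ zero    t base = base
  counts-[01]ᵏ (suc k) t base = countsAre λ { 0F → at ih 0F ; 1F → cong suc (at ih 1F) ; 2F → cong suc (at ih 2F) ; 3F → at ih 3F }
    where ih = counts-[01]ᵏ k t base

  counts-0[01]ᵏ : ∀ k t {x₀₀ x₀₁ x₁₀ x₁₁} → CountsAre ([01]^ (suc k) ++ t) x₀₀ x₀₁ x₁₀ x₁₁ →
                  CountsAre (𝟎 ∷ [01]^ (suc k) ++ t) (suc x₀₀) x₀₁ x₁₀ x₁₁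
  counts-0[01]ᵏ k t base = countsAre λ { 0F → cong suc (at base 0F) ; 1F → at base 1F ; 2F → at base 2F ; 3F → at base 3F }

  length-[01]ᵏ : ∀ k t → length ([01]^ k ++ t) ≡ k * 2 + length t
  length-[01]ᵏ zero    t = refl
  length-[01]ᵏ (suc k) t = cong (λ l → suc (suc l)) (length-[01]ᵏ k t)

  length-^-++ : ∀ (i : State) k t → length (i ^ k ++ t) ≡ k + length t
  length-^-++ i k t = trans (List.length-++ (i ^ k)) (cong (_+ length t) (List.length-replicate k))

  countsAre⇒≡ : ∀ {s s′ x₀₀ x₀₁ x₁₀ x₁₁} (v : Fin 4 → ℕ) → s ≡ s′ → CountsAre s x₀₀ x₀₁ x₁₀ x₁₁ →
                x₀₀ ≡ v 0F → x₀₁ ≡ v 1F → x₁₀ ≡ v 2F → x₁₁ ≡ v 3F → ∀ k → counts s′ k ≡ v k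
  countsAre⇒≡ v refl h e₀ e₁ e₂ e₃ = λ where
    0F → trans (at h 0F) e₀
    1F → trans (at h 1F) e₁
    2F → trans (at h 2F) e₂
    3F → trans (at h 3F) e₃

  verticesAt : Table → ℕ → Fin 7 → Fin 4 → ℕ
  verticesAt table r i k = eval (Table.vertex table i k) r

  module _ (r : ℕ) where

    private
      m = 2 + r


      one : 1 ≡ eval 1ₚ r
      one = cong suc (sym (ℕ.*-zeroʳ r))

    even-size : 2 * m ≡ eval (Table.size evenTable) r
    even-size = identity r
      where
      identity : ∀ r → 2 * (2 + r) ≡ 4 + r * (2 + r * 0)
      identity = solve-∀

    odd-size : 2 * m + 1 ≡ eval (Table.size oddTable) r
    odd-size = identity r
      where
      identity : ∀ r → 2 * (2 + r) + 1 ≡ 5 + r * (2 + r * 0)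
      identity = solve-∀

    private
      pred-size : r + suc (suc (r + 0)) ≡ 2 + 2 * r
      pred-size = identity r
        where
        identity : ∀ r → r + suc (suc (r + 0)) ≡ 2 + 2 * r
        identity = solve-∀

      2+r : suc r + 1 ≡ eval (2 + 1 X) r
      2+r = identity r
        where
        identity : ∀ r → suc r + 1 ≡ 2 + r * (1 + r * 0)
        identity = solve-∀

      1+r : suc r + 0 ≡ eval (1 + 1 X) r
      1+r = identity r
        where
        identity : ∀ r → suc r + 0 ≡ 1 + r * (1 + r * 0)
        identity = solve-∀

      3+r : suc (suc r) + 1 ≡ eval (3 + 1 X) r
      3+r = identity r
        where
        identity : ∀ r → suc (suc r) + 1 ≡ 3 + r * (1 + r * 0)
        identity = solve-∀

      2+r′ : suc (suc r) + 0 ≡ eval (2 + 1 X) r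
      2+r′ = identity r
        where
        identity : ∀ r → suc (suc r) + 0 ≡ 2 + r * (1 + r * 0)
        identity = solve-∀

      even-n : ∀ k {l} → l ≡ k + (2 + 2 * r) → l ≡ eval ((2 + k) + 2 X) r
      even-n k refl = identity k r
        where
        identity : ∀ k r → k + (2 + 2 * r) ≡ (2 + k) + r * (2 + r * 0)
        identity = solve-∀

    even-counts : ∀ i k → counts (evenSeq m i) k ≡ verticesAt evenTable r i k
    even-counts A = countsAre⇒≡ (verticesAt evenTable r A) (cong (𝟎 ^_) (ℕ.+-comm 1 (2 * m))) (counts-0ᵏ (2 * m)) even-size refl refl refl
    even-counts B = countsAre⇒≡ (verticesAt evenTable r B) refl (counts-0ᵏ1 (suc (r + suc (suc (r + 0))))) (even-n 1 (cong suc pred-size)) one refl refl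
    even-counts C = countsAre⇒≡ (verticesAt evenTable r C) (cong (𝟎 ∷_) (List.++-identityʳ ([01]^ m)))
        (counts-0[01]ᵏ (suc r) [] (counts-[01]ᵏ (suc r) [] (countsAre λ { 0F → refl ; 1F → refl ; 2F → refl ; 3F → refl }))) one 2+r 1+r refl
    even-counts D = countsAre⇒≡ (verticesAt evenTable r D) refl (counts-[01]ᵏ (suc r) (𝟏 ∷ []) (countsAre λ { 0F → refl ; 1F → refl ; 2F → refl ; 3F → refl })) refl 2+r 1+r one
    even-counts E = countsAre⇒≡ (verticesAt evenTable r E) refl (counts-[01]ᵏ (suc r) (𝟎 ∷ []) (countsAre λ { 0F → refl ; 1F → refl ; 2F → refl ; 3F → refl })) refl 2+r 2+r refl
    even-counts F = countsAre⇒≡ (verticesAt evenTable r F) refl (counts-01ᵏ0 (r + suc (suc (r + 0)))) refl one one (even-n 0 pred-size)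
    even-counts G = countsAre⇒≡ (verticesAt evenTable r G) refl (counts-01ᵏ (suc (r + suc (suc (r + 0))))) refl one refl (even-n 1 (cong suc pred-size))

    even-path : ∀ i → PathFrom0 (2 * m) (evenSeq m i)
    even-path A = trans (List.length-replicate (2 * m + 1)) (ℕ.+-comm (2 * m) 1) , cong (λ l → head (𝟎 ^ l)) (ℕ.+-comm (2 * m) 1)
    even-path B = trans (length-^-++ 𝟎 (2 * m) (𝟏 ∷ [])) (ℕ.+-comm (2 * m) 1) , refl
    even-path C = cong suc (trans (cong length (sym (List.++-identityʳ ([01]^ m)))) (trans (length-[01]ᵏ m []) (trans (ℕ.+-identityʳ _) (ℕ.*-comm m 2)))) , refl
    even-path D = trans (length-[01]ᵏ m (𝟏 ∷ [])) (trans (ℕ.+-comm _ 1) (cong suc (ℕ.*-comm m 2))) , refl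
    even-path E = trans (length-[01]ᵏ m (𝟎 ∷ [])) (trans (ℕ.+-comm _ 1) (cong suc (ℕ.*-comm m 2))) , refl
    even-path F = cong suc (trans (length-^-++ 𝟏 (2 * m ∸ 1) (𝟎 ∷ [])) (ℕ.+-comm _ 1)) , refl
    even-path G = cong suc (List.length-replicate (2 * m)) , refl

    odd-counts : ∀ i k → counts (oddSeq m i) k ≡ verticesAt oddTable r i k
    odd-counts A = countsAre⇒≡ (verticesAt oddTable r A) (cong (𝟎 ^_) (sym (ℕ.+-suc (2 * m) 1))) (counts-0ᵏ (2 * m + 1)) odd-size refl refl refl
    odd-counts B = countsAre⇒≡ (verticesAt oddTable r B) (cong (λ l → 𝟎 ^ l ++ 𝟏 ∷ []) (ℕ.+-comm 1 (2 * m))) (counts-0ᵏ1 (2 * m)) even-size one refl refl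
    odd-counts C = countsAre⇒≡ (verticesAt oddTable r C) refl
        (counts-0[01]ᵏ (suc r) (𝟎 ∷ []) (counts-[01]ᵏ (suc r) (𝟎 ∷ []) (countsAre λ { 0F → refl ; 1F → refl ; 2F → refl ; 3F → refl }))) one 2+r 2+r refl
    odd-counts D = countsAre⇒≡ (verticesAt oddTable r D) refl (counts-[01]ᵏ (suc r) (𝟏 ∷ 𝟎 ∷ []) (countsAre λ { 0F → refl ; 1F → refl ; 2F → refl ; 3F → refl })) refl 2+r 2+r one
    odd-counts E = countsAre⇒≡ (verticesAt oddTable r E) (trans (List.++-identityʳ ([01]^ (suc m))) (cong [01]^_ (ℕ.+-comm 1 m)))
        (counts-[01]ᵏ m [] (countsAre λ { 0F → refl ; 1F → refl ; 2F → refl ; 3F → refl })) refl 3+r 2+r′ refl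
    odd-counts F = countsAre⇒≡ (verticesAt oddTable r F) refl (counts-01ᵏ0 (suc (r + suc (suc (r + 0))))) refl one one (even-n 1 (cong suc pred-size))
    odd-counts G = countsAre⇒≡ (verticesAt oddTable r G) (cong (λ l → 𝟎 ∷ 𝟏 ^ l) (ℕ.+-comm 1 (2 * m))) (counts-01ᵏ (2 * m)) refl one refl even-size

    odd-path : ∀ i → PathFrom0 (2 * m + 1) (oddSeq m i)
    odd-path A = trans (List.length-replicate (2 * m + 2)) (ℕ.+-suc (2 * m) 1) , cong (λ l → head (𝟎 ^ l)) (ℕ.+-suc (2 * m) 1)
    odd-path B = trans (length-^-++ 𝟎 (2 * m + 1) (𝟏 ∷ [])) (ℕ.+-comm (2 * m + 1) 1) , cong (λ l → head (𝟎 ^ l ++ 𝟏 ∷ [])) (ℕ.+-comm (2 * m) 1)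
    odd-path C = cong suc (trans (length-[01]ᵏ m (𝟎 ∷ [])) (cong (_+ 1) (ℕ.*-comm m 2))) , refl
    odd-path D = trans (length-[01]ᵏ m (𝟏 ∷ 𝟎 ∷ [])) (trans (ℕ.+-suc (m * 2) 1) (cong (λ l → suc (l + 1)) (ℕ.*-comm m 2))) , refl
    odd-path E = trans (cong length (trans (cong [01]^_ (ℕ.+-comm m 1)) (sym (List.++-identityʳ ([01]^ (suc m))))))
      (trans (length-[01]ᵏ (suc m) []) (identity r)) , cong (λ l → head ([01]^ l)) (ℕ.+-comm m 1)
      where
      identity : ∀ r → (3 + r) * 2 + 0 ≡ suc (2 * (2 + r) + 1)
      identity = solve-∀
    odd-path F = cong suc (length-^-++ 𝟏 (2 * m) (𝟎 ∷ [])) , refl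
    odd-path G = cong suc (List.length-replicate (2 * m + 1)) , refl

  -- A point as a weighted mean of the vertices, with the denominator cleared.
  record Mean (vertices : Fin 7 → Fin 4 → ℕ) (c : Fin 4 → ℕ) : Set where
    field
      denominator : ℕ
      coefficient : Fin 7 → ℕ
      positive    : 0 < denominator
      total-eq    : sumℕ coefficient ≡ denominator
      equation    : ∀ k → denominator * c k ≡ sumℕ (λ i → coefficient i * vertices i k)

  coefficients₇ : ℕ → ℕ → ℕ → ℕ → ℕ → ℕ → ℕ → Fin 7 → ℕ
  coefficients₇ a b c d e f g =
    a Vector.∷ b Vector.∷ c Vector.∷ d Vector.∷ e Vector.∷ f Vector.∷ g Vector.∷ Vector.[]

  coordinates₄ : ℕ → ℕ → ℕ → ℕ → Fin 4 → ℕ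
  coordinates₄ x₀₀ x₀₁ x₁₀ x₁₁ = x₀₀ Vector.∷ x₀₁ Vector.∷ x₁₀ Vector.∷ x₁₁ Vector.∷ Vector.[]

  -- Apart from one loop, two steps are spent either on a pair of loops or on a round trip; v pairs
  -- and j trips share the budget q. The same bookkeeping serves the means of vertices and, later,
  -- the trading of loops for round trips.
  split-parity : ∀ {t} j q → t + 2 * j ≡ 1 + 2 * q → ∃ λ v → v + j ≡ q × t ≡ 1 + 2 * v
  split-parity {t} j q eq = v , v+j≡q , ℕ.+-cancelʳ-≡ (2 * j) t (1 + 2 * v)
      (trans eq (trans (cong (λ q → 1 + 2 * q) (sym v+j≡q)) (identity v j)))
    where
    v = q ∸ j
    j≤q : j ≤ q
    j≤q = ℕ.≮⇒≥ λ q<j → ℕ.<-irrefl (sym eq) (ℕ.≤-trans (ℕ.≤-reflexive (identity′ q))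
      (ℕ.≤-trans (ℕ.*-monoʳ-≤ 2 q<j) (ℕ.m≤n+m (2 * j) t)) )
      where
      identity′ : ∀ q → suc (1 + 2 * q) ≡ 2 * suc q
      identity′ = solve-∀
    v+j≡q = ℕ.m∸n+n≡m j≤q
    identity : ∀ v j → 1 + 2 * (v + j) ≡ 1 + 2 * v + 2 * j
    identity = solve-∀

  module _ (r : ℕ) where

    private
      m = 2 + r

    stays-mean : ∀ table {n} → (∀ k → verticesAt table r A k ≡ coordinates₄ n 0 0 0 k) →
                 Mean (verticesAt table r) (coordinates₄ n 0 0 0)
    stays-mean table eq = record
      { denominator = 1
      ; coefficient = coefficients₇ 1 0 0 0 0 0 0
      ; positive    = s≤s z≤n
      ; total-eq    = refl
      ; equation    = λ k → trans (cong (1 *_) (sym (eq k))) (sym (ℕ.+-identityʳ _)) }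

    -- Among A, E and F only A has loops at 0 and only F has loops at 1, so the coefficients a/n and
    -- b/(n - 2) are forced and E takes the remainder. The denominator is (n - 2) m.
    even-returns : ∀ {a b} j → (a + b) + (2 * j + 2) ≡ 2 * m →
                   Mean (verticesAt evenTable r) (coordinates₄ a (suc j) (suc j) b)
    even-returns {a} {b} j eq = record
      { denominator = 2 * (1 + r) * (2 + r)
      ; coefficient = coefficients₇ (a * (1 + r)) 0 0 0 (2 * (1 + r) * j + a + 2 * j) (b * (2 + r)) 0
      ; positive    = s≤s z≤n
      ; total-eq    = trans (total₁ a b j r) (cong (_* (2 + r)) t≡)
      ; equation    = λ where
          0F → eq₀ a b j r
          1F → eq₁′
          2F → eq₁′
          3F → eq₃ a b j r }
      where
      t≡ : a + b + 2 * j ≡ 2 * (1 + r)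
      t≡ = ℕ.+-cancelʳ-≡ 2 _ _ (trans (ℕ.+-assoc (a + b) (2 * j) 2) (trans eq (identity r)))
        where
        identity : ∀ r → 2 * (2 + r) ≡ 2 * (1 + r) + 2
        identity = solve-∀
      total₁ : ∀ a b j r → a * (1 + r) + (2 * (1 + r) * j + a + 2 * j + (b * (2 + r) + 0)) ≡ (a + b + 2 * j) * (2 + r)
      total₁ = solve-∀
      eq₀ : ∀ a b j r → 2 * (1 + r) * (2 + r) * a ≡
        a * (1 + r) * (4 + r * (2 + r * 0)) + ((2 * (1 + r) * j + a + 2 * j) * 0 + (b * (2 + r) * 0 + 0))
      eq₀ = solve-∀
      eq₃ : ∀ a b j r → 2 * (1 + r) * (2 + r) * b ≡
        a * (1 + r) * 0 + ((2 * (1 + r) * j + a + 2 * j) * 0 + (b * (2 + r) * (2 + r * (2 + r * 0)) + 0))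
      eq₃ = solve-∀
      eq₁ : ∀ j r → 2 * (1 + r) * (2 + r) * suc j ≡ (2 + r) * (2 * (1 + r) * j + 2 * (1 + r))
      eq₁ = solve-∀
      eq₂ : ∀ a b j r → (2 + r) * (2 * (1 + r) * j + (a + b + 2 * j)) ≡
        a * (1 + r) * 0 + ((2 * (1 + r) * j + a + 2 * j) * (2 + r * (1 + r * 0)) + (b * (2 + r) * (1 + r * 0) + 0))
      eq₂ = solve-∀
      eq₁′ = trans (eq₁ j r) (trans (cong (λ t → (2 + r) * (2 * (1 + r) * j + t)) (sym t≡)) (eq₂ a b j r))

    -- A product of two mixtures: a : b divides between the sequences with loops at 0 (B and C) and
    -- those with loops at 1 (G and D), and v : j divides between few switches (B and G) and many (C
    -- and D).
    even-leaves : ∀ {a b} j → (a + b) + (2 * j + 1) ≡ 2 * m →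
                  Mean (verticesAt evenTable r) (coordinates₄ a (suc j) j b)
    even-leaves {a} {b} j eq = record
      { denominator = (1 + 2 * v) * (1 + r)
      ; coefficient = coefficients₇ 0 (a * v) (a * j) (b * j) 0 0 (b * v)
      ; positive    = s≤s z≤n
      ; total-eq    = trans (total₁ a b j v) (cong₂ _*_ t≡ v+j≡)
      ; equation    = λ where
          0F → trans (cong (λ s → (1 + 2 * v) * s * a) (sym v+j≡))
                 (trans (eq₀ a j v) (trans (cong (λ s → a * (v * (1 + 2 * s) + j)) v+j≡) (eq₀′ a b j v r)))
          1F → trans (cong₂ (λ t s → t * s * suc j) (sym t≡) (sym v+j≡))
                 (trans (eq₁ a b j v) (trans (cong (λ s → (a + b) * (v + j * (1 + s))) v+j≡) (eq₁′ a b j v r)))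
          2F → trans (cong (λ t → t * (1 + r) * j) (sym t≡)) (eq₂ a b j v r)
          3F → trans (cong (λ s → (1 + 2 * v) * s * b) (sym v+j≡))
                 (trans (eq₀ b j v) (trans (cong (λ s → b * (v * (1 + 2 * s) + j)) v+j≡) (eq₃ a b j v r))) }
      where
      split = split-parity {a + b} j (1 + r) (ℕ.+-cancelʳ-≡ 1 _ _ (trans (ℕ.+-assoc (a + b) (2 * j) 1) (trans eq (identity r))))
        where
        identity : ∀ r → 2 * (2 + r) ≡ (1 + 2 * (1 + r)) + 1
        identity = solve-∀
      v = proj₁ split
      v+j≡ : v + j ≡ 1 + r
      v+j≡ = proj₁ (proj₂ split)
      t≡ : a + b ≡ 1 + 2 * v
      t≡ = proj₂ (proj₂ split)
      total₁ : ∀ a b j v → a * v + (a * j + (b * j + (b * v + 0))) ≡ (a + b) * (v + j)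
      total₁ = solve-∀
      eq₀ : ∀ a j v → (1 + 2 * v) * (v + j) * a ≡ a * (v * (1 + 2 * (v + j)) + j)
      eq₀ = solve-∀
      eq₀′ : ∀ a b j v r → a * (v * (1 + 2 * (1 + r)) + j) ≡
        a * v * (3 + r * (2 + r * 0)) + (a * j * (1 + r * 0) + (b * j * 0 + (b * v * 0 + 0)))
      eq₀′ = solve-∀
      eq₁ : ∀ a b j v → (a + b) * (v + j) * suc j ≡ (a + b) * (v + j * (1 + (v + j)))
      eq₁ = solve-∀
      eq₁′ : ∀ a b j v r → (a + b) * (v + j * (1 + (1 + r))) ≡
        a * v * (1 + r * 0) + (a * j * (2 + r * (1 + r * 0)) + (b * j * (2 + r * (1 + r * 0)) + (b * v * (1 + r * 0) + 0)))
      eq₁′ = solve-∀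
      eq₂ : ∀ a b j v r → (a + b) * (1 + r) * j ≡
        a * v * 0 + (a * j * (1 + r * (1 + r * 0)) + (b * j * (1 + r * (1 + r * 0)) + (b * v * 0 + 0)))
      eq₂ = solve-∀
      eq₃ : ∀ a b j v r → b * (v * (1 + 2 * (1 + r)) + j) ≡
        a * v * 0 + (a * j * 0 + (b * j * (1 + r * 0) + (b * v * (3 + r * (2 + r * 0)) + 0)))
      eq₃ = solve-∀

    -- Again a mixture of mixtures, but A makes no round trip while F already makes one. Hence the
    -- share of a is divided between A and C as v : (j + 1), and the share of b between F and D as v
    -- : j.
    odd-returns : ∀ {a b} j → (a + b) + (2 * j + 2) ≡ 2 * m + 1 →
                  Mean (verticesAt oddTable r) (coordinates₄ a (suc j) (suc j) b)
    odd-returns {a} {b} j eq = record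
      { denominator = (1 + 2 * v) * ((1 + r) * (2 + r))
      ; coefficient = coefficients₇ (a * v * (1 + r)) 0 (a * suc j * (1 + r)) (b * j * (2 + r)) 0 (b * v * (2 + r)) 0
      ; positive    = s≤s z≤n
      ; total-eq    = trans (total₁ a b j v r) (trans (cong (λ s → a * (1 + r) * (1 + s) + b * (2 + r) * s) v+j≡)
                        (trans (total₂ a b r) (cong (_* ((1 + r) * (2 + r))) t≡)))
      ; equation    = λ where
          0F → trans (eq₀ a v r) (trans (cong (λ s → a * (1 + r) * (2 * (v * (1 + r)) + 2 * v + 1 + s)) (sym v+j≡)) (eq₀′ a b j v r))
          1F → eq₁″
          2F → eq₁″
          3F → trans (eq₃ b v r) (trans (cong (λ s → b * (2 + r) * (s + 2 * (v * (1 + r)))) (sym v+j≡)) (eq₃′ a b j v r)) }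
      where
      split = split-parity {a + b} j (1 + r) (ℕ.+-cancelʳ-≡ 2 _ _ (trans (ℕ.+-assoc (a + b) (2 * j) 2) (trans eq (identity r))))
        where
        identity : ∀ r → 2 * (2 + r) + 1 ≡ (1 + 2 * (1 + r)) + 2
        identity = solve-∀
      v = proj₁ split
      v+j≡ : v + j ≡ 1 + r
      v+j≡ = proj₁ (proj₂ split)
      t≡ : a + b ≡ 1 + 2 * v
      t≡ = proj₂ (proj₂ split)
      total₁ : ∀ a b j v r → a * v * (1 + r) + (a * suc j * (1 + r) + (b * j * (2 + r) + (b * v * (2 + r) + 0))) ≡
        a * (1 + r) * (1 + (v + j)) + b * (2 + r) * (v + j)
      total₁ = solve-∀
      total₂ : ∀ a b r → a * (1 + r) * (1 + (1 + r)) + b * (2 + r) * (1 + r) ≡ (a + b) * ((1 + r) * (2 + r))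
      total₂ = solve-∀
      eq₀ : ∀ a v r → (1 + 2 * v) * ((1 + r) * (2 + r)) * a ≡ a * (1 + r) * (2 * (v * (1 + r)) + 2 * v + 1 + (1 + r))
      eq₀ = solve-∀
      eq₀′ : ∀ a b j v r → a * (1 + r) * (2 * (v * (1 + r)) + 2 * v + 1 + (v + j)) ≡
        a * v * (1 + r) * (5 + r * (2 + r * 0)) + (a * suc j * (1 + r) * (1 + r * 0) + (b * j * (2 + r) * 0 + (b * v * (2 + r) * 0 + 0)))
      eq₀′ = solve-∀
      eq₁ : ∀ a b j r → (a + b) * ((1 + r) * (2 + r)) * suc j ≡ a * suc j * (1 + r) * (2 + r) + b * (2 + r) * (j * (1 + r) + (1 + r))
      eq₁ = solve-∀
      eq₁′ : ∀ a b j v r → a * suc j * (1 + r) * (2 + r) + b * (2 + r) * (j * (1 + r) + (v + j)) ≡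
        a * v * (1 + r) * 0 + (a * suc j * (1 + r) * (2 + r * (1 + r * 0)) + (b * j * (2 + r) * (2 + r * (1 + r * 0)) + (b * v * (2 + r) * (1 + r * 0) + 0)))
      eq₁′ = solve-∀
      eq₁″ = trans (cong (λ t → t * ((1 + r) * (2 + r)) * suc j) (sym t≡)) (trans (eq₁ a b j r)
        (trans (cong (λ s → a * suc j * (1 + r) * (2 + r) + b * (2 + r) * (j * (1 + r) + s)) (sym v+j≡)) (eq₁′ a b j v r)))
      eq₃ : ∀ b v r → (1 + 2 * v) * ((1 + r) * (2 + r)) * b ≡ b * (2 + r) * ((1 + r) + 2 * (v * (1 + r)))
      eq₃ = solve-∀
      eq₃′ : ∀ a b j v r → b * (2 + r) * ((v + j) + 2 * (v * (1 + r))) ≡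
        a * v * (1 + r) * 0 + (a * suc j * (1 + r) * 0 + (b * j * (2 + r) * (1 + r * 0) + (b * v * (2 + r) * (3 + r * (2 + r * 0)) + 0)))
      eq₃′ = solve-∀

    -- In the triangle B E G the loops at 0 and at 1 force the coefficients a/(n - 1) and b/(n - 1);
    -- the remainder 2j/(n - 1) goes to E.
    odd-leaves : ∀ {a b} j → (a + b) + (2 * j + 1) ≡ 2 * m + 1 →
                 Mean (verticesAt oddTable r) (coordinates₄ a (suc j) j b)
    odd-leaves {a} {b} j eq = record
      { denominator = 2 * m
      ; coefficient = coefficients₇ 0 a 0 0 (2 * j) 0 b
      ; positive    = s≤s z≤n
      ; total-eq    = trans (total₁ a b j) t≡
      ; equation    = λ where
          0F → eq₀ a b j r
          1F → trans (eq₁ j r) (trans (cong (_+ 2 * j * (2 + r)) (sym t≡)) (eq₁′ a b j r))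
          2F → eq₂ a b j r
          3F → eq₃ a b j r }
      where
      t≡ : a + b + 2 * j ≡ 2 * m
      t≡ = ℕ.+-cancelʳ-≡ 1 _ _ (trans (ℕ.+-assoc (a + b) (2 * j) 1) eq)
      total₁ : ∀ a b j → a + (2 * j + (b + 0)) ≡ a + b + 2 * j
      total₁ = solve-∀
      eq₀ : ∀ a b j r → 2 * (2 + r) * a ≡ a * (4 + r * (2 + r * 0)) + (2 * j * 0 + (b * 0 + 0))
      eq₀ = solve-∀
      eq₁ : ∀ j r → 2 * (2 + r) * suc j ≡ 2 * (2 + r) + 2 * j * (2 + r)
      eq₁ = solve-∀
      eq₁′ : ∀ a b j r → a + b + 2 * j + 2 * j * (2 + r) ≡ a * (1 + r * 0) + (2 * j * (3 + r * (1 + r * 0)) + (b * (1 + r * 0) + 0))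
      eq₁′ = solve-∀
      eq₂ : ∀ a b j r → 2 * (2 + r) * j ≡ a * 0 + (2 * j * (2 + r * (1 + r * 0)) + (b * 0 + 0))
      eq₂ = solve-∀
      eq₃ : ∀ a b j r → 2 * (2 + r) * b ≡ a * 0 + (2 * j * 0 + (b * (4 + r * (2 + r * 0)) + 0))
      eq₃ = solve-∀

    even-mean : ∀ {x₀₀ x₀₁ x₁₀ x₁₁} → Shape (2 * m) x₀₀ x₀₁ x₁₀ x₁₁ → Mean (verticesAt evenTable r) (coordinates₄ x₀₀ x₀₁ x₁₀ x₁₁)
    even-mean stays          = stays-mean evenTable λ { 0F → sym (even-size r) ; 1F → refl ; 2F → refl ; 3F → refl }
    even-mean (returns j eq) = even-returns j eq
    even-mean (leaves j eq)  = even-leaves j eq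

    odd-mean : ∀ {x₀₀ x₀₁ x₁₀ x₁₁} → Shape (2 * m + 1) x₀₀ x₀₁ x₁₀ x₁₁ → Mean (verticesAt oddTable r) (coordinates₄ x₀₀ x₀₁ x₁₀ x₁₁)
    odd-mean stays          = stays-mean oddTable λ { 0F → sym (odd-size r) ; 1F → refl ; 2F → refl ; 3F → refl }
    odd-mean (returns j eq) = odd-returns j eq
    odd-mean (leaves j eq)  = odd-leaves j eq

open SevenSequences

-- Homogeneous linear systems and affine independence.

module LinearAlgebra (em : ExcludedMiddle 0ℓ) (ℝ : CompleteOrderedField) where

  open CompleteOrderedField ℝ hiding (zero)
  open Over ℝ
  open OrderedField em ℝ
  open RingSolver ℝ

  sum-zero : ∀ {k} {u : ℝ^ k} → (∀ i → u i ≈ 0#) → sum u ≈ 0#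
  sum-zero {k} u≈0 = trans (sum-cong-≋ u≈0) (sum-replicate-zero k)

  sum-nonneg-zero : ∀ {k} {u : ℝ^ k} → (∀ i → 0# ≤ u i) → sum u ≈ 0# → ∀ i → u i ≈ 0#
  sum-nonneg-zero {suc k} {u} 0≤u eq zero = antisym
    (≤-respʳ-≈ eq (≤-respˡ-≈ (+-identityʳ (u zero)) (+-mono-≤ ≤-refl (sum-nonneg λ i → 0≤u (suc i))))) (0≤u zero)
  sum-nonneg-zero {suc k} {u} 0≤u eq (suc i) = sum-nonneg-zero (λ i → 0≤u (suc i))
    (trans (sym (+-identityˡ _)) (trans (+-congʳ (sym (sum-nonneg-zero 0≤u eq zero))) eq)) i

  ∙-cong : ∀ {d} (c : ℝ^ d) {u v : ℝ^ d} → u ≋ v → c ∙ u ≈ c ∙ v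
  ∙-cong c u≋v = sum-cong-≋ λ i → *-congˡ (u≋v i)

  ∙-combination : ∀ {d k} (c : ℝ^ d) (a : ℝ^ k) (u : Fin k → ℝ^ d) → c ∙ combination a u ≈ a ∙ (λ i → c ∙ u i)
  ∙-combination {d} {k} c a u = begin
    sum (λ j → c j * sum (λ i → a i * u i j))    ≈⟨ sum-cong-≋ (λ j → *-distribˡ-sum (c j) (λ i → a i * u i j)) ⟩
    sum (λ j → sum (λ i → c j * (a i * u i j)))  ≈⟨ ∑-comm {d} {k} (λ j i → c j * (a i * u i j)) ⟩
    sum (λ i → sum (λ j → c j * (a i * u i j)))  ≈⟨ sum-cong-≋ (λ i → trans
        (sum-cong-≋ λ j → solve 3 (λ c a u → c :* (a :* u) := a :* (c :* u)) refl (c j) (a i) (u i j))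
        (sym (*-distribˡ-sum (a i) (λ j → c j * u i j)))) ⟩
    sum (λ i → a i * (c ∙ u i))                  ∎
    where open Relation.Binary.Reasoning.Setoid setoid

  ∙-const : ∀ {k} (a : ℝ^ k) {u : ℝ^ k} {b} → (∀ i → u i ≈ b) → a ∙ u ≈ sum a * b
  ∙-const a {b = b} eq = trans (sum-cong-≋ λ i → *-congˡ (eq i)) (sym (*-distribʳ-sum b a))

  ∙-- : ∀ {k} (a b c : ℝ^ k) t → (λ i → a i - t * b i) ∙ c ≈ a ∙ c - t * (b ∙ c)
  ∙-- {zero}  a b c t = solve 1 (λ t → con (+ 0) := con (+ 0) :- t :* con (+ 0)) refl t
  ∙-- {suc k} a b c t = trans (+-congˡ (∙-- (λ i → a (suc i)) (λ i → b (suc i)) (λ i → c (suc i)) t))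
    (solve 6 (λ a b c t p q → (a :- t :* b) :* c :+ (p :- t :* q) := (a :* c :+ p) :- t :* (b :* c :+ q)) refl
      (a zero) (b zero) (c zero) t ((λ i → a (suc i)) ∙ (λ i → c (suc i))) ((λ i → b (suc i)) ∙ (λ i → c (suc i))))

  -- One step of elimination: an injective linear map into the kernel of φ, together with its
  -- transpose `pullback`, which rewrites the other equations in one unknown fewer.
  record KernelEmbedding {m : ℕ} (φ : ℝ^ (suc m)) : Set where
    field
      embed     : ℝ^ m → ℝ^ (suc m)
      pullback  : ℝ^ (suc m) → ℝ^ m
      adjoint   : ∀ ψ c → ψ ∙ embed c ≈ pullback ψ ∙ c
      kills     : ∀ c → φ ∙ embed c ≈ 0#
      injective : ∀ c → embed c ≋ (λ _ → 0#) → c ≋ (λ _ → 0#)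

  kernelEmbedding : ∀ {m} (φ : ℝ^ (suc m)) → KernelEmbedding φ
  kernelEmbedding {m} φ = by-cases m φ em
    where
    solve-first : ∀ {m} (φ : ℝ^ (suc m)) → ¬ φ zero ≈ 0# → KernelEmbedding φ
    solve-first {m} φ φ₀≉0 = record
      { embed     = λ c → - (i * (φ′ ∙ c)) Vector.∷ c
      ; pullback  = λ ψ k → ψ (suc k) - (ψ zero * i) * φ′ k
      ; adjoint   = λ ψ c → trans
          (solve 4 (λ p i f s → p :* :- (i :* f) :+ s := s :- (p :* i) :* f) refl (ψ zero) i (φ′ ∙ c) ((λ k → ψ (suc k)) ∙ c))
          (sym (∙-- (λ k → ψ (suc k)) φ′ c (ψ zero * i)))
      ; kills     = λ c → trans
          (solve 3 (λ p i f → p :* :- (i :* f) :+ f := (con (+ 1) :- p :* i) :* f) refl (φ zero) i (φ′ ∙ c))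
          (trans (*-congʳ (trans (+-congˡ (-‿cong (proj₂ (inverse (φ zero) φ₀≉0)))) (-‿inverseʳ 1#))) (zeroˡ _))
      ; injective = λ c eq k → eq (suc k) }
      where
      i = proj₁ (inverse (φ zero) φ₀≉0)
      φ′ : ℝ^ m
      φ′ k = φ (suc k)

    by-cases : ∀ m (φ : ℝ^ (suc m)) → Dec (φ zero ≈ 0#) → KernelEmbedding φ
    by-cases m       φ (no φ₀≉0)  = solve-first φ φ₀≉0
    by-cases zero    φ (yes φ₀≈0) = record
      { embed     = λ _ _ → 0#
      ; pullback  = λ _ → Vector.[]
      ; adjoint   = λ ψ _ → solve 1 (λ p → p :* con (+ 0) :+ con (+ 0) := con (+ 0)) refl (ψ zero)
      ; kills     = λ _ → solve 1 (λ p → p :* con (+ 0) :+ con (+ 0) := con (+ 0)) refl (φ zero)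
      ; injective = λ _ _ () }
    by-cases (suc m) φ (yes φ₀≈0) = record
      { embed     = λ c → c zero Vector.∷ embed (λ k → c (suc k))
      ; pullback  = λ ψ → ψ zero Vector.∷ pullback (λ k → ψ (suc k))
      ; adjoint   = λ ψ c → +-congˡ (adjoint (λ k → ψ (suc k)) (λ k → c (suc k)))
      ; kills     = λ c → trans (+-cong (trans (*-congʳ φ₀≈0) (zeroˡ _)) (kills (λ k → c (suc k)))) (+-identityʳ 0#)
      ; injective = λ { c eq zero → eq zero ; c eq (suc k) → injective (λ k → c (suc k)) (λ j → eq (suc j)) k } }
      where open KernelEmbedding (by-cases m (λ k → φ (suc k)) em)

  nontrivial-solution : ∀ k (rows : Fin k → ℝ^ (suc k)) →
    ∃ λ (c : ℝ^ (suc k)) → (∀ r → rows r ∙ c ≈ 0#) × ¬ c ≋ (λ _ → 0#)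
  nontrivial-solution zero    rows = (λ _ → 1#) , (λ ()) , λ eq → 0≉1 (sym (eq zero))
  nontrivial-solution (suc k) rows = embed c , zeros , λ eq → proj₂ (proj₂ rest) (injective c eq)
    where
    open KernelEmbedding (kernelEmbedding (rows zero))
    rest = nontrivial-solution k (λ r → pullback (rows (suc r)))
    c = proj₁ rest
    zeros : ∀ r → rows r ∙ embed c ≈ 0#
    zeros zero    = kills c
    zeros (suc r) = trans (adjoint (rows (suc r)) c) (proj₁ (proj₂ rest) r)

  -- Five unknown coefficients face only four equations: their sum and three coordinates. The fourth
  -- coordinate vanishes by itself, because all points have the same coordinate sum.
  ¬independent₅ : ∀ {K : Pred (ℝ^ 4) 0ℓ} {n} → (∀ v → K v → sum v ≈ n) → ¬ ContainsIndependent 5 K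
  ¬independent₅ {K} {n} size (u , inK , independent) = proj₂ (proj₂ solution)
      (λ i → independent c sum≈0 zeros i)
    where
    rows : Fin 4 → ℝ^ 5
    rows zero    i = 1#
    rows (suc j) i = u i (inject₁ j)
    solution = nontrivial-solution 4 rows
    c = proj₁ solution
    sum≈0 : sum c ≈ 0#
    sum≈0 = trans (sum-cong-≋ λ i → sym (*-identityˡ (c i))) (proj₁ (proj₂ solution) zero)
    coordinate : ∀ j → combination c u (inject₁ j) ≈ 0#
    coordinate j = trans (sum-cong-≋ λ i → *-comm (c i) (u i (inject₁ j))) (proj₁ (proj₂ solution) (suc j))
    total≈0 : sum (combination c u) ≈ 0#
    total≈0 = begin
      sum (λ j → sum (λ i → c i * u i j))   ≈⟨ ∑-comm {4} {5} (λ j i → c i * u i j) ⟩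
      sum (λ i → sum (λ j → c i * u i j))   ≈⟨ sum-cong-≋ (λ i → trans (sym (*-distribˡ-sum (c i) (u i))) (*-congˡ (size (u i) (inK i)))) ⟩
      sum (λ i → c i * n)                   ≈⟨ sym (*-distribʳ-sum n c) ⟩
      sum c * n                             ≈⟨ *-congʳ sum≈0 ⟩
      0# * n                                ≈⟨ zeroˡ n ⟩
      0#                                    ∎
      where open Relation.Binary.Reasoning.Setoid setoid
    zeros : combination c u ≋ (λ _ → 0#)
    zeros 0F = coordinate 0F
    zeros 1F = coordinate 1F
    zeros 2F = coordinate 2F
    zeros 3F = begin
      y₃                               ≈⟨ solve 1 (λ y → y := con (+ 0) :+ (con (+ 0) :+ (con (+ 0) :+ (y :+ con (+ 0))))) refl y₃ ⟩
      0# + (0# + (0# + (y₃ + 0#)))     ≈⟨ +-cong (sym (coordinate 0F)) (+-cong (sym (coordinate 1F)) (+-congʳ (sym (coordinate 2F)))) ⟩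
      sum (combination c u)            ≈⟨ total≈0 ⟩
      0#                               ∎
      where
      open Relation.Binary.Reasoning.Setoid setoid
      y₃ = combination c u 3F

  -- Evaluating c on a vanishing combination with coefficient sum 0 leaves only the coefficient of
  -- v, multiplied by c ∙ v - b.
  extend-independent : ∀ {d k} (c : ℝ^ d) {b} {u : Fin k → ℝ^ d} {v} → (∀ i → c ∙ u i ≈ b) → ¬ c ∙ v ≈ b →
                       AffinelyIndependent u → AffinelyIndependent (v Vector.∷ u)
  extend-independent {d} {k} c {b} {u} {v} on off independent a sum≈0 comb≈0 = λ where
      zero    → a₀≈0
      (suc i) → independent a′ (trans (sym (+-identityˡ _)) (trans (+-congʳ (sym a₀≈0)) sum≈0))
                  (λ j → trans (sym (+-identityˡ _)) (trans (+-congʳ (sym (trans (*-congʳ a₀≈0) (zeroˡ _)))) (comb≈0 j))) i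
    where
    a₀ = a zero
    a′ : ℝ^ k
    a′ i = a (suc i)
    sum′≈ : sum a′ ≈ - a₀
    sum′≈ = trans (solve 2 (λ p q → q := (p :+ q) :- p) refl a₀ (sum a′)) (trans (+-congʳ sum≈0) (+-identityˡ _))
    product≈0 : (c ∙ v - b) * a₀ ≈ 0#
    product≈0 = begin
      (c ∙ v - b) * a₀                     ≈⟨ solve 3 (λ p b a → (p :- b) :* a := a :* p :+ :- a :* b) refl (c ∙ v) b a₀ ⟩
      a₀ * (c ∙ v) + - a₀ * b              ≈⟨ +-congˡ (*-congʳ (sym sum′≈)) ⟩
      a₀ * (c ∙ v) + sum a′ * b            ≈⟨ +-congˡ (sym (∙-const a′ on)) ⟩
      a ∙ (λ i → c ∙ (v Vector.∷ u) i)     ≈⟨ sym (∙-combination c a (v Vector.∷ u)) ⟩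
      c ∙ combination a (v Vector.∷ u)     ≈⟨ ∙-cong c comb≈0 ⟩
      c ∙ (λ _ → 0#)                       ≈⟨ sum-zero (λ i → zeroʳ (c i)) ⟩
      0#                                   ∎
      where open Relation.Binary.Reasoning.Setoid setoid
    a₀≈0 : a₀ ≈ 0#
    a₀≈0 = *-cancelˡ-≈0 (λ eq → off (trans (solve 2 (λ p b → p := (p :- b) :+ b) refl (c ∙ v) b) (trans (+-congʳ eq) (+-identityˡ b)))) product≈0

-- What the two parities share. The polytope and the min-weight sequences are treated once from
-- these fields; the Viterbi sequences are not, since there the answers differ.
record Model (n : ℕ) (seq : Fin 7 → List State) : Set where
  field
    table      : Table
    valid      : Table.Valid table
    r          : ℕ
    size-eq    : n ≡ eval (Table.size table) r
    seq-path   : ∀ i → PathFrom0 n (seq i)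
    seq-counts : ∀ i k → counts (seq i) k ≡ verticesAt table r i k
    mean       : ∀ {x₀₀ x₀₁ x₁₀ x₁₁} → Shape n x₀₀ x₀₁ x₁₀ x₁₁ → Mean (verticesAt table r) (coordinates₄ x₀₀ x₀₁ x₁₀ x₁₁)

  open Table table public
  open Valid valid public

  P : Fin 7 → Fin 4 → ℕ
  P = verticesAt table r

  at : ∀ {k} → Vector Poly k → Vector ℕ k
  at v i = eval (v i) r

module Embedding (em : ExcludedMiddle 0ℓ) (ℝ : CompleteOrderedField) where

  open CompleteOrderedField ℝ hiding (zero)
  open Over ℝ
  open OrderedField em ℝ
  open RingSolver ℝ

  ι : ℕ → Carrier
  ι k = k · 1#

  ι-+ : ∀ j k → ι (j ℕ.+ k) ≈ ι j + ι k
  ι-+ = ·-homo-+ 1#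

  ι-* : ∀ j k → ι (j ℕ.* k) ≈ ι j * ι k
  ι-* = ×1-homo-*

  ι-sum : ∀ {k} (f : Vector ℕ k) → ι (sumℕ f) ≈ sum (λ i → ι (f i))
  ι-sum {zero}  f = refl
  ι-sum {suc k} f = trans (ι-+ (f zero) _) (+-congˡ (ι-sum (f ∘ suc)))

  ι-nonneg : ∀ k → 0# ≤ ι k
  ι-nonneg k = ·-nonneg k 0≤1

  ι-pos : ∀ {k} → 0 ℕ.< k → 0# < ι k
  ι-pos {suc k} _ = ·-pos k 0<1

  ι-mono-< : ∀ {j k} → j ℕ.< k → ι j < ι k
  ι-mono-< {j} {k} j<k = <-by-difference (ι-pos (ℕ.m<n⇒0<n∸m j<k)) (begin
    ι k - ι j                     ≡⟨ ≡.cong (λ i → ι i - ι j) (≡.sym (ℕ.m+[n∸m]≡n (ℕ.<⇒≤ j<k))) ⟩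
    ι (j ℕ.+ (k ℕ.∸ j)) - ι j     ≈⟨ +-congʳ (ι-+ j (k ℕ.∸ j)) ⟩
    (ι j + ι (k ℕ.∸ j)) - ι j     ≈⟨ solve 2 (λ p q → (p :+ q) :- p := q) refl (ι j) (ι (k ℕ.∸ j)) ⟩
    ι (k ℕ.∸ j)                   ∎)
    where open Relation.Binary.Reasoning.Setoid setoid

  ι-cancel-< : ∀ {j k} → ι j < ι k → j ℕ.< k
  ι-cancel-< {j} {k} lt with ℕ.<-cmp j k
  ... | tri< j<k _ _    = j<k
  ... | tri≈ _ ≡.refl _ = contradiction refl (proj₂ lt)
  ... | tri> _ _ k<j    = contradiction (proj₁ (ι-mono-< k<j)) (<⇒≱ lt)

  ι-injective : ∀ {j k} → ι j ≈ ι k → j ≡ k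
  ι-injective {j} {k} eq with ℕ.<-cmp j k
  ... | tri< j<k _ _ = contradiction eq (proj₂ (ι-mono-< j<k))
  ... | tri≈ _ j≡k _ = j≡k
  ... | tri> _ _ k<j = contradiction (sym eq) (proj₂ (ι-mono-< k<j))

  point≈ι : ∀ s k → point s k ≈ ι (counts s k)
  point≈ι s 0F = refl
  point≈ι s 1F = refl
  point≈ι s 2F = refl
  point≈ι s 3F = refl

  ι-∙-point : ∀ (g : Fin 4 → ℕ) s → (λ k → ι (g k)) ∙ point s ≈ ι (g • counts s)
  ι-∙-point g s = sym (trans (ι-sum (λ k → g k ℕ.* counts s k))
    (sum-cong-≋ λ k → trans (ι-* (g k) (counts s k)) (*-congˡ (sym (point≈ι s k)))))

  sameCounts⇒≋ : ∀ {s t} → SameCounts s t → point s ≋ point t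
  sameCounts⇒≋ {s} {t} eq k = trans (point≈ι s k) (trans (reflexive (≡.cong ι (eq k))) (sym (point≈ι t k)))

  ≋⇒sameCounts : ∀ {s t} → point s ≋ point t → SameCounts s t
  ≋⇒sameCounts {s} {t} eq k = ι-injective (trans (sym (point≈ι s k)) (trans (eq k) (point≈ι t k)))

  weight≈∙ : ∀ w s → weight w s ≈ w ∙ point s
  weight≈∙ w s = trans (foldr-occurrences +-commutativeMonoid _ (transitions s)) (trans
    (+-cong (+-cong (scale 0F (x 𝟎 𝟎 s)) (scale 1F (x 𝟎 𝟏 s))) (+-cong (scale 2F (x 𝟏 𝟎 s)) (scale 3F (x 𝟏 𝟏 s))))
    (solve 4 (λ p q r t → (p :+ q) :+ (r :+ t) := p :+ (q :+ (r :+ (t :+ con (+ 0))))) refl _ _ _ _))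
    where
    scale : ∀ k j → j · w k ≈ w k * ι j
    scale k j = sym (trans (·-comm-* j (w k) 1#) (·-congʳ j (*-identityʳ (w k))))

-- The face lattice of the polytope.

module Polytope (em : ExcludedMiddle 0ℓ) (ℝ : CompleteOrderedField) {n : ℕ} {seq : Fin 7 → List State} (model : Model n seq) where

  open CompleteOrderedField ℝ hiding (zero)
  open Over ℝ
  open OrderedField em ℝ
  open RingSolver ℝ
  open LinearAlgebra em ℝ
  open Embedding em ℝ
  open Model model

  K : Pred (ℝ^ 4) 0ℓ
  K = TransitionPolytope n

  V : Fin 7 → ℝ^ 4
  V i = point (seq i)

  ι-∙-V : ∀ (g : Fin 4 → ℕ) i → (λ k → ι (g k)) ∙ V i ≈ ι (g • P i)
  ι-∙-V g i = trans (ι-∙-point g (seq i))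
    (reflexive (≡.cong ι (sumℕ-cong λ k → ≡.cong (g k ℕ.*_) (seq-counts i k))))

  -- In `K` the points to be combined range over arbitrary finite families of paths. Rewriting
  -- everything over the seven fixed vertices gives each point coefficients that functionals and
  -- faces can be tested against.
  record Hull (v : ℝ^ 4) : Set where
    field
      coeff        : ℝ^ 7
      coeff-nonneg : ∀ i → 0# ≤ coeff i
      coeff-sum    : sum coeff ≈ 1#
      v≋           : v ≋ combination coeff V

  hull-resp : ∀ {u v} → u ≋ v → Hull v → Hull u
  hull-resp u≋v h = record
    { coeff = coeff ; coeff-nonneg = coeff-nonneg ; coeff-sum = coeff-sum ; v≋ = λ k → trans (u≋v k) (v≋ k) }
    where open Hull h

  path⇒hull : ∀ s → PathFrom0 n s → Hull (point s)
  path⇒hull s path = record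
    { coeff        = λ i → ι (coefficient i) * d⁻¹
    ; coeff-nonneg = λ i → *-nonneg (ι-nonneg (coefficient i)) (proj₁ (proj₁ (proj₂ inv)))
    ; coeff-sum    = trans (sym (*-distribʳ-sum d⁻¹ (λ i → ι (coefficient i))))
        (trans (*-congʳ (trans (sym (ι-sum coefficient)) (reflexive (≡.cong ι total-eq)))) (proj₂ (proj₂ inv)))
    ; v≋           = λ k → sym (begin
        sum (λ i → ι (coefficient i) * d⁻¹ * V i k)
          ≈⟨ sum-cong-≋ (λ i → solve 3 (λ c d v → c :* d :* v := d :* (c :* v)) refl (ι (coefficient i)) d⁻¹ (V i k)) ⟩
        sum (λ i → d⁻¹ * (ι (coefficient i) * V i k))
          ≈⟨ sym (*-distribˡ-sum d⁻¹ (λ i → ι (coefficient i) * V i k)) ⟩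
        d⁻¹ * sum (λ i → ι (coefficient i) * V i k)
          ≈⟨ *-congˡ (sum-cong-≋ λ i → trans (*-congˡ (V≈ι i k)) (sym (ι-* (coefficient i) (P i k)))) ⟩
        d⁻¹ * sum (λ i → ι (coefficient i ℕ.* P i k))
          ≈⟨ *-congˡ (trans (sym (ι-sum (λ i → coefficient i ℕ.* P i k))) (reflexive (≡.cong ι (≡.sym (equation k))))) ⟩
        d⁻¹ * ι (denominator ℕ.* coordinates₄ (x 𝟎 𝟎 s) (x 𝟎 𝟏 s) (x 𝟏 𝟎 s) (x 𝟏 𝟏 s) k)
          ≈⟨ *-congˡ (trans (ι-* denominator _) (*-congˡ (sym (point≈ι s k)))) ⟩
        d⁻¹ * (ι denominator * point s k)
          ≈⟨ solve 3 (λ i d p → i :* (d :* p) := d :* i :* p) refl d⁻¹ (ι denominator) (point s k) ⟩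
        ι denominator * d⁻¹ * point s k
          ≈⟨ trans (*-congʳ (proj₂ (proj₂ inv))) (*-identityˡ _) ⟩
        point s k ∎) }
    where
    open Mean (mean (pathShape s path))
    open Relation.Binary.Reasoning.Setoid setoid
    inv = inverse-pos (ι-pos positive)
    d⁻¹ = proj₁ inv
    V≈ι : ∀ i k → V i k ≈ ι (P i k)
    V≈ι i k = trans (point≈ι (seq i) k) (reflexive (≡.cong ι (seq-counts i k)))

  combination-hull : ∀ {k} (c : ℝ^ k) (u : Fin k → ℝ^ 4) → (∀ i → 0# ≤ c i) → sum c ≈ 1# → (∀ i → Hull (u i)) → Hull (combination c u)
  combination-hull {k} c u 0≤c sum≈1 h = record
    { coeff        = λ j → sum λ i → c i * coeff (h i) j
    ; coeff-nonneg = λ j → sum-nonneg λ i → *-nonneg (0≤c i) (coeff-nonneg (h i) j)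
    ; coeff-sum    = trans (∑-comm {7} {k} λ j i → c i * coeff (h i) j)
        (trans (sum-cong-≋ λ i → trans (sym (*-distribˡ-sum (c i) (coeff (h i)))) (trans (*-congˡ (coeff-sum (h i))) (*-identityʳ (c i)))) sum≈1)
    ; v≋           = λ l → begin
        sum (λ i → c i * u i l)
          ≈⟨ sum-cong-≋ (λ i → trans (*-congˡ (v≋ (h i) l)) (*-distribˡ-sum (c i) (λ j → coeff (h i) j * V j l))) ⟩
        sum (λ i → sum (λ j → c i * (coeff (h i) j * V j l)))
          ≈⟨ ∑-comm {k} {7} (λ i j → c i * (coeff (h i) j * V j l)) ⟩
        sum (λ j → sum (λ i → c i * (coeff (h i) j * V j l)))
          ≈⟨ sum-cong-≋ (λ j → trans (sum-cong-≋ λ i → sym (*-assoc (c i) (coeff (h i) j) (V j l)))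
               (sym (*-distribʳ-sum (V j l) (λ i → c i * coeff (h i) j)))) ⟩
        sum (λ j → sum (λ i → c i * coeff (h i) j) * V j l) ∎ }
    where
    open Hull
    open Relation.Binary.Reasoning.Setoid setoid

  K⇒hull : ∀ {v} → K v → Hull v
  K⇒hull (k , c , u , inS , 0≤c , sum≈1 , v≋) = hull-resp v≋ (combination-hull c u 0≤c sum≈1 λ i →
    let s , path , eq = inS i in hull-resp eq (path⇒hull s path))

  hull⇒K : ∀ {v} → Hull v → K v
  hull⇒K h = 7 , coeff , V , (λ i → seq i , seq-path i , λ _ → refl) , coeff-nonneg , coeff-sum , v≋
    where open Hull h

  V∈K : ∀ i → K (V i)
  V∈K i = hull⇒K (path⇒hull (seq i) (seq-path i))

  ∙-hull : ∀ {v} (h : Hull v) (c : ℝ^ 4) → c ∙ v ≈ Hull.coeff h ∙ (λ i → c ∙ V i)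
  ∙-hull h c = trans (∙-cong c v≋) (∙-combination c coeff V)
    where open Hull h

  hull-bound : ∀ {v} (h : Hull v) (c : ℝ^ 4) {b} → (∀ i → c ∙ V i ≤ b) → c ∙ v ≤ b
  hull-bound h c {b} bound = ≤-respˡ-≈ (sym (∙-hull h c)) (≤-respʳ-≈
    (trans (∙-const coeff (λ _ → refl)) (trans (*-congʳ coeff-sum) (*-identityˡ b)))
    (sum-mono-≤ λ i → *-monoˡ-≤ (coeff-nonneg i) (bound i)))
    where open Hull h

  hull-slack : ∀ {v} (h : Hull v) (c : ℝ^ 4) b → Hull.coeff h ∙ (λ i → b - c ∙ V i) ≈ b - c ∙ v
  hull-slack {v} h c b = begin
    sum (λ i → coeff i * (b - c ∙ V i))               ≈⟨ sum-cong-≋ (λ i → *-comm (coeff i) (b - c ∙ V i)) ⟩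
    sum (λ i → (b - c ∙ V i) * coeff i)               ≈⟨ sum-cong-≋ (λ i → *-congʳ {coeff i} (+-congˡ {b} (-‿cong (sym (*-identityˡ (c ∙ V i)))))) ⟩
    sum (λ i → (b - 1# * (c ∙ V i)) * coeff i)        ≈⟨ ∙-- (λ _ → b) (λ i → c ∙ V i) coeff 1# ⟩
    (λ _ → b) ∙ coeff - 1# * ((λ i → c ∙ V i) ∙ coeff) ≈⟨ +-cong
        (trans (sum-cong-≋ λ i → *-comm b (coeff i)) (trans (∙-const coeff (λ _ → refl)) (trans (*-congʳ coeff-sum) (*-identityˡ b))))
        (-‿cong (trans (*-identityˡ _) (trans (sum-cong-≋ λ i → *-comm (c ∙ V i) (coeff i)) (sym (∙-hull h c))))) ⟩
    b - c ∙ v                                         ∎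
    where
    open Hull h
    open Relation.Binary.Reasoning.Setoid setoid

  -- Complementary slackness: the nonnegative slacks b - c ∙ V i have weighted mean 0, so a vertex
  -- with nonzero slack carries no weight.
  hull-support : ∀ {v} (h : Hull v) (c : ℝ^ 4) {b} → (∀ i → c ∙ V i ≤ b) → c ∙ v ≈ b →
                 ∀ i → ¬ c ∙ V i ≈ b → Hull.coeff h i ≈ 0#
  hull-support {v} h c {b} bound eq i off = *-cancelˡ-≈0
    (λ slack≈0 → off (sym (trans (solve 2 (λ b p → b := (b :- p) :+ p) refl b (c ∙ V i)) (trans (+-congʳ slack≈0) (+-identityˡ _)))))
    (trans (*-comm _ _) (sum-nonneg-zero (λ j → *-nonneg (coeff-nonneg j) (0≤y-x (bound j)))
      (trans (hull-slack h c b) (trans (+-congˡ (-‿cong eq)) (-‿inverseʳ b))) i))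
    where open Hull h

  sum-single : ∀ {k} (u : ℝ^ (suc k)) i → (∀ j → ¬ i ≡ j → u j ≈ 0#) → sum u ≈ u i
  sum-single u i zeros = trans (Algebra.Properties.CommutativeMonoid.Sum.sum-remove +-commutativeMonoid {i = i} u)
    (trans (+-congˡ (sum-zero λ j → zeros (punchIn i j) λ eq → Fin.punchInᵢ≢i i j (≡.sym eq))) (+-identityʳ (u i)))

  hull-single : ∀ {v} (h : Hull v) i → (∀ j → ¬ i ≡ j → Hull.coeff h j ≈ 0#) → v ≋ V i
  hull-single h i zeros k = trans (v≋ k) (trans
    (sum-single (λ j → coeff j * V j k) i λ j i≢j → trans (*-congʳ (zeros j i≢j)) (zeroˡ _))
    (trans (*-congʳ (trans (sym (sum-single coeff i zeros)) coeff-sum)) (*-identityˡ _)))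
    where open Hull h

  hull-nonzero : ∀ {v} (h : Hull v) → ∃ λ i → ¬ Hull.coeff h i ≈ 0#
  hull-nonzero h with em {∃ λ i → ¬ Hull.coeff h i ≈ 0#}
  ... | yes found = found
  ... | no none   = contradiction (trans (sym (sum-zero all-zero)) (Hull.coeff-sum h)) 0≉1
    where
    all-zero : ∀ i → Hull.coeff h i ≈ 0#
    all-zero i with em {Hull.coeff h i ≈ 0#}
    ... | yes eq = eq
    ... | no neq = contradiction (i , neq) none

  -- A functional certifying that the vertices marked by z, and no others, lie on a face. Such faces
  -- are equal exactly when their patterns agree, so comparing faces becomes comparing Boolean
  -- tables.
  record Supporting (z : Fin 7 → Bool) : Set where
    field
      normal : ℝ^ 4
      bound  : Carrier
      on     : ∀ i → z i ≡ true → normal ∙ V i ≈ bound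
      off    : ∀ i → z i ≡ false → normal ∙ V i < bound

    below : ∀ i → normal ∙ V i ≤ bound
    below i with z i in eq
    ... | true  = ≤-reflexive (on i eq)
    ... | false = proj₁ (off i eq)

    face : Pred (ℝ^ 4) 0ℓ
    face v = K v × normal ∙ v ≈ bound

    face-V : ∀ i → z i ≡ true → face (V i)
    face-V i zi = V∈K i , on i zi

    below-K : ∀ v → K v → normal ∙ v ≤ bound
    below-K v v∈K = hull-bound (K⇒hull v∈K) normal below

    isFace : IsFace K face
    isFace = normal , bound , below-K , (λ v∈face → v∈face) , λ v∈face → v∈face

    support : ∀ {v} → face v → (h : Hull v) → ∀ i → z i ≡ false → Hull.coeff h i ≈ 0#
    support (_ , eq) h i zi = hull-support h normal below eq i (proj₂ (off i zi))

    support-on : ∀ {v} → face v → (h : Hull v) → ∀ i → ¬ Hull.coeff h i ≈ 0# → z i ≡ true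
    support-on v∈face h i nonzero with z i in zi
    ... | true  = ≡.refl
    ... | false = contradiction (support v∈face h i zi) nonzero

  open Supporting

  face-⊆ : ∀ {z z′} (S : Supporting z) (S′ : Supporting z′) → (∀ i → z i ≡ z′ i) → face S ⊆ face S′
  face-⊆ {z} {z′} S S′ same {v} v∈S@(v∈K , _) = v∈K , eq
    where
    h = K⇒hull v∈K
    open Hull h
    term : ∀ i → coeff i * (bound S′ - normal S′ ∙ V i) ≈ 0#
    term i with z i in zi
    ... | true  = trans (*-congˡ (trans (+-congˡ (-‿cong (on S′ i (≡.trans (≡.sym (same i)) zi)))) (-‿inverseʳ _))) (zeroʳ _)
    ... | false = trans (*-congʳ (support S v∈S h i zi)) (zeroˡ _)
    slack≈0 : bound S′ - normal S′ ∙ v ≈ 0#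
    slack≈0 = trans (sym (hull-slack h (normal S′) (bound S′))) (sum-zero term)
    eq : normal S′ ∙ v ≈ bound S′
    eq = sym (trans (solve 2 (λ b p → b := (b :- p) :+ p) refl (bound S′) (normal S′ ∙ v)) (trans (+-congʳ slack≈0) (+-identityˡ _)))

  face-≐ : ∀ {z z′} (S : Supporting z) (S′ : Supporting z′) → (∀ i → z i ≡ z′ i) → face S ≐ face S′
  face-≐ S S′ same = face-⊆ S S′ same , face-⊆ S′ S (λ i → ≡.sym (same i))

  face-≐⇒pattern : ∀ {z z′} (S : Supporting z) (S′ : Supporting z′) → face S ≐ face S′ → ∀ i → z i ≡ z′ i
  face-≐⇒pattern {z} {z′} S S′ (S⊆S′ , S′⊆S) i with z i in zi | z′ i in z′i
  ... | true  | true  = ≡.refl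
  ... | false | false = ≡.refl
  ... | true  | false = contradiction (proj₂ (S⊆S′ (face-V S i zi))) (proj₂ (off S′ i z′i))
  ... | false | true  = contradiction (proj₂ (S′⊆S (face-V S′ i z′i))) (proj₂ (off S i zi))

  ∙-+ : ∀ {k} (a b v : ℝ^ k) → (λ i → a i + b i) ∙ v ≈ a ∙ v + b ∙ v
  ∙-+ {k} a b v = trans (sum-cong-≋ λ i → distribʳ (v i) (a i) (b i)) (∑-distrib-+ {k} _ _)

  ∙-neg : ∀ {k} (a v : ℝ^ k) → (λ i → - a i) ∙ v ≈ - (a ∙ v)
  ∙-neg a v = +-cancelˡ-≈ (a ∙ v) (trans (sym (∙-+ a (λ i → - a i) v))
    (trans (sum-zero λ i → trans (*-congʳ (-‿inverseʳ (a i))) (zeroˡ (v i))) (sym (-‿inverseʳ (a ∙ v)))))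

  neg-mono-< : ∀ {y z} → y < z → - z < - y
  neg-mono-< {y} {z} y<z = <-by-difference (0<y-x y<z) (solve 2 (λ y z → :- y :- :- z := z :- y) refl y z)

  minimal⇒supporting : ∀ {z} (g : Fin 4 → ℕ) (o : ℕ) → (∀ i → z i ≡ true → g • P i ≡ o) → (∀ i → z i ≡ false → o ℕ.< g • P i) → Supporting z
  minimal⇒supporting {z} g o on′ off′ = record
    -- The tables state minima, while the inequalities defining faces are upper bounds; hence the
    -- signs.
    { normal = λ k → - ι (g k)
    ; bound  = - ι o
    ; on     = λ i zi → trans (value i) (-‿cong (reflexive (≡.cong ι (on′ i zi))))
    ; off    = λ i zi → <-resp-≈ (sym (value i)) refl (neg-mono-< (ι-mono-< (off′ i zi))) }
    where
    value : ∀ i → (λ k → - ι (g k)) ∙ V i ≈ - ι (g • P i)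
    value i = trans (∙-neg (λ k → ι (g k)) (V i)) (-‿cong (ι-∙-V g i))

  eval-•-vertex : ∀ (g : Vector Poly 4) i → eval (g •ₚ vertex i) r ≡ at g • P i
  eval-•-vertex g i = eval-• g (vertex i) r

  does-true : ∀ {Q : Set} (Q? : Dec Q) → does Q? ≡ true → Q
  does-true (yes q) _ = q

  does-false : ∀ {Q : Set} (Q? : Dec Q) → does Q? ≡ false → ¬ Q
  does-false (no ¬q) _ = ¬q

  facetS : ∀ f → Supporting (onFacet f)
  facetS f = minimal⇒supporting (at (facet f)) (eval (offset f) r)
    (λ i eq → ≡.trans (≡.sym (eval-•-vertex (facet f) i)) (eval-≃ r (on′ i eq)))
    (λ i eq → ≡.subst (eval (offset f) r ℕ.<_) (eval-•-vertex (facet f) i) (off′ i eq))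
    where
    on′ : ∀ i → onFacet f i ≡ true → OnFacet f i
    on′ i eq = does-true (onFacet? f i) eq
    off′ : ∀ i → onFacet f i ≡ false → eval (offset f) r ℕ.< eval (facet f •ₚ vertex i) r
    off′ i eq with offset-minimal f i
    ... | inj₁ p  = contradiction p (does-false (onFacet? f i) eq)
    ... | inj₂ lt = eval-≺ {offset f} {facet f •ₚ vertex i} r lt

  weights-< : ∀ i j → ¬ i ≡ j → at (weights i) • P i ℕ.< at (weights i) • P j
  weights-< i j i≢j with weights-minimal i j
  ... | inj₁ i≡j = contradiction i≡j i≢j
  ... | inj₂ lt = ≡.subst₂ ℕ._<_ (eval-•-vertex (weights i) i) (eval-•-vertex (weights i) j)
                    (eval-≺ {weights i •ₚ vertex i} {weights i •ₚ vertex j} r lt)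

  vertexS : ∀ i → Supporting (λ j → does (i Fin.≟ j))
  vertexS i = minimal⇒supporting (at (weights i)) (at (weights i) • P i) on′ off′
    where
    on′ : ∀ j → does (i Fin.≟ j) ≡ true → at (weights i) • P j ≡ at (weights i) • P i
    on′ j eq = ≡.cong (λ i′ → at (weights i) • P i′) (≡.sym (does-true (i Fin.≟ j) eq))
    off′ : ∀ j → does (i Fin.≟ j) ≡ false → at (weights i) • P i ℕ.< at (weights i) • P j
    off′ j eq = weights-< i j (does-false (i Fin.≟ j) eq)

  V-injective : ∀ i j → V i ≋ V j → i ≡ j
  V-injective i j eq with i Fin.≟ j
  ... | yes i≡j = i≡j
  ... | no i≢j  = contradiction (ι-injective (trans (sym (ι-∙-V (at (weights i)) i))
      (trans (∙-cong (λ k → ι (at (weights i) k)) eq) (ι-∙-V (at (weights i)) j)))) (ℕ.<⇒≢ (weights-< i j i≢j))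

  infixl 6 _∩S_

  -- The sum of two valid inequalities is tight exactly where both are.
  _∩S_ : ∀ {z z′} → Supporting z → Supporting z′ → Supporting (λ i → z i ∧ z′ i)
  _∩S_ {z} {z′} S S′ = record
    { normal = λ k → normal S k + normal S′ k
    ; bound  = bound S + bound S′
    ; on     = on′
    ; off    = off′ }
    where
    value : ∀ i → (λ k → normal S k + normal S′ k) ∙ V i ≈ normal S ∙ V i + normal S′ ∙ V i
    value i = ∙-+ (normal S) (normal S′) (V i)
    on′ : ∀ i → z i ∧ z′ i ≡ true → (λ k → normal S k + normal S′ k) ∙ V i ≈ bound S + bound S′
    on′ i eq with z i in zi | z′ i in z′i
    ... | true | true = trans (value i) (+-cong (on S i zi) (on S′ i z′i))
    strict : ∀ i → normal S ∙ V i < bound S ⊎ normal S′ ∙ V i < bound S′ → (λ k → normal S k + normal S′ k) ∙ V i < bound S + bound S′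
    strict i (inj₁ lt) = <-by-difference (+-pos-nonneg (0<y-x lt) (0≤y-x (below S′ i)))
      (trans (+-congˡ (-‿cong (value i))) (solve 4 (λ a b p q → (a :+ b) :- (p :+ q) := (a :- p) :+ (b :- q)) refl (bound S) (bound S′) _ _))
    strict i (inj₂ lt) = <-by-difference (+-pos-nonneg (0<y-x lt) (0≤y-x (below S i)))
      (trans (+-congˡ (-‿cong (value i))) (solve 4 (λ a b p q → (a :+ b) :- (p :+ q) := (b :- q) :+ (a :- p)) refl (bound S) (bound S′) _ _))
    off′ : ∀ i → z i ∧ z′ i ≡ false → (λ k → normal S k + normal S′ k) ∙ V i < bound S + bound S′
    off′ i eq with z i in zi | z′ i in z′i
    ... | false | _     = strict i (inj₁ (off S i zi))
    ... | true  | false = strict i (inj₂ (off S′ i z′i))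

  ∩S-⊆ˡ : ∀ {z z′} (S : Supporting z) (S′ : Supporting z′) → face (S ∩S S′) ⊆ face S
  ∩S-⊆ˡ S S′ {v} (v∈K , eq) = v∈K , antisym (below-K S v v∈K)
    (≤-by-difference (0≤y-x (below-K S′ v v∈K)) (begin
      normal S ∙ v - bound S
        ≈⟨ solve 4 (λ p q a b → p :- a := ((p :+ q) :- (a :+ b)) :+ (b :- q)) refl (normal S ∙ v) (normal S′ ∙ v) (bound S) (bound S′) ⟩
      ((normal S ∙ v + normal S′ ∙ v) - (bound S + bound S′)) + (bound S′ - normal S′ ∙ v)
        ≈⟨ +-congʳ (trans (+-congʳ (trans (sym (∙-+ (normal S) (normal S′) v)) eq)) (-‿inverseʳ _)) ⟩
      0# + (bound S′ - normal S′ ∙ v)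
        ≈⟨ +-identityˡ _ ⟩
      bound S′ - normal S′ ∙ v ∎))
    where open Relation.Binary.Reasoning.Setoid setoid

  edgeS : ∀ e → Supporting (onEdge e)
  edgeS e = facetS (proj₁ (edge e)) ∩S facetS (proj₂ (edge e))

  containsIndependent-⊆ : ∀ {k} {Φ Φ′ : Pred (ℝ^ 4) 0ℓ} → Φ ⊆ Φ′ → ContainsIndependent k Φ → ContainsIndependent k Φ′
  containsIndependent-⊆ Φ⊆Φ′ (u , inΦ , independent) = u , (λ i → Φ⊆Φ′ (inΦ i)) , independent

  ∧-true : ∀ p q → p ∧ q ≡ true → p ≡ true × q ≡ true
  ∧-true true true _ = ≡.refl , ≡.refl

  module EdgeFlag (e : Fin 12) where

    open Flag (flags e)
    f₁ = proj₁ (edge e)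
    f₂ = proj₂ (edge e)
    S₁ = facetS f₁
    S₂ = facetS f₂

    v₀-on₁ : onFacet f₁ v₀ ≡ true
    v₀-on₁ = proj₁ (∧-true (onFacet f₁ v₀) (onFacet f₂ v₀) v₀-on)
    v₀-on₂ : onFacet f₂ v₀ ≡ true
    v₀-on₂ = proj₂ (∧-true (onFacet f₁ v₀) (onFacet f₂ v₀) v₀-on)
    v₁-on₁ : onFacet f₁ v₁ ≡ true
    v₁-on₁ = proj₁ (∧-true (onFacet f₁ v₁) (onFacet f₂ v₁) v₁-on)
    v₁-on₂ : onFacet f₂ v₁ ≡ true
    v₁-on₂ = proj₂ (∧-true (onFacet f₁ v₁) (onFacet f₂ v₁) v₁-on)

    u₁ : Fin 1 → ℝ^ 4
    u₁ = V v₀ Vector.∷ Vector.[]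
    u₂ : Fin 2 → ℝ^ 4
    u₂ = V v₁ Vector.∷ u₁
    u₃ : Fin 3 → ℝ^ 4
    u₃ = V v₂ Vector.∷ u₂
    u₄ : Fin 4 → ℝ^ 4
    u₄ = V v₃ Vector.∷ u₃

    independent₁ : AffinelyIndependent u₁
    -- Starting from no points, any functional that misses its level will do; the zero functional
    -- misses level 1.
    independent₁ = extend-independent (λ _ → 0#) {1#} {Vector.[]} {V v₀} (λ ()) (λ eq → 0≉1 (trans (sym (sum-zero (λ k → zeroˡ (V v₀ k)))) eq)) λ _ _ _ ()

    independent₂ : AffinelyIndependent u₂
    independent₂ = extend-independent (normal (vertexS v₀)) {u = u₁} {V v₁} (λ { zero → on (vertexS v₀) v₀ (dec-true (v₀ Fin.≟ v₀) ≡.refl) })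
        (proj₂ (off (vertexS v₀) v₁ (dec-false (v₀ Fin.≟ v₁) v₀≢v₁))) independent₁

    independent₃ : AffinelyIndependent u₃
    independent₃ = extend-independent (normal S₂) {u = u₂} {V v₂}
      (λ { zero → on S₂ v₁ v₁-on₂ ; (suc zero) → on S₂ v₀ v₀-on₂ })
      (proj₂ (off S₂ v₂ v₂-off₂)) independent₂

    independent₄ : AffinelyIndependent u₄
    independent₄ = extend-independent (normal S₁) {u = u₃} {V v₃}
      (λ { zero → on S₁ v₂ v₂-on₁ ; (suc zero) → on S₁ v₁ v₁-on₁ ; (suc (suc zero)) → on S₁ v₀ v₀-on₁ })
      (proj₂ (off S₁ v₃ v₃-off₁)) independent₃

    edge-contains₂ : ContainsIndependent 2 (face (edgeS e))
    edge-contains₂ = u₂ , (λ { zero → face-V (edgeS e) v₁ v₁-on ; (suc zero) → face-V (edgeS e) v₀ v₀-on }) , independent₂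

    facet-contains₃ : ContainsIndependent 3 (face S₁)
    facet-contains₃ = u₃ , (λ { zero → face-V S₁ v₂ v₂-on₁ ; (suc zero) → face-V S₁ v₁ v₁-on₁ ; (suc (suc zero)) → face-V S₁ v₀ v₀-on₁ }) , independent₃

    whole-contains₄ : (Φ : Pred (ℝ^ 4) 0ℓ) → (∀ i → Φ (V i)) → ContainsIndependent 4 Φ
    whole-contains₄ Φ V∈Φ = u₄ , (λ { zero → V∈Φ v₃ ; (suc zero) → V∈Φ v₂ ; (suc (suc zero)) → V∈Φ v₁ ; (suc (suc (suc zero))) → V∈Φ v₀ }) , independent₄

    whole-contains₃ : (Φ : Pred (ℝ^ 4) 0ℓ) → (∀ i → Φ (V i)) → ContainsIndependent 3 Φ
    whole-contains₃ Φ V∈Φ = u₃ , (λ { zero → V∈Φ v₂ ; (suc zero) → V∈Φ v₁ ; (suc (suc zero)) → V∈Φ v₀ }) , independent₃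

  K-size : ∀ v → K v → sum v ≈ ι n
  K-size v v∈K = trans (sum-cong-≋ λ k → sym (*-identityˡ (v k))) (trans (∙-hull h (λ _ → 1#))
    (trans (∙-const coeff V-size) (trans (*-congʳ coeff-sum) (*-identityˡ (ι n)))))
    where
    h = K⇒hull v∈K
    open Hull h
    V-size : ∀ i → (λ _ → 1#) ∙ V i ≈ ι n
    V-size i = trans (sum-cong-≋ λ k → trans (*-identityˡ (V i k)) (trans (point≈ι (seq i) k) (reflexive (≡.cong ι (seq-counts i k)))))
      (trans (sym (ι-sum (P i))) (reflexive (≡.cong ι (≡.trans (≡.sym (eval-sum (vertex i) r))
        (≡.trans (eval-≃ r (vertex-size i)) (≡.sym size-eq))))))

  ¬K-contains₅ : ¬ ContainsIndependent 5 K
  ¬K-contains₅ = ¬independent₅ K-size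

  -- Upper bounds on dimension descend along this: too many independent points in a face, together
  -- with a vertex off it, would give too many in the larger set, and `K` has no five.
  extend-contained : ∀ {k z} (S : Supporting z) {Φ : Pred (ℝ^ 4) 0ℓ} → face S ⊆ Φ → ∀ {i} → Φ (V i) → z i ≡ false →
                     ContainsIndependent k (face S) → ContainsIndependent (suc k) Φ
  extend-contained S S⊆Φ {i} V∈Φ zi (u , inS , independent) =
    V i Vector.∷ u , (λ { zero → V∈Φ ; (suc j) → S⊆Φ (inS j) }) ,
    extend-independent (normal S) {u = u} {V i} (λ j → proj₂ (inS j)) (proj₂ (off S i zi)) independent

  ¬facet-contains₄ : ∀ e → ¬ ContainsIndependent 4 (face (facetS (proj₁ (edge e))))
  ¬facet-contains₄ e contained = ¬K-contains₅ (extend-contained S₁ proj₁ (V∈K v₃) v₃-off₁ contained)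
    where
    open EdgeFlag e
    open Flag (flags e)

  ¬edge-contains₃ : ∀ e → ¬ ContainsIndependent 3 (face (edgeS e))
  ¬edge-contains₃ e contained = ¬facet-contains₄ e (extend-contained (edgeS e) (∩S-⊆ˡ S₁ S₂) (face-V S₁ v₂ v₂-on₁) off-edge contained)
    where
    open EdgeFlag e
    open Flag (flags e)
    off-edge : onEdge e v₂ ≡ false
    off-edge = ≡.trans (≡.cong (onFacet f₁ v₂ ∧_) v₂-off₂) (Bool.∧-zeroʳ (onFacet f₁ v₂))

  module Classification (c : ℝ^ 4) (b : Carrier) (c≤b : ∀ v → K v → c ∙ v ≤ b) where

    z : Fin 7 → Bool
    z i = does (em {c ∙ V i ≈ b})

    S : Supporting z
    S = record
      { normal = c
      ; bound  = b
      ; on     = λ i → does-true em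
      ; off    = λ i zi → c≤b (V i) (V∈K i) , does-false em zi }

    slack : ℝ^ 7
    slack i = b - c ∙ V i

    slack≈0⇒z : ∀ i → slack i ≈ 0# → z i ≡ true
    slack≈0⇒z i eq with em {c ∙ V i ≈ b}
    ... | yes _ = ≡.refl
    ... | no neq = contradiction (sym (trans (solve 2 (λ b p → b := (b :- p) :+ p) refl b (c ∙ V i)) (trans (+-congʳ eq) (+-identityˡ _)))) neq

    z⇒slack≈0 : ∀ i → z i ≡ true → slack i ≈ 0#
    z⇒slack≈0 i zi = trans (+-congˡ (-‿cong (on S i zi))) (-‿inverseʳ b)

    lift : Vector Poly 7 → ℝ^ 7
    lift α i = ι (at α i)

    slack-expand : ∀ α → lift α ∙ slack ≈ ι (eval (sumₚ α) r) * b - c ∙ (λ k → ι (eval (α •ₚ λ i → vertex i k) r))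
    slack-expand α = begin
      sum (λ i → lift α i * (b - c ∙ V i))
        ≈⟨ sum-cong-≋ (λ i → solve 3 (λ a b p → a :* (b :- p) := a :* b :+ (:- a) :* p) refl (lift α i) b (c ∙ V i)) ⟩
      sum (λ i → lift α i * b + (- lift α i) * (c ∙ V i))
        ≈⟨ ∑-distrib-+ {7} (λ i → lift α i * b) (λ i → - lift α i * (c ∙ V i)) ⟩
      lift α ∙ (λ _ → b) + (λ i → - lift α i) ∙ (λ i → c ∙ V i)
        ≈⟨ +-cong (∙-const (lift α) (λ _ → refl)) (∙-neg (lift α) (λ i → c ∙ V i)) ⟩
      sum (lift α) * b - lift α ∙ (λ i → c ∙ V i)
        ≈⟨ +-cong (*-congʳ (trans (sym (ι-sum (at α))) (reflexive (≡.cong ι (≡.sym (eval-sum α r))))))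
             (-‿cong (trans (sym (∙-combination c (lift α) V)) (∙-cong c coordinates≈))) ⟩
      ι (eval (sumₚ α) r) * b - c ∙ (λ k → ι (eval (α •ₚ λ i → vertex i k) r)) ∎
      where
      open Relation.Binary.Reasoning.Setoid setoid
      coordinates≈ : combination (lift α) V ≋ (λ k → ι (eval (α •ₚ λ i → vertex i k) r))
      coordinates≈ k = trans (sum-cong-≋ λ i → trans (*-congˡ (trans (point≈ι (seq i) k) (reflexive (≡.cong ι (seq-counts i k)))))
          (sym (ι-* (at α i) (P i k))))
        (trans (sym (ι-sum (λ i → at α i ℕ.* P i k))) (reflexive (≡.cong ι (≡.sym (eval-• α (λ i → vertex i k) r)))))

    -- An affine dependency makes the α-weighted and the β-weighted sums of the slacks equal. If all
    -- vertices used by α are tight, both sums are 0; slacks are nonnegative, so every vertex that β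
    -- uses with a positive coefficient is tight too.
    transfer : ∀ {α β} → sumₚ α ≃ sumₚ β → (∀ k → (α •ₚ λ i → vertex i k) ≃ (β •ₚ λ i → vertex i k)) →
               (∀ i → inSupport β i ≡ true → [] ≺ β i) → SupportWithin α z → SupportWithin β z
    transfer {α} {β} balanced dependent positive within i inβ = slack≈0⇒z i
        (*-cancelˡ-≈0 (pos⇒≉0 (ι-pos (eval-≺ {[]} {β i} r (positive i inβ))))
          (sum-nonneg-zero (λ j → *-nonneg (ι-nonneg (at β j)) (0≤y-x (below S j))) β∙slack≈0 i))
      where
      term : ∀ i → lift α i * slack i ≈ 0#
      term i with inSupport α i in eq
      ... | true  = trans (*-congˡ (z⇒slack≈0 i (within i eq))) (zeroʳ _)
      ... | false = trans (*-congʳ (reflexive (≡.cong ι (ℕ.n≤0⇒n≡0 (eval-mono r (outside-support (α i ≼? []) eq)))))) (zeroˡ _)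
        where
        outside-support : ∀ {Q : Set} (Q? : Dec Q) → Bool.not (does Q?) ≡ false → Q
        outside-support (yes q) _ = q
      β∙slack≈0 : lift β ∙ slack ≈ 0#
      β∙slack≈0 = trans (slack-expand β) (trans
        (+-cong (*-congʳ (reflexive (≡.cong ι (≡.sym (eval-≃ r balanced)))))
          (-‿cong (∙-cong c λ k → reflexive (≡.cong ι (≡.sym (eval-≃ r (dependent k)))))))
        (trans (sym (slack-expand α)) (sum-zero term)))

    ≃-sym : ∀ {p q} → p ≃ q → q ≃ p
    ≃-sym (p≼q , q≼p) = q≼p , p≼q

    closed : Closed z
    closed = All.map (λ {αβ} v → let open CircuitValid v in
        transfer {proj₁ αβ} {proj₂ αβ} balanced dependent positiveʳ ,
        transfer {proj₂ αβ} {proj₁ αβ} (≃-sym balanced) (λ k → ≃-sym (dependent k)) positiveˡ)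
      circuits-valid

    z≗ : ∀ i → lookup (tabulate z) i ≡ z i
    z≗ = Vec.lookup∘tabulate z

    supportWithin-resp : ∀ α {z z′ : Fin 7 → Bool} → (∀ i → z i ≡ z′ i) → SupportWithin α z → SupportWithin α z′
    supportWithin-resp α same h i eq = ≡.trans (≡.sym (same i)) (h i eq)

    facePattern : FacePattern z
    facePattern = transport (classification (tabulate z) (All.map (λ {αβ} (to , from) →
        (λ h → supportWithin-resp (proj₂ αβ) back (to (supportWithin-resp (proj₁ αβ) z≗ h))) ,
        (λ h → supportWithin-resp (proj₁ αβ) back (from (supportWithin-resp (proj₂ αβ) z≗ h)))) closed))
      where
      back : ∀ i → z i ≡ lookup (tabulate z) i
      back i = ≡.sym (z≗ i)
      transport : FacePattern (lookup (tabulate z)) → FacePattern z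
      transport (isEmpty h)    = isEmpty λ i → ≡.trans (back i) (h i)
      transport (isVertex j h) = isVertex j λ i → ≡.trans (back i) (h i)
      transport (isEdge e h)   = isEdge e λ i → ≡.trans (back i) (h i)
      transport (isFacet f h)  = isFacet f λ i → ≡.trans (back i) (h i)
      transport (isWhole h)    = isWhole λ i → ≡.trans (back i) (h i)

    empty-face : (∀ i → z i ≡ false) → ∀ {v} → ¬ face S v
    empty-face none {v} v∈face = proj₂ nonzero (support S v∈face h (proj₁ nonzero) (none (proj₁ nonzero)))
      where
      h = K⇒hull (proj₁ v∈face)
      nonzero = hull-nonzero h

    vertex-face : ∀ j → (∀ i → z i ≡ does (j Fin.≟ i)) → ∀ {v} → face S v → v ≋ V j
    vertex-face j h v∈face = hull-single hull j λ i j≢i → support S v∈face hull i (≡.trans (h i) (dec-false (j Fin.≟ i) j≢i))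
      where
      hull = K⇒hull (proj₁ v∈face)

  ¬coincident-independent : ∀ {k} w (Φ : Pred (ℝ^ 4) 0ℓ) → (∀ v → Φ v → v ≋ w) → ¬ ContainsIndependent (suc (suc k)) Φ
  ¬coincident-independent {k} w Φ coincide (u , inΦ , independent) = 0≉1 (sym (independent a sum≈0 comb≈0 zero))
    where
    a : ℝ^ (suc (suc k))
    a zero          = 1#
    a (suc zero)    = - 1#
    a (suc (suc _)) = 0#
    sum≈0 : sum a ≈ 0#
    sum≈0 = trans (+-congˡ (+-congˡ (sum-zero {k} λ _ → refl))) (solve 0 (con (+ 1) :+ (:- con (+ 1) :+ con (+ 0)) := con (+ 0)) refl)
    comb≈0 : combination a u ≋ (λ _ → 0#)
    comb≈0 j = trans (∙-const a {λ i → u i j} λ i → coincide (u i) (inΦ i) j) (trans (*-congʳ sum≈0) (zeroˡ _))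

  anyEdge : Fin 12
  anyEdge = zero

  edge-dimension : ∀ e → HasDimension (face (edgeS e)) 1
  edge-dimension e = EdgeFlag.edge-contains₂ e , ¬edge-contains₃ e

  facet-contains₃ : ∀ f → ContainsIndependent 3 (face (facetS f))
  facet-contains₃ f = ≡.subst (λ f → ContainsIndependent 3 (face (facetS f))) (proj₂ (facet-edge f))
    (EdgeFlag.facet-contains₃ (proj₁ (facet-edge f)))

  facet-dimension : ∀ f → HasDimension (face (facetS f)) 2
  facet-dimension f = facet-contains₃ f , λ contained → ¬facet-contains₄ (proj₁ (facet-edge f))
    (≡.subst (λ f → ContainsIndependent 4 (face (facetS f))) (≡.sym (proj₂ (facet-edge f))) contained)

  K-dimension : HasDimension K 3
  K-dimension = EdgeFlag.whole-contains₄ anyEdge K V∈K , ¬K-contains₅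

  edges : Enumerates _≐_ (FaceOfDimension 1 K) (λ e → face (edgeS e))
  edges = record
    { sound    = λ e → isFace (edgeS e) , edge-dimension e
    ; distinct = λ e e′ eq → edges-distinct e e′ (face-≐⇒pattern (edgeS e) (edgeS e′) eq)
    ; complete = complete }
    where
    complete : ∀ Φ → FaceOfDimension 1 K Φ → ∃ λ e → Φ ≐ face (edgeS e)
    complete Φ ((c , b , c≤b , Φ⊆ , ⊆Φ) , (two , ¬three)) = by-pattern facePattern
      where
      open Classification c b c≤b
      by-pattern : FacePattern z → ∃ λ e → Φ ≐ face (edgeS e)
      by-pattern (isEmpty h)    = contradiction (Φ⊆ (proj₁ (proj₂ two) zero)) (empty-face h)
      by-pattern (isVertex j h) = contradiction two (¬coincident-independent (V j) Φ λ v v∈Φ → vertex-face j h {v} (Φ⊆ v∈Φ))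
      by-pattern (isEdge e h)   = e , (λ v∈Φ → proj₁ (face-≐ S (edgeS e) h) (Φ⊆ v∈Φ)) , λ v∈e → ⊆Φ (proj₂ (face-≐ S (edgeS e) h) v∈e)
      by-pattern (isFacet f h)  = contradiction
        (containsIndependent-⊆ (λ {v} v∈f → ⊆Φ {v} (proj₂ (face-≐ S (facetS f) h) {v} v∈f)) (facet-contains₃ f)) ¬three
      by-pattern (isWhole h)    = contradiction (EdgeFlag.whole-contains₃ anyEdge Φ λ i → ⊆Φ (face-V S i (h i))) ¬three

  facets : Enumerates _≐_ (FaceOfDimension 2 K) (λ f → face (facetS f))
  facets = record
    { sound    = λ f → isFace (facetS f) , facet-dimension f
    ; distinct = λ f f′ eq → facets-distinct f f′ (face-≐⇒pattern (facetS f) (facetS f′) eq)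
    ; complete = complete }
    where
    complete : ∀ Φ → FaceOfDimension 2 K Φ → ∃ λ f → Φ ≐ face (facetS f)
    complete Φ ((c , b , c≤b , Φ⊆ , ⊆Φ) , (three , ¬four)) = by-pattern facePattern
      where
      open Classification c b c≤b
      by-pattern : FacePattern z → ∃ λ f → Φ ≐ face (facetS f)
      by-pattern (isEmpty h)    = contradiction (Φ⊆ (proj₁ (proj₂ three) zero)) (empty-face h)
      by-pattern (isVertex j h) = contradiction three (¬coincident-independent (V j) Φ λ v v∈Φ → vertex-face j h {v} (Φ⊆ v∈Φ))
      by-pattern (isEdge e h)   = contradiction
        (containsIndependent-⊆ (λ {v} v∈Φ → proj₁ (face-≐ S (edgeS e) h) {v} (Φ⊆ {v} v∈Φ)) three) (¬edge-contains₃ e)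
      by-pattern (isFacet f h)  = f , (λ v∈Φ → proj₁ (face-≐ S (facetS f) h) (Φ⊆ v∈Φ)) , λ v∈f → ⊆Φ (proj₂ (face-≐ S (facetS f) h) v∈f)
      by-pattern (isWhole h)    = contradiction (EdgeFlag.whole-contains₄ anyEdge Φ λ i → ⊆Φ (face-V S i (h i))) ¬four

  K-resp : ∀ u v → u ≋ v → K v → K u
  K-resp u v u≋v v∈K = hull⇒K (hull-resp {u} {v} u≋v (K⇒hull v∈K))

  vertices : Enumerates _≋_ (IsVertex K) V
  vertices = record { sound = sound ; distinct = V-injective ; complete = complete }
    where
    sound : ∀ i → IsVertex K (V i)
    sound i = normal W , bound W , below-K W ,
        (λ {v} eq → K-resp v (V i) eq (V∈K i) , trans (∙-cong (normal W) eq) (on W i (dec-true (i Fin.≟ i) ≡.refl))) ,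
        λ v∈face → let h = K⇒hull (proj₁ v∈face) in
          hull-single h i λ j i≢j → support W v∈face h j (dec-false (i Fin.≟ j) i≢j)
      where W = vertexS i
    complete : ∀ v → IsVertex K v → ∃ λ i → v ≋ V i
    -- The classification of patterns is not called for here: a vertex with nonzero coefficient in v
    -- lies on the face, and the face is the single point v.
    complete v (c , b , c≤b , v⊆ , ⊆v) = i , λ k → sym (⊆v (face-V S i z-i) k)
      where
      open Classification c b c≤b
      v∈face = v⊆ (λ _ → refl)
      h = K⇒hull (proj₁ v∈face)
      i = proj₁ (hull-nonzero h)
      z-i : z i ≡ true
      z-i = support-on S v∈face h i (proj₂ (hull-nonzero h))

  isPolytope : IsPolytope K
  isPolytope = 7 , V ,
    (λ v∈K → let open Hull (K⇒hull v∈K) in 7 , coeff , V , (λ i → i , λ _ → refl) , coeff-nonneg , coeff-sum , v≋) ,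
    λ (k , c , u , inV , 0≤c , sum≈1 , v≋) → hull⇒K (hull-resp v≋ (combination-hull c u 0≤c sum≈1
      λ i → hull-resp {u i} (proj₂ (inV i)) (K⇒hull (V∈K (proj₁ (inV i))))))

  polytopeStructure : PolytopeStructure n seq
  polytopeStructure = isPolytope , K-dimension , vertices , (_ , edges) , (_ , facets)

-- Min-weight sequences.

module MinWeight (em : ExcludedMiddle 0ℓ) (ℝ : CompleteOrderedField) {n : ℕ} {seq : Fin 7 → List State} (model : Model n seq) where

  open CompleteOrderedField ℝ hiding (zero)
  open Over ℝ
  open OrderedField em ℝ
  open RingSolver ℝ
  open LinearAlgebra em ℝ
  open Embedding em ℝ
  open PositiveBoxes em ℝ using (box-positive)
  open NullSets em ℝ using (hyperplane⇒¬positive)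
  open Model model
  open Polytope em ℝ model

  ∙-comm : ∀ {k} (u v : ℝ^ k) → u ∙ v ≈ v ∙ u
  ∙-comm u v = sum-cong-≋ λ i → *-comm (u i) (v i)

  -- For integral weights the minimum is smaller than all other weights by at
  -- least 1, so it survives a perturbation by η.
  module AroundVertex (i : Fin 7) where

    g : Fin 4 → ℕ
    g = at (weights i)

    w₀ : Weighting
    w₀ k = ι (g k)

    gap : ∀ s → PathFrom0 n s → ¬ SameCounts s (seq i) → 1# + w₀ ∙ V i ≤ w₀ ∙ point s
    gap s path different = ≤-respˡ-≈ (trans (ι-+ 1 (g • P i)) (+-cong (+-identityʳ 1#) (sym (ι-∙-V g i))))
        (≤-respʳ-≈ (sym (ι-∙-point g s)) (ι-mono-≤ (ι-cancel-< {g • P i} {g • counts s} strict)))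
      where
      h = path⇒hull s path
      ι-mono-≤ : ∀ {j k} → j ℕ.≤ k → ι j ≤ ι k
      ι-mono-≤ {j} {k} j≤k with ℕ.m≤n⇒m<n∨m≡n j≤k
      ... | inj₁ j<k    = proj₁ (ι-mono-< j<k)
      ... | inj₂ ≡.refl = ≤-refl
      open Polytope.Supporting (vertexS i)
      same-point : - ι (g • counts s) ≈ - ι (g • P i) → point s ≋ V i
      same-point eq = hull-single h i λ j i≢j → support
        (hull⇒K h , trans (∙-neg w₀ (point s)) (trans (-‿cong (ι-∙-point g s)) eq)) h j (dec-false (i Fin.≟ j) i≢j)
      strict : ι (g • P i) < ι (g • counts s)
      strict =
        ≤-by-difference (0≤y-x (≤-respˡ-≈ (trans (∙-neg w₀ (point s)) (-‿cong (ι-∙-point g s))) (hull-bound h normal below)))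
          (solve 2 (λ p q → q :- p := :- p :- :- q) refl (ι (g • P i)) (ι (g • counts s))) ,
        λ eq → different (≋⇒sameCounts {s} {seq i} (same-point (-‿cong (sym eq))))

    -- η = 1/(1 + 2n): every path weight changes by at most ηn, so a gap of 1 shrinks by at most 2ηn
    -- = 1 - η and at least η remains.
    inv = inverse-pos (+-pos-nonneg 0<1 (+-nonneg (ι-nonneg n) (ι-nonneg n)))
    η = proj₁ inv

    0<η : 0# < η
    0<η = proj₁ (proj₂ inv)

    Near : Weighting → Set
    Near w = ∀ k → w₀ k - η ≤ w k × w k ≤ w₀ k + η

    point-nonneg : ∀ s k → 0# ≤ point s k
    point-nonneg s k = ≤-respʳ-≈ (sym (point≈ι s k)) (ι-nonneg (counts s k))

    path-size : ∀ s → PathFrom0 n s → sum (point s) ≈ ι n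
    path-size s path = K-size (point s) (hull⇒K (path⇒hull s path))

    module _ (w : Weighting) (near : Near w) where

      lower-bound : ∀ s → PathFrom0 n s → w₀ ∙ point s - η * ι n ≤ w ∙ point s
      lower-bound s path = ≤-respˡ-≈
        (trans (sum-cong-≋ λ k → *-congʳ {point s k} (+-congˡ {w₀ k} (-‿cong (sym (*-identityʳ η)))))
          (trans (∙-- w₀ (λ _ → 1#) (point s) η) (+-congˡ (-‿cong (*-congˡ (trans (sum-cong-≋ λ k → *-identityˡ (point s k)) (path-size s path)))))))
        (sum-mono-≤ λ k → *-monoʳ-≤ (point-nonneg s k) (proj₁ (near k)))

      upper-bound : ∀ s → PathFrom0 n s → w ∙ point s ≤ w₀ ∙ point s + η * ι n
      upper-bound s path = ≤-respʳ-≈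
        (trans (∙-+ w₀ (λ _ → η) (point s)) (+-congˡ (trans (sym (*-distribˡ-sum η (point s))) (*-congˡ (path-size s path)))))
        (sum-mono-≤ λ k → *-monoʳ-≤ (point-nonneg s k) (proj₂ (near k)))

      cheaper : ∀ s → PathFrom0 n s → ¬ SameCounts s (seq i) → weight w (seq i) < weight w s
      cheaper s path different = <-resp-≈ (sym (weight≈∙ w (seq i))) (sym (weight≈∙ w s)) (<-by-difference (+-pos-nonneg 0<η
          (+-nonneg (+-nonneg (0≤y-x (lower-bound s path)) (0≤y-x (upper-bound (seq i) (seq-path i)))) (0≤y-x (gap s path different))))
        (begin
          w ∙ point s - w ∙ V i
            ≈⟨ solve 6 (λ y v y₀ v₀ η n → y :- v :=
                 (con (+ 1) :- η :* (con (+ 1) :+ (n :+ n))) :+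
                 (η :+ (((y :- (y₀ :- η :* n)) :+ ((v₀ :+ η :* n) :- v)) :+ (y₀ :- (con (+ 1) :+ v₀)))))
               refl (w ∙ point s) (w ∙ V i) (w₀ ∙ point s) (w₀ ∙ V i) η (ι n) ⟩
          (1# - η * (1# + (ι n + ι n))) + rest
            ≈⟨ +-congʳ (trans (+-congˡ (-‿cong (trans (*-comm η _) (proj₂ (proj₂ inv))))) (-‿inverseʳ 1#)) ⟩
          0# + rest
            ≈⟨ +-identityˡ rest ⟩
          rest ∎))
        where
        open Relation.Binary.Reasoning.Setoid setoid
        rest = η + (((w ∙ point s - (w₀ ∙ point s - η * ι n)) + ((w₀ ∙ V i + η * ι n) - w ∙ V i)) + (w₀ ∙ point s - (1# + w₀ ∙ V i)))

      same-weight : ∀ s → SameCounts s (seq i) → weight w s ≈ weight w (seq i)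
      same-weight s same = trans (weight≈∙ w s) (trans (∙-cong w (sameCounts⇒≋ {s} {seq i} same)) (sym (weight≈∙ w (seq i))))

      minimal⇒same : ∀ s → MinWeightPath n w s → SameCounts s (seq i)
      minimal⇒same s (path , minimal) = by-contradiction λ different →
        <⇒≱ (cheaper s path different) (minimal (seq i) (seq-path i))

      same⇒minimal : ∀ s → PathFrom0 n s → SameCounts s (seq i) → MinWeightPath n w s
      same⇒minimal s path same = path , λ t path-t → ≤-respˡ-≈ (sym (same-weight s same)) (least t path-t)
        where
        least : ∀ t → PathFrom0 n t → weight w (seq i) ≤ weight w t
        least t path-t = by-contradiction λ ≰ → ≰ (proj₁ (cheaper t path-t λ same-t → ≰ (≤-reflexive (sym (same-weight t same-t)))))

    near-w₀ : Near w₀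
    near-w₀ k = ≤-by-difference (proj₁ 0<η) (solve 2 (λ y h → y :- (y :- h) := h) refl (w₀ k) η) ,
                ≤-by-difference (proj₁ 0<η) (solve 2 (λ y h → (y :+ h) :- y := h) refl (w₀ k) η)

    minWeightSequence : MinWeightSequence n (seq i)
    minWeightSequence = w₀ ,
      box-positive (λ k → w₀ k - η) (λ k → w₀ k + η)
        (λ k → <-by-difference (+-pos-nonneg 0<η (proj₁ 0<η)) (solve 2 (λ y h → (y :+ h) :- (y :- h) := h :+ h) refl (w₀ k) η))
        (λ w near s → mk⇔
          (λ min → same⇒minimal w near s (proj₁ min) (minimal⇒same w₀ near-w₀ s min))
          (λ min → same⇒minimal w₀ near-w₀ s (proj₁ min) (minimal⇒same w near s min))) ,
      same⇒minimal w₀ near-w₀ (seq i) (seq-path i) (λ _ → ≡.refl)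

  module Complete (s : List State) (w : Weighting) (positive : PositiveMeasure (WeightRegion n w)) (minimal : MinWeightPath n w s) where

    path = proj₁ minimal
    h = path⇒hull s path
    open Hull h

    -- Complementary slackness for the functional -w, whose maximum over the vertices is attained at
    -- the mean of those used.
    used⇒tight : ∀ i → ¬ coeff i ≈ 0# → w ∙ V i ≈ w ∙ point s
    used⇒tight i used = by-contradiction λ neq → used (hull-support h (λ k → - w k) {b = - (w ∙ point s)}
        (λ j → ≤-respˡ-≈ (sym (∙-neg w (V j))) (neg-mono-≤ (≤-respˡ-≈ (weight≈∙ w s) (≤-respʳ-≈ (weight≈∙ w (seq j)) (proj₂ minimal (seq j) (seq-path j))))))
        (∙-neg w (point s)) i
        (λ eq → neq (trans (sym (-‿involutive′ _)) (trans (-‿cong (trans (sym (∙-neg w (V i))) eq)) (-‿involutive′ _)))))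
      where
      -‿involutive′ : ∀ y → - - y ≈ y
      -‿involutive′ = solve 1 (λ y → :- :- y := y) refl

    used⇒minimal : ∀ i → ¬ coeff i ≈ 0# → MinWeightPath n w (seq i)
    used⇒minimal i used = seq-path i , λ t path-t →
      ≤-respˡ-≈ (trans (weight≈∙ w s) (trans (sym (used⇒tight i used)) (sym (weight≈∙ w (seq i))))) (proj₂ minimal t path-t)

    -- If two vertices are used, they are minimal throughout the region,
    -- which then lies in a hyperplane.
    unique : ∀ i j → ¬ coeff i ≈ 0# → ¬ coeff j ≈ 0# → i ≡ j
    unique i j used-i used-j = by-contradiction λ i≢j →
        hyperplane⇒¬positive c (proj₁ (differ i≢j)) (proj₂ (differ i≢j)) within positive
      where
      c : ℝ^ 4
      c k = V i k - 1# * V j k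
      differ : ¬ i ≡ j → ∃ λ k → ¬ c k ≈ 0#
      differ i≢j = by-contradiction λ none → i≢j (V-injective i j λ k →
        trans (solve 2 (λ p q → p := (p :- con (+ 1) :* q) :+ q) refl (V i k) (V j k))
          (trans (+-congʳ (by-contradiction λ neq → none (k , neq))) (+-identityˡ _)))
      within : ∀ v → WeightRegion n w v → c ∙ v ≈ 0#
      within v region = trans (∙-- (V i) (V j) v 1#) (trans (+-congˡ (-‿cong (trans (*-identityˡ _)
          (trans (∙-comm (V j) v) (trans (sym (weight≈∙ v (seq j))) (trans (antisym
            (proj₂ min-j (seq i) (seq-path i)) (proj₂ min-i (seq j) (seq-path j)))
            (trans (weight≈∙ v (seq i)) (∙-comm v (V i)))))))))
          (-‿inverseʳ _))
        where
        min-i = Equivalence.to (region (seq i)) (used⇒minimal i used-i)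
        min-j = Equivalence.to (region (seq j)) (used⇒minimal j used-j)

    equivalent : ∃ λ i → Equivalent s (seq i)
    equivalent = i , ≡.trans (proj₂ path) (≡.sym (proj₂ (seq-path i))) ,
      sameCounts⇒↭ s (seq i) (≋⇒sameCounts {s} {seq i} (hull-single h i others))
      where
      i = proj₁ (hull-nonzero h)
      others : ∀ j → ¬ i ≡ j → coeff j ≈ 0#
      others j i≢j = by-contradiction λ neq → i≢j (unique i j (proj₂ (hull-nonzero h)) neq)

  sevenMinWeightSequences : SevenMinWeightSequences n seq
  sevenMinWeightSequences = record
    { sound    = AroundVertex.minWeightSequence
    ; distinct = λ i j (_ , perm) → V-injective i j (sameCounts⇒≋ {seq i} {seq j} (↭⇒sameCounts (seq i) (seq j) perm))
    ; complete = λ s (w , positive , minimal) → Complete.equivalent s w positive minimal }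

-- Path probabilities as monomials in the transition probabilities.

module Monomials (em : ExcludedMiddle 0ℓ) (ℝ : CompleteOrderedField) where

  open CompleteOrderedField ℝ hiding (zero)
  open Over ℝ
  open OrderedField em ℝ
  open RingSolver ℝ

  ↑-+ : ∀ z j k → z ↑ (j ℕ.+ k) ≈ z ↑ j * z ↑ k
  ↑-+ z j k = Algebra.Properties.Monoid.Mult.×-homo-+ *-monoid z j k

  ↑≤1 : ∀ {z} k → 0# ≤ z → z ≤ 1# → z ↑ k ≤ 1#
  ↑≤1 zero    0≤z z≤1 = ≤-refl
  ↑≤1 (suc k) 0≤z z≤1 = ≤-respʳ-≈ (*-identityˡ 1#) (*-mono-≤ 0≤z z≤1 (↑-nonneg k 0≤z) (↑≤1 k 0≤z z≤1))

  -- A chain without its initial distribution, which contributes the same factor to all paths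
  -- starting in 0.
  record TransitionMatrix : Set where
    field
      p₀₀ p₀₁ p₁₀ p₁₁ : Carrier
      0≤p₀₀ : 0# ≤ p₀₀
      0≤p₀₁ : 0# ≤ p₀₁
      0≤p₁₀ : 0# ≤ p₁₀
      0≤p₁₁ : 0# ≤ p₁₁
      sum₀  : p₀₀ + p₀₁ ≈ 1#
      sum₁  : p₁₀ + p₁₁ ≈ 1#

    monomial : Vector ℕ 4 → Carrier
    monomial v = (p₀₀ ↑ v 0F * p₀₁ ↑ v 1F) * (p₁₀ ↑ v 2F * p₁₁ ↑ v 3F)

    monomial-nonneg : ∀ v → 0# ≤ monomial v
    monomial-nonneg v = *-nonneg (*-nonneg (↑-nonneg (v 0F) 0≤p₀₀) (↑-nonneg (v 1F) 0≤p₀₁))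
                                 (*-nonneg (↑-nonneg (v 2F) 0≤p₁₀) (↑-nonneg (v 3F) 0≤p₁₁))

    monomial-cong : ∀ {v w} → (∀ k → v k ≡ w k) → monomial v ≈ monomial w
    monomial-cong {v} {w} eq = *-cong (*-cong (pow p₀₀ 0F) (pow p₀₁ 1F)) (*-cong (pow p₁₀ 2F) (pow p₁₁ 3F))
      where
      pow : ∀ z k → z ↑ v k ≈ z ↑ w k
      pow z k = reflexive (≡.cong (z ↑_) (eq k))

    monomial-+ : ∀ v w → monomial (λ k → v k ℕ.+ w k) ≈ monomial v * monomial w
    monomial-+ v w = trans
      (*-cong (*-cong (↑-+ p₀₀ (v 0F) (w 0F)) (↑-+ p₀₁ (v 1F) (w 1F))) (*-cong (↑-+ p₁₀ (v 2F) (w 2F)) (↑-+ p₁₁ (v 3F) (w 3F))))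
      (solve 8 (λ a a′ b b′ c c′ d d′ → ((a :* a′) :* (b :* b′)) :* ((c :* c′) :* (d :* d′)) :=
          ((a :* b) :* (c :* d)) :* ((a′ :* b′) :* (c′ :* d′))) refl
        (p₀₀ ↑ v 0F) (p₀₀ ↑ w 0F) (p₀₁ ↑ v 1F) (p₀₁ ↑ w 1F) (p₁₀ ↑ v 2F) (p₁₀ ↑ w 2F) (p₁₁ ↑ v 3F) (p₁₁ ↑ w 3F))

    monomial-cancel : ∀ u e f v w → (∀ k → v k ≡ e k ℕ.+ u k) → (∀ k → w k ≡ f k ℕ.+ u k) →
      0# < monomial w → monomial v ≤ monomial w → monomial e ≤ monomial f
    monomial-cancel u e f v w v≡ w≡ 0<w v≤w = *-cancelˡ-≤ 0<u
        (≤-respˡ-≈ (trans (split e v v≡) (*-comm _ _)) (≤-respʳ-≈ (trans (split f w w≡) (*-comm _ _)) v≤w))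
      where
      split : ∀ e′ v′ → (∀ k → v′ k ≡ e′ k ℕ.+ u k) → monomial v′ ≈ monomial e′ * monomial u
      split e′ v′ eq = trans (monomial-cong {v′} eq) (monomial-+ e′ u)
      0<u : 0# < monomial u
      0<u = monomial-nonneg u , λ 0≈u → proj₂ 0<w (sym (trans (split f w w≡) (trans (*-congˡ (sym 0≈u)) (zeroʳ _))))

    p₀₀≤1 : p₀₀ ≤ 1#
    p₀₀≤1 = ≤-respʳ-≈ sum₀ (≤-respˡ-≈ (+-identityʳ p₀₀) (+-mono-≤ ≤-refl 0≤p₀₁))
    p₀₁≤1 : p₀₁ ≤ 1#
    p₀₁≤1 = ≤-respʳ-≈ sum₀ (≤-respˡ-≈ (+-identityˡ p₀₁) (+-mono-≤ 0≤p₀₀ ≤-refl))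
    p₁₀≤1 : p₁₀ ≤ 1#
    p₁₀≤1 = ≤-respʳ-≈ sum₁ (≤-respˡ-≈ (+-identityʳ p₁₀) (+-mono-≤ ≤-refl 0≤p₁₁))
    p₁₁≤1 : p₁₁ ≤ 1#
    p₁₁≤1 = ≤-respʳ-≈ sum₁ (≤-respˡ-≈ (+-identityˡ p₁₁) (+-mono-≤ 0≤p₁₀ ≤-refl))

    entry : Fin 4 → Carrier
    entry 0F = p₀₀
    entry 1F = p₀₁
    entry 2F = p₁₀
    entry 3F = p₁₁

    entry-nonneg : ∀ k → 0# ≤ entry k
    entry-nonneg 0F = 0≤p₀₀
    entry-nonneg 1F = 0≤p₀₁
    entry-nonneg 2F = 0≤p₁₀
    entry-nonneg 3F = 0≤p₁₁

    entry≤1 : ∀ k → entry k ≤ 1#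
    entry≤1 0F = p₀₀≤1
    entry≤1 1F = p₀₁≤1
    entry≤1 2F = p₁₀≤1
    entry≤1 3F = p₁₁≤1

    private
      *≤1 : ∀ {y z w} → 0# ≤ y → y ≤ w → 0# ≤ z → z ≤ 1# → y * z ≤ w
      *≤1 0≤y y≤w 0≤z z≤1 = ≤-respʳ-≈ (*-identityʳ _) (*-mono-≤ 0≤y y≤w 0≤z z≤1)

      power-nonneg : ∀ v k → 0# ≤ entry k ↑ v k
      power-nonneg v k = ↑-nonneg (v k) (entry-nonneg k)

      power≤1 : ∀ v k → entry k ↑ v k ≤ 1#
      power≤1 v k = ↑≤1 (v k) (entry-nonneg k) (entry≤1 k)

    monomial≤power : ∀ v k → monomial v ≤ entry k ↑ v k
    monomial≤power v k = by-position k
      where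
      0≤ = power-nonneg v
      ≤1 = power≤1 v
      pair≤1 : ∀ i j → entry i ↑ v i * entry j ↑ v j ≤ 1#
      pair≤1 i j = *≤1 (0≤ i) (≤1 i) (0≤ j) (≤1 j)
      swap : ∀ {y z w} → z * y ≤ w → y * z ≤ w
      swap le = ≤-respˡ-≈ (*-comm _ _) le
      by-position : ∀ k → monomial v ≤ entry k ↑ v k
      by-position 0F = *≤1 (*-nonneg (0≤ 0F) (0≤ 1F)) (*≤1 (0≤ 0F) ≤-refl (0≤ 1F) (≤1 1F)) (*-nonneg (0≤ 2F) (0≤ 3F)) (pair≤1 2F 3F)
      by-position 1F = *≤1 (*-nonneg (0≤ 0F) (0≤ 1F)) (swap (*≤1 (0≤ 1F) ≤-refl (0≤ 0F) (≤1 0F))) (*-nonneg (0≤ 2F) (0≤ 3F)) (pair≤1 2F 3F)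
      by-position 2F = swap (*≤1 (*-nonneg (0≤ 2F) (0≤ 3F)) (*≤1 (0≤ 2F) ≤-refl (0≤ 3F) (≤1 3F)) (*-nonneg (0≤ 0F) (0≤ 1F)) (pair≤1 0F 1F))
      by-position 3F = swap (*≤1 (*-nonneg (0≤ 2F) (0≤ 3F)) (swap (*≤1 (0≤ 3F) ≤-refl (0≤ 2F) (≤1 2F))) (*-nonneg (0≤ 0F) (0≤ 1F)) (pair≤1 0F 1F))

    monomial≤1 : ∀ v → monomial v ≤ 1#
    monomial≤1 v = ≤-trans (monomial≤power v 0F) (power≤1 v 0F)

    monomial≤entry : ∀ v k {j} → v k ≡ suc j → monomial v ≤ entry k
    monomial≤entry v k {j} eq = ≤-trans (monomial≤power v k) (≡.subst (λ l → entry k ↑ l ≤ entry k) (≡.sym eq)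
      (*≤1 (entry-nonneg k) ≤-refl (↑-nonneg j (entry-nonneg k)) (↑≤1 j (entry-nonneg k) (entry≤1 k))))

    monomial≥ : ∀ v {h} → 0# ≤ h → (∀ k → v k ≡ 0 ⊎ h ≤ entry k) →
                h ↑ ((v 0F ℕ.+ v 1F) ℕ.+ (v 2F ℕ.+ v 3F)) ≤ monomial v
    monomial≥ v {h} 0≤h good = ≤-respˡ-≈ (sym (trans (↑-+ h (v 0F ℕ.+ v 1F) (v 2F ℕ.+ v 3F))
          (*-cong (↑-+ h (v 0F) (v 1F)) (↑-+ h (v 2F) (v 3F)))))
        (*-mono-≤ (*-nonneg (0≤h↑ 0F) (0≤h↑ 1F)) (*-mono-≤ (0≤h↑ 0F) (power≥ 0F) (0≤h↑ 1F) (power≥ 1F))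
                  (*-nonneg (0≤h↑ 2F) (0≤h↑ 3F)) (*-mono-≤ (0≤h↑ 2F) (power≥ 2F) (0≤h↑ 3F) (power≥ 3F)))
      where
      0≤h↑ : ∀ k → 0# ≤ h ↑ v k
      0≤h↑ k = ↑-nonneg (v k) 0≤h
      power≥ : ∀ k → h ↑ v k ≤ entry k ↑ v k
      power≥ k = [ (λ eq → ≡.subst (λ j → h ↑ j ≤ entry k ↑ j) (≡.sym eq) ≤-refl) , (λ le → ↑-mono-≤ (v k) 0≤h le) ]′ (good k)

  matrix : MarkovChain → TransitionMatrix
  matrix M = record
    { p₀₀ = p 𝟎 𝟎 ; p₀₁ = p 𝟎 𝟏 ; p₁₀ = p 𝟏 𝟎 ; p₁₁ = p 𝟏 𝟏
    ; 0≤p₀₀ = p-nonneg 𝟎 𝟎 ; 0≤p₀₁ = p-nonneg 𝟎 𝟏 ; 0≤p₁₀ = p-nonneg 𝟏 𝟎 ; 0≤p₁₁ = p-nonneg 𝟏 𝟏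
    ; sum₀ = p-sum 𝟎 ; sum₁ = p-sum 𝟏 }
    where open MarkovChain M

  open MarkovChain using (probability)

  probability≈ : ∀ M i s → probability M (i ∷ s) ≈ MarkovChain.π M i * TransitionMatrix.monomial (matrix M) (counts (i ∷ s))
  probability≈ M i s = *-congˡ (foldr-occurrences *-commutativeMonoid _ (transitions (i ∷ s)))

  probability-path : ∀ M {n} s → PathFrom0 n s → probability M s ≈ MarkovChain.π M 𝟎 * TransitionMatrix.monomial (matrix M) (counts s)
  probability-path M (𝟎 ∷ s) (_ , ≡.refl) = probability≈ M 𝟎 s

  positive-of-sum : ∀ {y z} → 0# ≤ y → 0# ≤ z → y + z ≈ 1# → 0# < y ⊎ 0# < z
  positive-of-sum {y} {z} 0≤y 0≤z eq with em {0# ≈ y}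
  ... | no 0≉y  = inj₁ (0≤y , 0≉y)
  ... | yes 0≈y = inj₂ (0≤z , λ 0≈z → 0≉1 (trans (sym (+-identityʳ 0#)) (trans (+-cong 0≈y 0≈z) eq)))

  module _ (M : MarkovChain) where
    open MarkovChain M hiding (probability)

    possible-from : ∀ n i → ∃ λ s → length s ≡ n × 0# < foldr _*_ 1# (map (λ (j , k) → p j k) (transitions (i ∷ s)))
    possible-from zero    i = [] , ≡.refl , 0<1
    possible-from (suc n) i with positive-of-sum (p-nonneg i 𝟎) (p-nonneg i 𝟏) (p-sum i)
    ... | inj₁ 0<p = let s , len , 0<s = possible-from n 𝟎 in 𝟎 ∷ s , ≡.cong suc len , *-pos 0<p 0<s
    ... | inj₂ 0<p = let s , len , 0<s = possible-from n 𝟏 in 𝟏 ∷ s , ≡.cong suc len , *-pos 0<p 0<s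

    -- Every distribution has a positive entry, so a sequence can follow positive transitions only.
    -- Optimal sequences therefore have positive probability, and factors common to two paths may be
    -- cancelled.
    possible : ∀ n → ∃ λ s → HasLength n s × 0# < probability M s
    possible n with positive-of-sum (π-nonneg 𝟎) (π-nonneg 𝟏) π-sum
    ... | inj₁ 0<π = let s , len , 0<s = possible-from n 𝟎 in 𝟎 ∷ s , ≡.cong suc len , *-pos 0<π 0<s
    ... | inj₂ 0<π = let s , len , 0<s = possible-from n 𝟏 in 𝟏 ∷ s , ≡.cong suc len , *-pos 0<π 0<s

    module Optimal {n} s (path : PathFrom0 n s) (optimal : ViterbiPath n M s) where
      open TransitionMatrix (matrix M)

      0<π*monomial : 0# < π 𝟎 * monomial (counts s)
      0<π*monomial = let t , len , 0<t = possible n in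
        <-≤-trans 0<t (≤-respʳ-≈ (probability-path M s path) (proj₂ optimal t len))

      0<π : 0# < π 𝟎
      0<π = π-nonneg 𝟎 , λ 0≈π → proj₂ 0<π*monomial (sym (trans (*-congʳ (sym 0≈π)) (zeroˡ _)))

      0<monomial : 0# < monomial (counts s)
      0<monomial = monomial-nonneg (counts s) , λ 0≈m → proj₂ 0<π*monomial (sym (trans (*-congˡ (sym 0≈m)) (zeroʳ _)))

      monomial≤ : ∀ t → PathFrom0 n t → monomial (counts t) ≤ monomial (counts s)
      monomial≤ t path-t = *-cancelˡ-≤ 0<π (≤-respˡ-≈ (probability-path M t path-t)
        (≤-respʳ-≈ (probability-path M s path) (proj₂ optimal t (proj₁ path-t))))

      compare : ∀ u e f t → PathFrom0 n t → (∀ k → counts t k ≡ e k ℕ.+ u k) → (∀ k → counts s k ≡ f k ℕ.+ u k) → monomial e ≤ monomial f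
      compare u e f t path-t t≡ s≡ = monomial-cancel u e f (counts t) (counts s) t≡ s≡ 0<monomial (monomial≤ t path-t)

counts-0ᵏ10 : ∀ k → CountsAre (𝟎 ^ suc k ++ 𝟏 ∷ 𝟎 ∷ []) k 1 1 0
counts-0ᵏ10 zero    = countsAre λ { 0F → ≡.refl ; 1F → ≡.refl ; 2F → ≡.refl ; 3F → ≡.refl }
counts-0ᵏ10 (suc k) = countsAre λ { 0F → ≡.cong suc (at (counts-0ᵏ10 k) 0F) ; 1F → at (counts-0ᵏ10 k) 1F ; 2F → at (counts-0ᵏ10 k) 2F ; 3F → at (counts-0ᵏ10 k) 3F }
  where open CountsAre

counts-01ᵏ010 : ∀ k → CountsAre (𝟎 ∷ 𝟏 ^ suc k ++ 𝟎 ∷ 𝟏 ∷ 𝟎 ∷ []) 0 2 2 k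
counts-01ᵏ010 zero    = countsAre λ { 0F → ≡.refl ; 1F → ≡.refl ; 2F → ≡.refl ; 3F → ≡.refl }
counts-01ᵏ010 (suc k) = countsAre λ { 0F → at (counts-01ᵏ010 k) 0F ; 1F → at (counts-01ᵏ010 k) 1F ; 2F → at (counts-01ᵏ010 k) 2F ; 3F → ≡.cong suc (at (counts-01ᵏ010 k) 3F) }
  where open CountsAre

-- The vertices that are not Viterbi sequences.

module NotViterbi (em : ExcludedMiddle 0ℓ) (ℝ : CompleteOrderedField) where

  open CompleteOrderedField ℝ hiding (zero)
  open Over ℝ
  open OrderedField em ℝ
  open NullSets em ℝ using (flat⇒¬positive)
  open RingSolver ℝ
  open Monomials em ℝ
  open TransitionMatrix
  open CountsAre

  -- Both inequalities for 2w come from a row sum: 1 = u + v ≤ 2w and 2w ≤ w + z = 1. In the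
  -- applications u, v are the probabilities at one state and w, z those at the other.
  middle≈½ : ∀ {u v w z} → u + v ≈ 1# → w + z ≈ 1# → u ≤ w → v ≤ w → w ≤ z → w ≈ ½ × z ≈ ½
  middle≈½ {u} {v} {w} {z} u+v w+z u≤w v≤w w≤z = w≈½ , +-cancelˡ-≈ w (trans w+z (trans (sym ½+½≈1) (+-congʳ (sym w≈½))))
    where
    w+w≈1 : w + w ≈ 1#
    w+w≈1 = antisym (≤-respʳ-≈ w+z (+-mono-≤ ≤-refl w≤z)) (≤-respˡ-≈ u+v (+-mono-≤ u≤w v≤w))
    w≈½ : w ≈ ½
    w≈½ = trans (sym (½x+½x≈x w)) (trans (sym (distribˡ ½ w w)) (trans (*-congˡ w+w≈1) (*-identityʳ ½)))

  only : Fin 4 → ℕ → Vector ℕ 4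
  only 0F j = coordinates₄ j 0 0 0
  only 1F j = coordinates₄ 0 j 0 0
  only 2F j = coordinates₄ 0 0 j 0
  only 3F j = coordinates₄ 0 0 0 j

  monomial-only : ∀ T k j → monomial T (only k j) ≈ entry T k ↑ j
  monomial-only T 0F j = solve 1 (λ p → (p :* con (+ 1)) :* (con (+ 1) :* con (+ 1)) := p) refl (p₀₀ T ↑ j)
  monomial-only T 1F j = solve 1 (λ p → (con (+ 1) :* p) :* (con (+ 1) :* con (+ 1)) := p) refl (p₀₁ T ↑ j)
  monomial-only T 2F j = solve 1 (λ p → (con (+ 1) :* con (+ 1)) :* (p :* con (+ 1)) := p) refl (p₁₀ T ↑ j)
  monomial-only T 3F j = solve 1 (λ p → (con (+ 1) :* con (+ 1)) :* (con (+ 1) :* p) := p) refl (p₁₁ T ↑ j)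

  only-≤ : ∀ T k l → monomial T (only k 1) ≤ monomial T (only l 1) → entry T k ≤ entry T l
  only-≤ T k l le = ≤-respˡ-≈ (trans (monomial-only T k 1) (*-identityʳ _)) (≤-respʳ-≈ (trans (monomial-only T l 1) (*-identityʳ _)) le)

  monomial-01-10 : ∀ T → monomial T (coordinates₄ 0 1 1 0) ≈ p₀₁ T * p₁₀ T
  monomial-01-10 T = solve 2 (λ b c → (con (+ 1) :* (b :* con (+ 1))) :* ((c :* con (+ 1)) :* con (+ 1)) := b :* c) refl (p₀₁ T) (p₁₀ T)

  ↑2 : ∀ z → z ↑ 2 ≈ z * z
  ↑2 z = *-congˡ (*-identityʳ z)

  private
    in-unit : ∀ {y z} → 0# ≤ y → 0# ≤ z → y + z ≈ 1# → 0# ≤ y × y ≤ 1#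
    in-unit {y} 0≤y 0≤z eq = 0≤y , ≤-respʳ-≈ eq (≤-respˡ-≈ (+-identityʳ y) (+-mono-≤ ≤-refl 0≤z))

    ≋-bounds : ∀ {y z l u} → y ≈ z → l ≤ y × y ≤ u → l ≤ z × z ≤ u
    ≋-bounds eq (l≤y , y≤u) = ≤-respʳ-≈ eq l≤y , ≤-respˡ-≈ eq y≤u

  -- The sequence is a Viterbi path of every chain in its region, so the equation for `p 𝟎 𝟎` holds
  -- throughout the region and confines it to a flat box.
  ¬viterbi-by-p₀₀ : ∀ {n} s → (∀ M → ViterbiPath n M s → MarkovChain.p M 𝟎 𝟎 ≈ ½) → ¬ ViterbiSequence n s
  ¬viterbi-by-p₀₀ {n} s forced (M , positive , optimal) = flat⇒¬positive
    (record { lower = 0# Vector.∷ ½ Vector.∷ 0# Vector.∷ Vector.[] ; upper = 1# Vector.∷ ½ Vector.∷ 1# Vector.∷ Vector.[]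
            ; lower≤upper = λ { 0F → 0≤1 ; 1F → ≤-refl ; 2F → 0≤1 } })
    1F refl
    (λ v (M′ , coords , same) → let open MarkovChain M′
                                    p≈½ = forced M′ (Equivalence.to (same s) optimal) in λ where
      0F → ≋-bounds (coords 0F) (in-unit (π-nonneg 𝟎) (π-nonneg 𝟏) π-sum)
      1F → ≋-bounds (coords 1F) (≤-reflexive (sym p≈½) , ≤-reflexive p≈½)
      2F → ≋-bounds (coords 2F) (in-unit (p-nonneg 𝟏 𝟎) (p-nonneg 𝟏 𝟏) (p-sum 𝟏)))
    positive

  ¬viterbi-by-p₁₀ : ∀ {n} s → (∀ M → ViterbiPath n M s → MarkovChain.p M 𝟏 𝟎 ≈ ½) → ¬ ViterbiSequence n s
  ¬viterbi-by-p₁₀ {n} s forced (M , positive , optimal) = flat⇒¬positive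
    (record { lower = 0# Vector.∷ 0# Vector.∷ ½ Vector.∷ Vector.[] ; upper = 1# Vector.∷ 1# Vector.∷ ½ Vector.∷ Vector.[]
            ; lower≤upper = λ { 0F → 0≤1 ; 1F → 0≤1 ; 2F → ≤-refl } })
    2F refl
    (λ v (M′ , coords , same) → let open MarkovChain M′
                                    p≈½ = forced M′ (Equivalence.to (same s) optimal) in λ where
      0F → ≋-bounds (coords 0F) (in-unit (π-nonneg 𝟎) (π-nonneg 𝟏) π-sum)
      1F → ≋-bounds (coords 1F) (in-unit (p-nonneg 𝟎 𝟎) (p-nonneg 𝟎 𝟏) (p-sum 𝟎))
      2F → ≋-bounds (coords 2F) (≤-reflexive (sym p≈½) , ≤-reflexive p≈½))
    positive

  module Compare (M : MarkovChain) {n : ℕ} (s : List State) {s₀₀ s₀₁ s₁₀ s₁₁ : ℕ} (s-counts : CountsAre s s₀₀ s₀₁ s₁₀ s₁₁)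
                 (path : PathFrom0 n s) (optimal : ViterbiPath n M s) where

    open Optimal M s path optimal public
    T = matrix M

    -- The optimal s has counts f + u, so no path has counts e + u with e more probable than f.
    compared : ∀ u e f t {t₀₀ t₀₁ t₁₀ t₁₁} → CountsAre t t₀₀ t₀₁ t₁₀ t₁₁ → PathFrom0 n t →
      (∀ k → coordinates₄ t₀₀ t₀₁ t₁₀ t₁₁ k ≡ e k ℕ.+ u k) → (∀ k → coordinates₄ s₀₀ s₀₁ s₁₀ s₁₁ k ≡ f k ℕ.+ u k) →
      monomial T e ≤ monomial T f
    compared u e f t t-counts path-t t≡ s≡ = compare u e f t path-t
      (λ k → ≡.trans (at t-counts k) (t≡ k)) (λ k → ≡.trans (at s-counts k) (s≡ k))

    positive-entry : ∀ k {j} → coordinates₄ s₀₀ s₀₁ s₁₀ s₁₁ k ≡ suc j → 0# < entry T k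
    positive-entry k eq = <-≤-trans 0<monomial (monomial≤entry T (counts s) k (≡.trans (at s-counts k) eq))

  -- The competitors are 0ⁿ⁺¹, 01ⁿ and 0ⁿ⁻¹10. They show that both probabilities at state 1 are at
  -- most p₀₀, which in turn is at most p₀₁.
  module SequenceB (k : ℕ) where

    s = 𝟎 ^ (2 ℕ.+ k) ++ 𝟏 ∷ []

    path : PathFrom0 (2 ℕ.+ k) s
    path = ≡.trans (length-^-++ 𝟎 (2 ℕ.+ k) (𝟏 ∷ [])) (ℕ.+-comm (2 ℕ.+ k) 1) , ≡.refl

    module _ (M : MarkovChain) (optimal : ViterbiPath (2 ℕ.+ k) M s) where
      open Compare M s (counts-0ᵏ1 (suc k)) path optimal

      p₀₀≤p₀₁ : p₀₀ T ≤ p₀₁ T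
      p₀₀≤p₀₁ = only-≤ T 0F 1F (compared (only 0F (suc k)) (only 0F 1) (only 1F 1) (𝟎 ^ (3 ℕ.+ k)) (counts-0ᵏ (2 ℕ.+ k))
        (List.length-replicate (3 ℕ.+ k) , ≡.refl) (λ { 0F → ≡.refl ; 1F → ≡.refl ; 2F → ≡.refl ; 3F → ≡.refl }) (λ { 0F → ≡.refl ; 1F → ≡.refl ; 2F → ≡.refl ; 3F → ≡.refl }))

      p₁₁≤p₀₀ : p₁₁ T ≤ p₀₀ T
      p₁₁≤p₀₀ = ↑-cancel-≤ k (0≤p₀₀ T) (≤-respˡ-≈ (monomial-only T 3F (suc k)) (≤-respʳ-≈ (monomial-only T 0F (suc k))
        (compared (only 1F 1) (only 3F (suc k)) (only 0F (suc k)) (𝟎 ∷ 𝟏 ^ (2 ℕ.+ k)) (counts-01ᵏ (suc k))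
          (≡.cong suc (List.length-replicate (2 ℕ.+ k)) , ≡.refl)
          (λ { 0F → ≡.refl ; 1F → ≡.refl ; 2F → ≡.refl ; 3F → ≡.sym (ℕ.+-identityʳ (suc k)) })
          (λ { 0F → ≡.sym (ℕ.+-identityʳ (suc k)) ; 1F → ≡.refl ; 2F → ≡.refl ; 3F → ≡.refl }))))

      p₁₀≤p₀₀ : p₁₀ T ≤ p₀₀ T
      p₁₀≤p₀₀ = only-≤ T 2F 0F (compared (coordinates₄ k 1 0 0) (only 2F 1) (only 0F 1) (𝟎 ^ suc k ++ 𝟏 ∷ 𝟎 ∷ []) (counts-0ᵏ10 k)
        (≡.trans (length-^-++ 𝟎 (suc k) (𝟏 ∷ 𝟎 ∷ [])) (ℕ.+-comm (suc k) 2) , ≡.refl) (λ { 0F → ≡.refl ; 1F → ≡.refl ; 2F → ≡.refl ; 3F → ≡.refl }) (λ { 0F → ≡.refl ; 1F → ≡.refl ; 2F → ≡.refl ; 3F → ≡.refl }))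

      p₀₀≈½ : p₀₀ T ≈ ½
      p₀₀≈½ = proj₁ (middle≈½ (sum₁ T) (sum₀ T) p₁₀≤p₀₀ p₁₁≤p₀₀ p₀₀≤p₀₁)

    ¬viterbi : ¬ ViterbiSequence (2 ℕ.+ k) s
    ¬viterbi = ¬viterbi-by-p₀₀ s p₀₀≈½

  -- The competitors are 01ⁿ, 01ⁿ⁻³010 and 0ⁿ1. From p₁₁ ≤ p₁₀ and p₀₁ p₁₀ ≤ p₁₁² follows p₀₁ ≤ p₁₁,
  -- and p₁₀ ≤ p₀₀ by the row sums. The third comparison, p₀₀ⁿ⁻¹ ≤ p₁₀ p₁₁ⁿ⁻², then loses a factor
  -- p₀₀ and yields p₀₀ ≤ p₁₁, so that both probabilities at 0 are at most p₁₁ ≤ p₁₀.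
  module SequenceF (k : ℕ) where

    s = 𝟎 ∷ 𝟏 ^ (3 ℕ.+ k) ++ 𝟎 ∷ []

    path : PathFrom0 (4 ℕ.+ k) s
    path = ≡.cong suc (≡.trans (length-^-++ 𝟏 (3 ℕ.+ k) (𝟎 ∷ [])) (ℕ.+-comm (3 ℕ.+ k) 1)) , ≡.refl

    module _ (M : MarkovChain) (optimal : ViterbiPath (4 ℕ.+ k) M s) where
      open Compare M s (counts-01ᵏ0 (2 ℕ.+ k)) path optimal

      0<p₁₀ : 0# < p₁₀ T
      0<p₁₀ = positive-entry 2F ≡.refl

      0<p₁₁ : 0# < p₁₁ T
      0<p₁₁ = positive-entry 3F ≡.refl

      p₁₁≤p₁₀ : p₁₁ T ≤ p₁₀ T
      p₁₁≤p₁₀ = only-≤ T 3F 2F (compared (coordinates₄ 0 1 0 (2 ℕ.+ k)) (only 3F 1) (only 2F 1) (𝟎 ∷ 𝟏 ^ (4 ℕ.+ k)) (counts-01ᵏ (3 ℕ.+ k))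
        (≡.cong suc (List.length-replicate (4 ℕ.+ k)) , ≡.refl) (λ { 0F → ≡.refl ; 1F → ≡.refl ; 2F → ≡.refl ; 3F → ≡.refl }) (λ { 0F → ≡.refl ; 1F → ≡.refl ; 2F → ≡.refl ; 3F → ≡.refl }))

      p₀₁p₁₀≤p₁₁² : p₀₁ T * p₁₀ T ≤ p₁₁ T * p₁₁ T
      p₀₁p₁₀≤p₁₁² = ≤-respˡ-≈ (monomial-01-10 T) (≤-respʳ-≈ (trans (monomial-only T 3F 2) (↑2 (p₁₁ T)))
        (compared (coordinates₄ 0 1 1 k) (coordinates₄ 0 1 1 0) (only 3F 2) (𝟎 ∷ 𝟏 ^ suc k ++ 𝟎 ∷ 𝟏 ∷ 𝟎 ∷ []) (counts-01ᵏ010 k)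
          (≡.cong suc (≡.trans (length-^-++ 𝟏 (suc k) (𝟎 ∷ 𝟏 ∷ 𝟎 ∷ [])) (ℕ.+-comm (suc k) 3)) , ≡.refl) (λ { 0F → ≡.refl ; 1F → ≡.refl ; 2F → ≡.refl ; 3F → ≡.refl }) (λ { 0F → ≡.refl ; 1F → ≡.refl ; 2F → ≡.refl ; 3F → ≡.refl })))

      p₀₀³⁺ᵏ≤ : p₀₀ T ↑ (3 ℕ.+ k) ≤ p₁₀ T * p₁₁ T ↑ (2 ℕ.+ k)
      p₀₀³⁺ᵏ≤ = ≤-respˡ-≈ (monomial-only T 0F (3 ℕ.+ k)) (≤-respʳ-≈
        (solve 2 (λ c d → (con (+ 1) :* con (+ 1)) :* ((c :* con (+ 1)) :* d) := c :* d) refl (p₁₀ T) (p₁₁ T ↑ (2 ℕ.+ k)))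
        (compared (only 1F 1) (only 0F (3 ℕ.+ k)) (coordinates₄ 0 0 1 (2 ℕ.+ k)) (𝟎 ^ (4 ℕ.+ k) ++ 𝟏 ∷ []) (counts-0ᵏ1 (3 ℕ.+ k))
          (≡.trans (length-^-++ 𝟎 (4 ℕ.+ k) (𝟏 ∷ [])) (ℕ.+-comm (4 ℕ.+ k) 1) , ≡.refl)
          (λ { 0F → ≡.sym (ℕ.+-identityʳ (3 ℕ.+ k)) ; 1F → ≡.refl ; 2F → ≡.refl ; 3F → ≡.refl })
          (λ { 0F → ≡.refl ; 1F → ≡.refl ; 2F → ≡.refl ; 3F → ≡.sym (ℕ.+-identityʳ (2 ℕ.+ k)) })))

      p₀₁≤p₁₁ : p₀₁ T ≤ p₁₁ T
      p₀₁≤p₁₁ = *-cancelˡ-≤ 0<p₁₁ (≤-trans (≤-respˡ-≈ (*-comm (p₀₁ T) (p₁₁ T)) (*-monoˡ-≤ (0≤p₀₁ T) p₁₁≤p₁₀)) p₀₁p₁₀≤p₁₁²)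

      p₁₀≤p₀₀ : p₁₀ T ≤ p₀₀ T
      p₁₀≤p₀₀ = ≤-by-difference (0≤y-x p₀₁≤p₁₁) (begin
        p₀₀ T - p₁₀ T
          ≈⟨ solve 4 (λ a b c d → a :- c := ((a :+ b) :- (c :+ d)) :+ (d :- b)) refl (p₀₀ T) (p₀₁ T) (p₁₀ T) (p₁₁ T) ⟩
        ((p₀₀ T + p₀₁ T) - (p₁₀ T + p₁₁ T)) + (p₁₁ T - p₀₁ T)
          ≈⟨ +-congʳ (trans (+-cong (sum₀ T) (-‿cong (sum₁ T))) (-‿inverseʳ 1#)) ⟩
        0# + (p₁₁ T - p₀₁ T)
          ≈⟨ +-identityˡ _ ⟩
        p₁₁ T - p₀₁ T ∎)
        where open Relation.Binary.Reasoning.Setoid setoid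

      p₀₀≤p₁₁ : p₀₀ T ≤ p₁₁ T
      p₀₀≤p₁₁ = ↑-cancel-≤ (suc k) (0≤p₁₁ T) (*-cancelˡ-≤ (<-≤-trans 0<p₁₀ p₁₀≤p₀₀)
        (≤-trans p₀₀³⁺ᵏ≤ (*-monoʳ-≤ (↑-nonneg (2 ℕ.+ k) (0≤p₁₁ T)) p₁₀≤p₀₀)))

      p₁₀≈½ : p₁₀ T ≈ ½
      p₁₀≈½ = proj₂ (middle≈½ (sum₀ T) (trans (+-comm _ _) (sum₁ T)) p₀₀≤p₁₁ p₀₁≤p₁₁ p₁₁≤p₁₀)

    ¬viterbi : ¬ ViterbiSequence (4 ℕ.+ k) s
    ¬viterbi = ¬viterbi-by-p₁₀ s p₁₀≈½

  -- The competitors are E, D and 000(01)ᵐ⁻¹. The last replaces a round trip by two loops and gives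
  -- p₀₀² ≤ p₀₁ p₁₀ ≤ p₀₁ p₀₀; cancelling p₀₀, which is positive because the optimal sequence uses
  -- it, bounds it by p₀₁.
  module EvenSequenceC (r : ℕ) where

    n = 2 ℕ.* (2 ℕ.+ r)
    s = 𝟎 ∷ [01]^ (2 ℕ.+ r) ++ []

    s-counts : CountsAre s 1 (suc r ℕ.+ 1) (suc r ℕ.+ 0) 0
    s-counts = counts-0[01]ᵏ (suc r) [] (counts-[01]ᵏ (suc r) [] (countsAre (λ { 0F → ≡.refl ; 1F → ≡.refl ; 2F → ≡.refl ; 3F → ≡.refl })))

    length-[01] : ∀ t → length ([01]^ (2 ℕ.+ r) ++ t) ≡ n ℕ.+ length t
    length-[01] t = ≡.trans (length-[01]ᵏ (2 ℕ.+ r) t) (≡.cong (ℕ._+ length t) (ℕ.*-comm (2 ℕ.+ r) 2))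

    path : PathFrom0 n s
    path = ≡.cong suc (≡.trans (length-[01] []) (ℕ.+-identityʳ n)) , ≡.refl

    module _ (M : MarkovChain) (optimal : ViterbiPath n M s) where
      open Compare M s s-counts path optimal

      p₁₀≤p₀₀ : p₁₀ T ≤ p₀₀ T
      p₁₀≤p₀₀ = only-≤ T 2F 0F (compared (coordinates₄ 0 (suc r ℕ.+ 1) (suc r ℕ.+ 0) 0) (only 2F 1) (only 0F 1) ([01]^ (2 ℕ.+ r) ++ 𝟎 ∷ [])
        (counts-[01]ᵏ (suc r) (𝟎 ∷ []) (countsAre (λ { 0F → ≡.refl ; 1F → ≡.refl ; 2F → ≡.refl ; 3F → ≡.refl })))
        (≡.trans (length-[01] (𝟎 ∷ [])) (ℕ.+-comm n 1) , ≡.refl)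
        (λ { 0F → ≡.refl ; 1F → ≡.refl ; 2F → ℕ.+-suc (suc r) 0 ; 3F → ≡.refl }) (λ { 0F → ≡.refl ; 1F → ≡.refl ; 2F → ≡.refl ; 3F → ≡.refl }))

      p₁₁≤p₀₀ : p₁₁ T ≤ p₀₀ T
      p₁₁≤p₀₀ = only-≤ T 3F 0F (compared (coordinates₄ 0 (suc r ℕ.+ 1) (suc r ℕ.+ 0) 0) (only 3F 1) (only 0F 1) ([01]^ (2 ℕ.+ r) ++ 𝟏 ∷ [])
        (counts-[01]ᵏ (suc r) (𝟏 ∷ []) (countsAre (λ { 0F → ≡.refl ; 1F → ≡.refl ; 2F → ≡.refl ; 3F → ≡.refl })))
        (≡.trans (length-[01] (𝟏 ∷ [])) (ℕ.+-comm n 1) , ≡.refl) (λ { 0F → ≡.refl ; 1F → ≡.refl ; 2F → ≡.refl ; 3F → ≡.refl }) (λ { 0F → ≡.refl ; 1F → ≡.refl ; 2F → ≡.refl ; 3F → ≡.refl }))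

      p₀₀²≤p₀₁p₁₀ : p₀₀ T * p₀₀ T ≤ p₀₁ T * p₁₀ T
      p₀₀²≤p₀₁p₁₀ = ≤-respˡ-≈ (trans (monomial-only T 0F 2) (↑2 (p₀₀ T))) (≤-respʳ-≈ (monomial-01-10 T)
        (compared (coordinates₄ 1 (r ℕ.+ 1) (r ℕ.+ 0) 0) (only 0F 2) (coordinates₄ 0 1 1 0) (𝟎 ∷ 𝟎 ∷ 𝟎 ∷ [01]^ suc r ++ [])
          (countsAre λ { 0F → ≡.cong (2 ℕ.+_) (at tail-counts 0F) ; 1F → at tail-counts 1F ; 2F → at tail-counts 2F ; 3F → at tail-counts 3F })
          (≡.trans (≡.cong (3 ℕ.+_) (length-[01]ᵏ (suc r) [])) (≡.cong suc (identity r)) , ≡.refl) (λ { 0F → ≡.refl ; 1F → ≡.refl ; 2F → ≡.refl ; 3F → ≡.refl }) (λ { 0F → ≡.refl ; 1F → ≡.refl ; 2F → ≡.refl ; 3F → ≡.refl })))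
        where
        tail-counts : CountsAre (𝟎 ∷ [01]^ suc r ++ []) 1 (r ℕ.+ 1) (r ℕ.+ 0) 0
        tail-counts = counts-0[01]ᵏ r [] (counts-[01]ᵏ r [] (countsAre (λ { 0F → ≡.refl ; 1F → ≡.refl ; 2F → ≡.refl ; 3F → ≡.refl })))
        identity : ∀ r → 2 ℕ.+ (suc r ℕ.* 2 ℕ.+ 0) ≡ 2 ℕ.* (2 ℕ.+ r)
        identity = solve-∀

      p₀₀≤p₀₁ : p₀₀ T ≤ p₀₁ T
      p₀₀≤p₀₁ = *-cancelˡ-≤ (positive-entry 0F ≡.refl)
        (≤-respʳ-≈ (*-comm (p₀₁ T) (p₀₀ T)) (≤-trans p₀₀²≤p₀₁p₁₀ (*-monoˡ-≤ (0≤p₀₁ T) p₁₀≤p₀₀)))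

      p₀₀≈½ : p₀₀ T ≈ ½
      p₀₀≈½ = proj₁ (middle≈½ (sum₁ T) (sum₀ T) p₁₀≤p₀₀ p₁₁≤p₀₀ p₀₀≤p₀₁)

    ¬viterbi : ¬ ViterbiSequence n s
    ¬viterbi = ¬viterbi-by-p₀₀ s p₀₀≈½

  -- The argument for C and even n with the states exchanged: the single loop is now at 1, and the
  -- competitors are E, C and (01)ᵐ⁻¹1110.
  module OddSequenceD (r : ℕ) where

    n = 2 ℕ.* (2 ℕ.+ r) ℕ.+ 1
    s = [01]^ (2 ℕ.+ r) ++ 𝟏 ∷ 𝟎 ∷ []

    s-counts : CountsAre s 0 (suc r ℕ.+ 1) (suc r ℕ.+ 1) 1
    s-counts = counts-[01]ᵏ (suc r) (𝟏 ∷ 𝟎 ∷ []) (countsAre (λ { 0F → ≡.refl ; 1F → ≡.refl ; 2F → ≡.refl ; 3F → ≡.refl }))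

    path : PathFrom0 n s
    path = ≡.trans (length-[01]ᵏ (2 ℕ.+ r) (𝟏 ∷ 𝟎 ∷ [])) (identity r) , ≡.refl
      where
      identity : ∀ r → (2 ℕ.+ r) ℕ.* 2 ℕ.+ 2 ≡ suc (2 ℕ.* (2 ℕ.+ r) ℕ.+ 1)
      identity = solve-∀

    module _ (M : MarkovChain) (optimal : ViterbiPath n M s) where
      open Compare M s s-counts path optimal

      p₀₁≤p₁₁ : p₀₁ T ≤ p₁₁ T
      p₀₁≤p₁₁ = only-≤ T 1F 3F (compared (coordinates₄ 0 (suc r ℕ.+ 1) (suc r ℕ.+ 1) 0) (only 1F 1) (only 3F 1) ([01]^ (3 ℕ.+ r) ++ [])
        (counts-[01]ᵏ (2 ℕ.+ r) [] (countsAre (λ { 0F → ≡.refl ; 1F → ≡.refl ; 2F → ≡.refl ; 3F → ≡.refl })))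
        (≡.trans (length-[01]ᵏ (3 ℕ.+ r) []) (identity r) , ≡.refl)
        (λ { 0F → ≡.refl ; 1F → ≡.refl ; 2F → ≡.sym (ℕ.+-suc (suc r) 0) ; 3F → ≡.refl }) (λ { 0F → ≡.refl ; 1F → ≡.refl ; 2F → ≡.refl ; 3F → ≡.refl }))
        where
        identity : ∀ r → (3 ℕ.+ r) ℕ.* 2 ℕ.+ 0 ≡ suc (2 ℕ.* (2 ℕ.+ r) ℕ.+ 1)
        identity = solve-∀

      p₀₀≤p₁₁ : p₀₀ T ≤ p₁₁ T
      p₀₀≤p₁₁ = only-≤ T 0F 3F (compared (coordinates₄ 0 (suc r ℕ.+ 1) (suc r ℕ.+ 1) 0) (only 0F 1) (only 3F 1) (𝟎 ∷ [01]^ (2 ℕ.+ r) ++ 𝟎 ∷ [])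
        (counts-0[01]ᵏ (suc r) (𝟎 ∷ []) (counts-[01]ᵏ (suc r) (𝟎 ∷ []) (countsAre (λ { 0F → ≡.refl ; 1F → ≡.refl ; 2F → ≡.refl ; 3F → ≡.refl }))))
        (≡.cong suc (≡.trans (length-[01]ᵏ (2 ℕ.+ r) (𝟎 ∷ [])) (identity r)) , ≡.refl) (λ { 0F → ≡.refl ; 1F → ≡.refl ; 2F → ≡.refl ; 3F → ≡.refl }) (λ { 0F → ≡.refl ; 1F → ≡.refl ; 2F → ≡.refl ; 3F → ≡.refl }))
        where
        identity : ∀ r → (2 ℕ.+ r) ℕ.* 2 ℕ.+ 1 ≡ 2 ℕ.* (2 ℕ.+ r) ℕ.+ 1
        identity = solve-∀

      p₁₁²≤p₀₁p₁₀ : p₁₁ T * p₁₁ T ≤ p₀₁ T * p₁₀ T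
      p₁₁²≤p₀₁p₁₀ = ≤-respˡ-≈ (trans (monomial-only T 3F 2) (↑2 (p₁₁ T))) (≤-respʳ-≈ (monomial-01-10 T)
        (compared (coordinates₄ 0 (r ℕ.+ 1) (r ℕ.+ 1) 1) (only 3F 2) (coordinates₄ 0 1 1 0) ([01]^ suc r ++ 𝟏 ∷ 𝟏 ∷ 𝟏 ∷ 𝟎 ∷ [])
          (counts-[01]ᵏ r (𝟏 ∷ 𝟏 ∷ 𝟏 ∷ 𝟎 ∷ []) (countsAre (λ { 0F → ≡.refl ; 1F → ≡.refl ; 2F → ≡.refl ; 3F → ≡.refl })))
          (≡.trans (length-[01]ᵏ (suc r) (𝟏 ∷ 𝟏 ∷ 𝟏 ∷ 𝟎 ∷ [])) (identity r) , ≡.refl) (λ { 0F → ≡.refl ; 1F → ≡.refl ; 2F → ≡.refl ; 3F → ≡.refl }) (λ { 0F → ≡.refl ; 1F → ≡.refl ; 2F → ≡.refl ; 3F → ≡.refl })))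
        where
        identity : ∀ r → suc r ℕ.* 2 ℕ.+ 4 ≡ suc (2 ℕ.* (2 ℕ.+ r) ℕ.+ 1)
        identity = solve-∀

      p₁₁≤p₁₀ : p₁₁ T ≤ p₁₀ T
      p₁₁≤p₁₀ = *-cancelˡ-≤ (positive-entry 3F ≡.refl) (≤-trans p₁₁²≤p₀₁p₁₀ (*-monoʳ-≤ (0≤p₁₀ T) p₀₁≤p₁₁))

      p₁₀≈½ : p₁₀ T ≈ ½
      p₁₀≈½ = proj₂ (middle≈½ (sum₀ T) (trans (+-comm _ _) (sum₁ T)) p₀₀≤p₁₁ p₀₁≤p₁₁ p₁₁≤p₁₀)

    ¬viterbi : ¬ ViterbiSequence n s
    ¬viterbi = ¬viterbi-by-p₁₀ s p₁₀≈½

split-even : ∀ {t} j q → t ℕ.+ 2 ℕ.* j ≡ 2 ℕ.* q → ∃ λ v → v ℕ.+ j ≡ q × t ≡ 2 ℕ.* v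
split-even j q eq = let v , v+j≡q , t≡ = split-parity j q (≡.cong suc eq) in v , v+j≡q , ℕ.suc-injective t≡

-- The vertices that are Viterbi sequences.

module Viterbi (em : ExcludedMiddle 0ℓ) (ℝ : CompleteOrderedField) where

  open CompleteOrderedField ℝ hiding (zero)
  open Over ℝ
  open OrderedField em ℝ
  open PositiveBoxes em ℝ using (box-positive)
  open RingSolver ℝ
  open Monomials em ℝ
  open TransitionMatrix
  open CountsAre
  open MarkovChain using (probability)

  abstract
    -- 1/32, the unit of all margins and a lower bound for every transition that a winning sequence
    -- uses. The delicate cases need a loop probability z with z > 1/2 and z² < 1 - z, so between
    -- 1/2 and about 0.618, with some room because the step back is certain only up to 1/32. The
    -- interval from 17/32 to 18/32 fits.
    h : Carrier
    h = ½ * (½ * (½ * (½ * ½)))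

    0<h : 0# < h
    0<h = *-pos 0<½ (*-pos 0<½ (*-pos 0<½ (*-pos 0<½ 0<½)))

    32h≈1 : fromℤ (+ 32) * h ≈ 1#
    32h≈1 = begin
      fromℤ (+ 32) * h
        ≈⟨ solve 1 (λ p → con (+ 32) :* (p :* (p :* (p :* (p :* p)))) := (p :+ p) :* ((p :+ p) :* ((p :+ p) :* ((p :+ p) :* (p :+ p))))) refl ½ ⟩
      (½ + ½) * ((½ + ½) * ((½ + ½) * ((½ + ½) * (½ + ½))))
        ≈⟨ *-cong ½+½≈1 (*-cong ½+½≈1 (*-cong ½+½≈1 (*-cong ½+½≈1 ½+½≈1))) ⟩
      1# * (1# * (1# * (1# * 1#)))
        ≈⟨ solve 0 (con (+ 1) :* (con (+ 1) :* (con (+ 1) :* (con (+ 1) :* con (+ 1)))) := con (+ 1)) refl ⟩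
      1# ∎
      where open Relation.Binary.Reasoning.Setoid setoid

  0≤h : 0# ≤ h
  0≤h = proj₁ 0<h

  κ : ℕ → Carrier
  κ j = fromℤ (+ j) * h

  open Algebra.Properties.Semiring.Mult.TCOptimised semiring using (×ᵤ≈×; ×-homo-+; 1+×)

  κ-nonneg : ∀ j → 0# ≤ κ j
  κ-nonneg j = *-nonneg (≤-respʳ-≈ (×ᵤ≈× j 1#) (·-nonneg j 0≤1)) 0≤h

  κ-+ : ∀ j k → κ (j ℕ.+ k) ≈ κ j + κ k
  κ-+ j k = trans (*-congʳ (×-homo-+ 1# j k)) (distribʳ h _ _)

  complement : ∀ {y z} j k → j ℕ.+ k ≡ 32 → y + z ≈ 1# → z ≤ κ j → κ k ≤ y
  complement {y} {z} j k j+k≡32 y+z z≤ = ≤-by-difference (0≤y-x z≤) (begin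
    y - κ k                     ≈⟨ solve 3 (λ y z k → y :- k := (y :+ z) :- (k :+ z)) refl y z (κ k) ⟩
    (y + z) - (κ k + z)         ≈⟨ +-congʳ (trans y+z (trans (sym 32h≈1) (trans (reflexive (≡.cong κ (≡.sym j+k≡32))) (κ-+ j k)))) ⟩
    (κ j + κ k) - (κ k + z)     ≈⟨ solve 3 (λ j k z → (j :+ k) :- (k :+ z) := j :- z) refl (κ j) (κ k) z ⟩
    κ j - z                     ∎)
    where open Relation.Binary.Reasoning.Setoid setoid

  complement′ : ∀ {y z} j k → j ℕ.+ k ≡ 32 → y + z ≈ 1# → κ j ≤ z → y ≤ κ k
  complement′ {y} {z} j k j+k≡32 y+z ≤z = ≤-by-difference (0≤y-x ≤z) (begin
    κ k - y                     ≈⟨ solve 3 (λ y z k → k :- y := (k :+ z) :- (y :+ z)) refl y z (κ k) ⟩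
    (κ k + z) - (y + z)         ≈⟨ +-congˡ (-‿cong (trans y+z (trans (sym 32h≈1) (trans (reflexive (≡.cong κ (≡.sym j+k≡32))) (κ-+ j k))))) ⟩
    (κ k + z) - (κ j + κ k)     ≈⟨ solve 3 (λ j k z → (k :+ z) :- (j :+ k) := z :- j) refl (κ j) (κ k) z ⟩
    z - κ j                     ∎)
    where open Relation.Binary.Reasoning.Setoid setoid

  h<1 : h < 1#
  h<1 = <-by-difference 0<31h (trans (+-congʳ (sym 32h≈1)) (solve 1 (λ h → con (+ 32) :* h :- h := h :+ con (+ 30) :* h) refl h))
    where
    0<31h : 0# < h + κ 30
    0<31h = +-pos-nonneg 0<h (κ-nonneg 30)

  ↑-* : ∀ y z k → (y * z) ↑ k ≈ y ↑ k * z ↑ k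
  ↑-* y z k = Algebra.Properties.CommutativeMonoid.Mult.×-distrib-+ *-commutativeMonoid y z k

  ↑-double : ∀ z v → z ↑ (2 ℕ.* v) ≈ (z * z) ↑ v
  ↑-double z v = trans (↑-+ z v (v ℕ.+ 0)) (trans (*-congˡ (reflexive (≡.cong (z ↑_) (ℕ.+-identityʳ v)))) (sym (↑-* z z v)))

  module _ {g y} (0≤g : 0# ≤ g) (g<y : g < y) where

    0<y : 0# < y
    0<y = ≤-<-trans 0≤g g<y

    -- To be read with g the probability of two loops and y that of a round trip: all v pairs of
    -- loops are traded for the likelier trips.
    exchange-≤ : ∀ {N} j v → v ℕ.+ j ≡ N → y ↑ j * g ↑ v ≤ y ↑ N
    exchange-≤ j v ≡.refl = ≤-respʳ-≈ (trans (*-comm _ _) (sym (↑-+ y v j)))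
      (*-monoˡ-≤ (↑-nonneg j (proj₁ 0<y)) (↑-mono-≤ v 0≤g (proj₁ g<y)))

    exchange-< : ∀ {N} j v → suc v ℕ.+ j ≡ N → y ↑ j * g ↑ suc v < y ↑ N
    exchange-< j v ≡.refl = <-resp-≈ refl (trans (*-comm _ _) (sym (↑-+ y (suc v) j)))
        (*-monoˡ-< (↑-pos j 0<y) (↑-mono-< v 0≤g g<y))

  module _ (n : ℕ) where

    -- A winning sequence has monomial at least hⁿ, so one step of probability at most `tiny`
    -- already loses. Of the two additional factors h, one accounts for the initial probability of
    -- 0, the other makes the comparison strict.
    tiny : Carrier
    tiny = h ↑ (2 ℕ.+ n)

    0<tiny : 0# < tiny
    0<tiny = ↑-pos (2 ℕ.+ n) 0<h

    tiny≤h : tiny ≤ h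
    tiny≤h = ≤-respʳ-≈ (*-identityʳ h) (*-monoˡ-≤ 0≤h (↑≤1 (suc n) 0≤h (proj₁ h<1)))

    tiny≤κ1 : tiny ≤ κ 1
    tiny≤κ1 = ≤-respʳ-≈ (sym (*-identityˡ h)) tiny≤h

    tiny<h↑1+n : tiny < h ↑ suc n
    tiny<h↑1+n = <-resp-≈ (*-comm _ _) (*-identityʳ _) (*-monoˡ-< (↑-pos (suc n) 0<h) h<1)

    tiny<h↑n : tiny < h ↑ n
    tiny<h↑n = <-≤-trans tiny<h↑1+n (≤-respʳ-≈ (*-identityˡ _) (*-monoʳ-≤ (↑-nonneg n 0≤h) (proj₁ h<1)))

    1-tiny<1 : 1# - tiny < 1#
    1-tiny<1 = <-by-difference 0<tiny (solve 1 (λ t → con (+ 1) :- (con (+ 1) :- t) := t) refl tiny)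

    0≤1-tiny : 0# ≤ 1# - tiny
    0≤1-tiny = 0≤y-x (≤-trans tiny≤h (proj₁ h<1))

    large⇒≤tiny : ∀ {y z} → y + z ≈ 1# → 1# - tiny ≤ y → z ≤ tiny
    large⇒≤tiny {y} {z} y+z le = ≤-by-difference (0≤y-x le)
      (trans (solve 3 (λ y z t → t :- z := y :- ((y :+ z) :- t)) refl y z tiny) (+-congˡ (-‿cong (+-congʳ y+z))))

    ≤tiny⇒κ31 : ∀ {y z} → y + z ≈ 1# → z ≤ tiny → κ 31 ≤ y
    ≤tiny⇒κ31 y+z z≤ = complement 1 31 ≡.refl y+z (≤-trans z≤ tiny≤κ1)

    κ31⇒h : ∀ {y} → κ 31 ≤ y → h ≤ y
    κ31⇒h le = ≤-trans (≤-by-difference (κ-nonneg 30) (solve 1 (λ h → con (+ 31) :* h :- h := con (+ 30) :* h) refl h)) le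

    record Interval (lo hi : Carrier) : Set where
      field
        0≤lo  : 0# ≤ lo
        lo<hi : lo < hi
        hi≤1  : hi ≤ 1#

    Between : Carrier → Carrier → Carrier → Set
    Between lo hi y = lo ≤ y × y ≤ hi

    -- Inequivalent paths must lose strictly: then all chains of the box have the same Viterbi
    -- paths, and the box lies within a single region.
    Beaten : TransitionMatrix → Vector ℕ 4 → Vector ℕ 4 → Set
    Beaten T target v = (∀ k → v k ≡ target k) ⊎ monomial T v < monomial T target

    record Wins (T : TransitionMatrix) (target : Vector ℕ 4) : Set where
      field
        good : h ↑ n ≤ monomial T target
        best : ∀ {x₀₀ x₀₁ x₁₀ x₁₁} → Shape n x₀₀ x₀₁ x₁₀ x₁₁ → Beaten T target (coordinates₄ x₀₀ x₀₁ x₁₀ x₁₁)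

    -- If s beats all inequivalent paths for all p₀₀ and p₁₀ in two intervals,
    -- then it is optimal on a box of chains starting in 0 with probability near 1.
    module Dominant (s : List State) (path : PathFrom0 n s) (target : Vector ℕ 4) (s-counts : ∀ k → counts s k ≡ target k)
      {lo₀ hi₀ lo₁ hi₁ : Carrier} (I₀ : Interval lo₀ hi₀) (I₁ : Interval lo₁ hi₁)
      (wins : ∀ T → Between lo₀ hi₀ (p₀₀ T) → Between lo₁ hi₁ (p₁₀ T) → Wins T target)
      where

      open Wins
      open Interval

      low high : ℝ^ 3
      low  = (1# - tiny) Vector.∷ lo₀ Vector.∷ lo₁ Vector.∷ Vector.[]
      high = 1# Vector.∷ hi₀ Vector.∷ hi₁ Vector.∷ Vector.[]

      low<high : ∀ i → low i < high i
      low<high 0F = 1-tiny<1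
      low<high 1F = lo<hi I₀
      low<high 2F = lo<hi I₁

      InBox : ℝ^ 3 → Set
      InBox v = ∀ i → low i ≤ v i × v i ≤ high i

      chain : ∀ v → InBox v → MarkovChain
      chain v inBox = record
        { π = λ { 𝟎 → v 0F ; 𝟏 → 1# - v 0F }
        ; p = λ { 𝟎 𝟎 → v 1F ; 𝟎 𝟏 → 1# - v 1F ; 𝟏 𝟎 → v 2F ; 𝟏 𝟏 → 1# - v 2F }
        ; π-nonneg = λ { 𝟎 → ≤-trans 0≤1-tiny (proj₁ (inBox 0F)) ; 𝟏 → 0≤y-x (proj₂ (inBox 0F)) }
        ; p-nonneg = λ { 𝟎 𝟎 → ≤-trans (0≤lo I₀) (proj₁ (inBox 1F)) ; 𝟎 𝟏 → 0≤y-x (≤-trans (proj₂ (inBox 1F)) (hi≤1 I₀))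
                       ; 𝟏 𝟎 → ≤-trans (0≤lo I₁) (proj₁ (inBox 2F)) ; 𝟏 𝟏 → 0≤y-x (≤-trans (proj₂ (inBox 2F)) (hi≤1 I₁)) }
        ; π-sum = total-1 (v 0F)
        ; p-sum = λ { 𝟎 → total-1 (v 1F) ; 𝟏 → total-1 (v 2F) } }
        where
        total-1 : ∀ y → y + (1# - y) ≈ 1#
        total-1 = solve 1 (λ y → y :+ (con (+ 1) :- y) := con (+ 1)) refl

      Winner : List State → Set
      Winner t = HasLength n t × StartsWith0 t × SameCounts t s

      module _ (v : ℝ^ 3) (inBox : InBox v) where

        M = chain v inBox
        T = matrix M
        π₀ = v 0F

        κ31≤π₀ : κ 31 ≤ π₀
        κ31≤π₀ = ≤tiny⇒κ31 (MarkovChain.π-sum M) (large⇒≤tiny (MarkovChain.π-sum M) (proj₁ (inBox 0F)))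

        h≤π₀ : h ≤ π₀
        h≤π₀ = κ31⇒h κ31≤π₀

        probability-s : probability M s ≈ π₀ * monomial T target
        probability-s = trans (probability-path M s path) (*-congˡ (monomial-cong T {counts s} {target} s-counts))

        compare-with : ∀ t → HasLength n t → Winner t ⊎ probability M t < probability M s
        compare-with (𝟎 ∷ t) len with best (wins T (inBox 1F) (inBox 2F)) (pathShape (𝟎 ∷ t) (len , ≡.refl))
        ... | inj₁ same = inj₁ (len , ≡.refl , λ k → ≡.trans (same k) (≡.sym (s-counts k)))
        ... | inj₂ lt   = inj₂ (<-resp-≈ (sym (probability-path M (𝟎 ∷ t) (len , ≡.refl))) (sym probability-s)
                                  (*-monoˡ-< (<-≤-trans 0<h h≤π₀) lt))
        compare-with (𝟏 ∷ t) len = inj₂ (<-resp-≈ (sym (probability≈ M 𝟏 t)) (sym probability-s)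
          (≤-<-trans (≤-trans (≤-respʳ-≈ (*-identityʳ _) (*-monoˡ-≤ (MarkovChain.π-nonneg M 𝟏) (monomial≤1 T (counts (𝟏 ∷ t)))))
                              (large⇒≤tiny (MarkovChain.π-sum M) (proj₁ (inBox 0F))))
            (<-≤-trans tiny<h↑1+n (*-mono-≤ 0≤h h≤π₀ (↑-nonneg n 0≤h) (good (wins T (inBox 1F) (inBox 2F)))))))

        winner-probability : ∀ t → Winner t → probability M t ≈ probability M s
        winner-probability t (len , starts , same) = trans (probability-path M t (len , starts))
          (trans (*-congˡ (monomial-cong T {counts t} {counts s} same)) (sym (probability-path M s path)))

        optimal⇒winner : ∀ t → ViterbiPath n M t → Winner t
        optimal⇒winner t (len , optimal) = [ (λ win → win) , (λ lt → contradiction (optimal s (proj₁ path)) (<⇒≱ lt)) ]′ (compare-with t len)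

        winner⇒optimal : ∀ t → Winner t → ViterbiPath n M t
        winner⇒optimal t win = proj₁ win , λ t′ len → ≤-respʳ-≈ (sym (winner-probability t win))
          ([ (λ win′ → ≤-reflexive (winner-probability t′ win′)) , proj₁ ]′ (compare-with t′ len))

      viterbi : ViterbiSequence n s
      viterbi = chain low at-low ,
        box-positive low high low<high (λ v inBox → chain v inBox , (λ { 0F → refl ; 1F → refl ; 2F → refl }) , λ t →
          mk⇔ (λ opt → winner⇒optimal v inBox t (optimal⇒winner low at-low t opt))
              (λ opt → winner⇒optimal low at-low t (optimal⇒winner v inBox t opt))) ,
        winner⇒optimal low at-low s (proj₁ path , proj₂ path , λ _ → ≡.refl)
        where
        at-low : InBox low
        at-low i = ≤-refl , proj₁ (low<high i)

    unit : Interval 0# 1#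
    unit = record { 0≤lo = ≤-refl ; lo<hi = 0<1 ; hi≤1 = ≤-refl }

    near0 : Interval 0# tiny
    near0 = record { 0≤lo = ≤-refl ; lo<hi = 0<tiny ; hi≤1 = ≤-trans tiny≤h (proj₁ h<1) }

    near1 : Interval (1# - tiny) 1#
    near1 = record { 0≤lo = 0≤1-tiny ; lo<hi = 1-tiny<1 ; hi≤1 = ≤-refl }

    κ-interval : ∀ j → suc j ℕ.≤ 32 → Interval (κ j) (κ (suc j))
    κ-interval j j<32 = record { 0≤lo = κ-nonneg j ; lo<hi = κ<κ ; hi≤1 = ≤1 }
      where
      κ<κ : κ j < κ (suc j)
      κ<κ = <-by-difference 0<h (trans (+-congʳ (*-congʳ (1+× j 1#)))
        (solve 2 (λ f h → (con (+ 1) :+ f) :* h :- f :* h := h) refl (fromℤ (+ j)) h))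
      ≤1 : κ (suc j) ≤ 1#
      ≤1 = complement {1#} {0#} (32 ℕ.∸ suc j) (suc j) (ℕ.m∸n+n≡m j<32) (+-identityʳ 1#) (κ-nonneg (32 ℕ.∸ suc j))

    good-bound : ∀ T v → (v 0F ℕ.+ v 1F) ℕ.+ (v 2F ℕ.+ v 3F) ≡ n → (∀ k → v k ≡ 0 ⊎ h ≤ entry T k) → h ↑ n ≤ monomial T v
    good-bound T v size good = ≡.subst (λ l → h ↑ l ≤ monomial T v) size (monomial≥ T v 0≤h good)

    bad-loses : ∀ T w v k {j} → h ↑ n ≤ monomial T w → entry T k ≤ tiny → v k ≡ suc j → Beaten T w v
    bad-loses T w v k good bad eq = inj₂ (≤-<-trans (≤-trans (monomial≤entry T v k eq) bad) (<-≤-trans tiny<h↑n good))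

    viterbi-A : ViterbiSequence n (𝟎 ^ suc n)
    viterbi-A = Dominant.viterbi (𝟎 ^ suc n) (List.length-replicate (suc n) , ≡.refl) target (at (counts-0ᵏ n)) near1 unit
        λ T b₀ _ → record { good = good T b₀ ; best = best T b₀ }
      where
      target = coordinates₄ n 0 0 0
      module _ (T : TransitionMatrix) (b₀ : Between (1# - tiny) 1# (p₀₀ T)) where
        p₀₁≤tiny : p₀₁ T ≤ tiny
        p₀₁≤tiny = large⇒≤tiny (sum₀ T) (proj₁ b₀)
        good : h ↑ n ≤ monomial T target
        good = good-bound T target (≡.trans (ℕ.+-identityʳ _) (ℕ.+-identityʳ n)) λ where
          0F → inj₂ (κ31⇒h (≤tiny⇒κ31 (sum₀ T) p₀₁≤tiny))
          1F → inj₁ ≡.refl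
          2F → inj₁ ≡.refl
          3F → inj₁ ≡.refl
        best : ∀ {x₀₀ x₀₁ x₁₀ x₁₁} → Shape n x₀₀ x₀₁ x₁₀ x₁₁ → Beaten T target (coordinates₄ x₀₀ x₀₁ x₁₀ x₁₁)
        best stays         = inj₁ λ _ → ≡.refl
        best (returns j _) = bad-loses T target _ 1F good p₀₁≤tiny ≡.refl
        best (leaves j _)  = bad-loses T target _ 1F good p₀₁≤tiny ≡.refl

  viterbi-G : ∀ k → ViterbiSequence (suc k) (𝟎 ∷ 𝟏 ^ suc k)
  viterbi-G k = Dominant.viterbi n (𝟎 ∷ 𝟏 ^ suc k) (≡.cong suc (List.length-replicate (suc k)) , ≡.refl) target
      (at (counts-01ᵏ k)) (near0 n) (near0 n)
      λ T b₀ b₁ → record { good = good T b₀ b₁ ; best = best T b₀ b₁ }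
    where
    n = suc k
    target = coordinates₄ 0 1 0 k
    module _ (T : TransitionMatrix) (b₀ : Between n 0# (tiny n) (p₀₀ T)) (b₁ : Between n 0# (tiny n) (p₁₀ T)) where
      good : h ↑ n ≤ monomial T target
      good = good-bound n T target ≡.refl λ where
        0F → inj₁ ≡.refl
        1F → inj₂ (κ31⇒h n (≤tiny⇒κ31 n (trans (+-comm _ _) (sum₀ T)) (proj₂ b₀)))
        2F → inj₁ ≡.refl
        3F → inj₂ (κ31⇒h n (≤tiny⇒κ31 n (trans (+-comm _ _) (sum₁ T)) (proj₂ b₁)))
      best : ∀ {x₀₀ x₀₁ x₁₀ x₁₁} → Shape n x₀₀ x₀₁ x₁₀ x₁₁ → Beaten n T target (coordinates₄ x₀₀ x₀₁ x₁₀ x₁₁)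
      best stays                       = bad-loses n T target _ 0F good (proj₂ b₀) ≡.refl
      best (returns j _)               = bad-loses n T target _ 2F good (proj₂ b₁) ≡.refl
      best (leaves (suc j) _)          = bad-loses n T target _ 2F good (proj₂ b₁) ≡.refl
      best (leaves {suc a} zero _)     = bad-loses n T target _ 0F good (proj₂ b₀) ≡.refl
      best (leaves {zero} {b} zero eq) = inj₁ λ { 0F → ≡.refl ; 1F → ≡.refl ; 2F → ≡.refl
        ; 3F → ℕ.suc-injective (≡.trans (ℕ.+-comm 1 b) eq) }

  module Alternating (n : ℕ) (T : TransitionMatrix) (b₀ : Between n 0# (tiny n) (p₀₀ T)) (b₁ : Between n (1# - tiny n) 1# (p₁₀ T)) where

    p₁₁≤tiny : p₁₁ T ≤ tiny n
    p₁₁≤tiny = large⇒≤tiny n (sum₁ T) (proj₁ b₁)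

    good : ∀ j k → j ℕ.+ k ≡ n → h ↑ n ≤ monomial T (coordinates₄ 0 j k 0)
    good j k eq = good-bound n T (coordinates₄ 0 j k 0) (≡.trans (≡.cong (j ℕ.+_) (ℕ.+-identityʳ k)) eq) λ where
      0F → inj₁ ≡.refl
      1F → inj₂ (κ31⇒h n (≤tiny⇒κ31 n (trans (+-comm _ _) (sum₀ T)) (proj₂ b₀)))
      2F → inj₂ (κ31⇒h n (≤tiny⇒κ31 n (sum₁ T) p₁₁≤tiny))
      3F → inj₁ ≡.refl

  module EvenE (r : ℕ) where

    n = 2 ℕ.* (2 ℕ.+ r)
    s = [01]^ (2 ℕ.+ r) ++ 𝟎 ∷ []
    target = coordinates₄ 0 (2 ℕ.+ r) (2 ℕ.+ r) 0

    s-counts : ∀ k → counts s k ≡ target k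
    s-counts = countsAre⇒≡ target ≡.refl (counts-[01]ᵏ (suc r) (𝟎 ∷ []) (countsAre λ { 0F → ≡.refl ; 1F → ≡.refl ; 2F → ≡.refl ; 3F → ≡.refl }))
      ≡.refl (ℕ.+-comm (suc r) 1) (ℕ.+-comm (suc r) 1) ≡.refl

    path : PathFrom0 n s
    path = ≡.trans (length-[01]ᵏ (2 ℕ.+ r) (𝟎 ∷ [])) (≡.trans (ℕ.+-comm _ 1) (≡.cong suc (ℕ.*-comm (2 ℕ.+ r) 2))) , ≡.refl

    module _ (T : TransitionMatrix) (b₀ : Between n 0# (tiny n) (p₀₀ T)) (b₁ : Between n (1# - tiny n) 1# (p₁₀ T)) where
      open Alternating n T b₀ b₁ using (p₁₁≤tiny)

      good : h ↑ n ≤ monomial T target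
      good = Alternating.good n T b₀ b₁ (2 ℕ.+ r) (2 ℕ.+ r) (≡.cong ((2 ℕ.+ r) ℕ.+_) (≡.sym (ℕ.+-identityʳ (2 ℕ.+ r))))

      best : ∀ {x₀₀ x₀₁ x₁₀ x₁₁} → Shape n x₀₀ x₀₁ x₁₀ x₁₁ → Beaten n T target (coordinates₄ x₀₀ x₀₁ x₁₀ x₁₁)
      best stays                          = bad-loses n T target _ 0F good (proj₂ b₀) ≡.refl
      best (returns {suc _} _ _)          = bad-loses n T target _ 0F good (proj₂ b₀) ≡.refl
      best (returns {zero} {suc _} _ _)   = bad-loses n T target _ 3F good p₁₁≤tiny ≡.refl
      best (returns {zero} {zero} j eq)   = inj₁ λ { 0F → ≡.refl ; 1F → 1+j≡ ; 2F → 1+j≡ ; 3F → ≡.refl }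
        where
        identity : ∀ j → 2 ℕ.* suc j ≡ 2 ℕ.* j ℕ.+ 2
        identity = solve-∀
        1+j≡ : suc j ≡ 2 ℕ.+ r
        1+j≡ = ℕ.*-cancelˡ-≡ (suc j) (2 ℕ.+ r) 2 (≡.trans (identity j) eq)
      best (leaves {suc _} _ _)           = bad-loses n T target _ 0F good (proj₂ b₀) ≡.refl
      best (leaves {zero} {suc _} _ _)    = bad-loses n T target _ 3F good p₁₁≤tiny ≡.refl
      best (leaves {zero} {zero} j eq)    = contradiction (≡.trans (≡.sym eq) (ℕ.+-comm (2 ℕ.* j) 1)) (ℕ.even≢odd (2 ℕ.+ r) j)

    viterbi : ViterbiSequence n s
    viterbi = Dominant.viterbi n s path target s-counts (near0 n) (near1 n) λ T b₀ b₁ → record { good = good T b₀ b₁ ; best = best T b₀ b₁ }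

  module OddE (r : ℕ) where

    n = 2 ℕ.* (2 ℕ.+ r) ℕ.+ 1
    s = [01]^ (3 ℕ.+ r) ++ []
    target = coordinates₄ 0 (3 ℕ.+ r) (2 ℕ.+ r) 0

    s-counts : ∀ k → counts s k ≡ target k
    s-counts = countsAre⇒≡ target ≡.refl (counts-[01]ᵏ (2 ℕ.+ r) [] (countsAre λ { 0F → ≡.refl ; 1F → ≡.refl ; 2F → ≡.refl ; 3F → ≡.refl }))
      ≡.refl (ℕ.+-comm (2 ℕ.+ r) 1) (ℕ.+-identityʳ (2 ℕ.+ r)) ≡.refl

    path : PathFrom0 n s
    path = ≡.trans (length-[01]ᵏ (3 ℕ.+ r) []) (identity r) , ≡.refl
      where
      identity : ∀ r → (3 ℕ.+ r) ℕ.* 2 ℕ.+ 0 ≡ suc (2 ℕ.* (2 ℕ.+ r) ℕ.+ 1)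
      identity = solve-∀

    module _ (T : TransitionMatrix) (b₀ : Between n 0# (tiny n) (p₀₀ T)) (b₁ : Between n (1# - tiny n) 1# (p₁₀ T)) where
      open Alternating n T b₀ b₁ using (p₁₁≤tiny)

      good : h ↑ n ≤ monomial T target
      good = Alternating.good n T b₀ b₁ (3 ℕ.+ r) (2 ℕ.+ r) (identity r)
        where
        identity : ∀ r → (3 ℕ.+ r) ℕ.+ (2 ℕ.+ r) ≡ 2 ℕ.* (2 ℕ.+ r) ℕ.+ 1
        identity = solve-∀

      best : ∀ {x₀₀ x₀₁ x₁₀ x₁₁} → Shape n x₀₀ x₀₁ x₁₀ x₁₁ → Beaten n T target (coordinates₄ x₀₀ x₀₁ x₁₀ x₁₁)
      best stays                          = bad-loses n T target _ 0F good (proj₂ b₀) ≡.refl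
      best (returns {suc _} _ _)          = bad-loses n T target _ 0F good (proj₂ b₀) ≡.refl
      best (returns {zero} {suc _} _ _)   = bad-loses n T target _ 3F good p₁₁≤tiny ≡.refl
      best (returns {zero} {zero} j eq)   = contradiction (≡.trans (identity j) (≡.trans eq (ℕ.+-comm _ 1))) (ℕ.even≢odd (suc j) (2 ℕ.+ r))
        where
        identity : ∀ j → 2 ℕ.* suc j ≡ 2 ℕ.* j ℕ.+ 2
        identity = solve-∀
      best (leaves {suc _} _ _)           = bad-loses n T target _ 0F good (proj₂ b₀) ≡.refl
      best (leaves {zero} {suc _} _ _)    = bad-loses n T target _ 3F good p₁₁≤tiny ≡.refl
      best (leaves {zero} {zero} j eq)    = inj₁ λ { 0F → ≡.refl ; 1F → ≡.cong suc j≡ ; 2F → j≡ ; 3F → ≡.refl }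
        where
        j≡ : j ≡ 2 ℕ.+ r
        j≡ = ℕ.*-cancelˡ-≡ j (2 ℕ.+ r) 2 (ℕ.+-cancelʳ-≡ 1 _ _ eq)

    viterbi : ViterbiSequence n s
    viterbi = Dominant.viterbi n s path target s-counts (near0 n) (near1 n) λ T b₀ b₁ → record { good = good T b₀ b₁ ; best = best T b₀ b₁ }

  -- Since (18/32)² < (14/32)(31/32), a round trip is more likely than two loops.
  loop²<trip : ∀ {z b c} → 0# ≤ z → z ≤ κ 18 → κ 14 ≤ b → κ 31 ≤ c → z * z < b * c
  loop²<trip {z} {b} {c} 0≤z z≤ ≤b ≤c = ≤-<-trans (*-mono-≤ 0≤z z≤ 0≤z z≤)
    (<-≤-trans (<-by-difference (+-pos-nonneg (*-pos 0<h 0<h) (*-nonneg (κ-nonneg 109) 0≤h))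
        (solve 1 (λ h → (con (+ 14) :* h) :* (con (+ 31) :* h) :- (con (+ 18) :* h) :* (con (+ 18) :* h) := h :* h :+ (con (+ 109) :* h) :* h) refl h))
      (*-mono-≤ (κ-nonneg 14) ≤b (κ-nonneg 31) ≤c))

  κ15<κ17 : κ 15 < κ 17
  κ15<κ17 = <-by-difference (+-pos-nonneg 0<h 0≤h) (solve 1 (λ h → con (+ 17) :* h :- con (+ 15) :* h := h :+ h) refl h)

  h≤κ : ∀ j → h ≤ κ (suc j)
  h≤κ j = ≤-by-difference (κ-nonneg j) (trans (+-congʳ (*-congʳ (1+× j 1#)))
    (solve 2 (λ f h → (con (+ 1) :+ f) :* h :- h := f :* h) refl (fromℤ (+ j)) h))

  -- With p₀₀ at most `tiny`, only paths without loops at 0 compete. A `leaves` path has an odd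
  -- number of loops at 1, a `returns` path an even number. Trading pairs of loops for round trips
  -- leaves b d yʳ⁺¹ for the former, which is the target, against b c yʳ⁺¹ for the latter, and c < d
  -- decides.
  module EvenD (r : ℕ) where

    n = 2 ℕ.* (2 ℕ.+ r)
    s = [01]^ (2 ℕ.+ r) ++ 𝟏 ∷ []
    target = coordinates₄ 0 (2 ℕ.+ r) (1 ℕ.+ r) 1

    s-counts : ∀ k → counts s k ≡ target k
    s-counts = countsAre⇒≡ target ≡.refl (counts-[01]ᵏ (suc r) (𝟏 ∷ []) (countsAre λ { 0F → ≡.refl ; 1F → ≡.refl ; 2F → ≡.refl ; 3F → ≡.refl }))
      ≡.refl (ℕ.+-comm (suc r) 1) (ℕ.+-identityʳ (suc r)) ≡.refl

    path : PathFrom0 n s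
    path = ≡.trans (length-[01]ᵏ (2 ℕ.+ r) (𝟏 ∷ [])) (≡.trans (ℕ.+-comm _ 1) (≡.cong suc (ℕ.*-comm (2 ℕ.+ r) 2))) , ≡.refl

    module _ (T : TransitionMatrix) (b₀ : Between n 0# (tiny n) (p₀₀ T)) (b₁ : Between n (κ 14) (κ 15) (p₁₀ T)) where

      b c d y : Carrier
      b = p₀₁ T
      c = p₁₀ T
      d = p₁₁ T
      y = b * c

      κ31≤b : κ 31 ≤ b
      κ31≤b = ≤tiny⇒κ31 n (trans (+-comm _ _) (sum₀ T)) (proj₂ b₀)

      κ17≤d : κ 17 ≤ d
      κ17≤d = complement 15 17 ≡.refl (trans (+-comm _ _) (sum₁ T)) (proj₂ b₁)

      d²<y : d * d < y
      d²<y = <-resp-≈ refl (*-comm c b) (loop²<trip (0≤p₁₁ T) (complement′ 14 18 ≡.refl (trans (+-comm _ _) (sum₁ T)) (proj₁ b₁)) (proj₁ b₁) κ31≤b)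

      c<d : c < d
      c<d = ≤-<-trans (proj₂ b₁) (<-≤-trans κ15<κ17 κ17≤d)

      0≤d² : 0# ≤ d * d
      0≤d² = *-nonneg (0≤p₁₁ T) (0≤p₁₁ T)

      0<b : 0# < b
      0<b = <-≤-trans 0<h (≤-trans (h≤κ 30) κ31≤b)

      good : h ↑ n ≤ monomial T target
      good = good-bound n T target (identity r) λ where
          0F → inj₁ ≡.refl
          1F → inj₂ (≤-trans (h≤κ 30) κ31≤b)
          2F → inj₂ (≤-trans (h≤κ 13) (proj₁ b₁))
          3F → inj₂ (≤-trans (h≤κ 16) κ17≤d)
        where
        identity : ∀ r → (2 ℕ.+ r) ℕ.+ ((1 ℕ.+ r) ℕ.+ 1) ≡ 2 ℕ.* (2 ℕ.+ r)
        identity = solve-∀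

      target≈ : b * d * y ↑ (1 ℕ.+ r) ≈ monomial T target
      target≈ = trans (*-congˡ (↑-* b c (1 ℕ.+ r)))
        (solve 4 (λ b d b′ c′ → b :* d :* (b′ :* c′) := (con (+ 1) :* (b :* b′)) :* (c′ :* (d :* con (+ 1)))) refl b d (b ↑ (1 ℕ.+ r)) (c ↑ (1 ℕ.+ r)))

      leaves≈ : ∀ j v → b * d * (y ↑ j * (d * d) ↑ v) ≈ monomial T (coordinates₄ 0 (suc j) j (1 ℕ.+ 2 ℕ.* v))
      leaves≈ j v = trans (*-congˡ (*-cong (↑-* b c j) (sym (↑-double d v))))
        (solve 5 (λ b d b′ c′ d′ → b :* d :* (b′ :* c′ :* d′) := (con (+ 1) :* (b :* b′)) :* (c′ :* (d :* d′))) refl b d (b ↑ j) (c ↑ j) (d ↑ (2 ℕ.* v)))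

      returns≈ : ∀ j v → b * c * (y ↑ j * (d * d) ↑ v) ≈ monomial T (coordinates₄ 0 (suc j) (suc j) (2 ℕ.* v))
      returns≈ j v = trans (*-congˡ (*-cong (↑-* b c j) (sym (↑-double d v))))
        (solve 5 (λ b c b′ c′ d′ → b :* c :* (b′ :* c′ :* d′) := (con (+ 1) :* (b :* b′)) :* ((c :* c′) :* d′)) refl b c (b ↑ j) (c ↑ j) (d ↑ (2 ℕ.* v)))

      beaten-leaves : ∀ j v → v ℕ.+ j ≡ 1 ℕ.+ r → Beaten n T target (coordinates₄ 0 (suc j) j (1 ℕ.+ 2 ℕ.* v))
      beaten-leaves j zero    j≡ = inj₁ λ { 0F → ≡.refl ; 1F → ≡.cong suc j≡ ; 2F → j≡ ; 3F → ≡.refl }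
      beaten-leaves j (suc v) eq = inj₂ (<-resp-≈ (leaves≈ j (suc v)) target≈
        (*-monoˡ-< (*-pos 0<b (<-≤-trans 0<h (≤-trans (h≤κ 16) κ17≤d))) (exchange-< 0≤d² d²<y j v eq)))

      beaten-returns : ∀ j v → v ℕ.+ j ≡ 1 ℕ.+ r → Beaten n T target (coordinates₄ 0 (suc j) (suc j) (2 ℕ.* v))
      beaten-returns j v eq = inj₂ (<-resp-≈ (returns≈ j v) target≈ (≤-<-trans
        (*-monoˡ-≤ (*-nonneg (0≤p₀₁ T) (0≤p₁₀ T)) (exchange-≤ 0≤d² d²<y j v eq))
        (<-resp-≈ (*-comm _ _) (*-comm _ _) (*-monoˡ-< (↑-pos (1 ℕ.+ r) (0<y 0≤d² d²<y)) (*-monoˡ-< 0<b c<d)))))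

      best : ∀ {x₀₀ x₀₁ x₁₀ x₁₁} → Shape n x₀₀ x₀₁ x₁₀ x₁₁ → Beaten n T target (coordinates₄ x₀₀ x₀₁ x₁₀ x₁₁)
      best stays                     = bad-loses n T target _ 0F good (proj₂ b₀) ≡.refl
      best (returns {suc _} _ _)     = bad-loses n T target _ 0F good (proj₂ b₀) ≡.refl
      best (returns {zero} {b′} j eq) = ≡.subst (λ l → Beaten n T target (coordinates₄ 0 (suc j) (suc j) l)) (≡.sym (proj₂ (proj₂ split)))
          (beaten-returns j (proj₁ split) (proj₁ (proj₂ split)))
        where
        identity : ∀ r → 2 ℕ.* (2 ℕ.+ r) ≡ 2 ℕ.* (1 ℕ.+ r) ℕ.+ 2
        identity = solve-∀
        split = split-even {b′} j (1 ℕ.+ r) (ℕ.+-cancelʳ-≡ 2 _ _ (≡.trans (ℕ.+-assoc b′ (2 ℕ.* j) 2) (≡.trans eq (identity r))))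
      best (leaves {suc _} _ _)      = bad-loses n T target _ 0F good (proj₂ b₀) ≡.refl
      best (leaves {zero} {b′} j eq) = ≡.subst (λ l → Beaten n T target (coordinates₄ 0 (suc j) j l)) (≡.sym (proj₂ (proj₂ split)))
          (beaten-leaves j (proj₁ split) (proj₁ (proj₂ split)))
        where
        identity : ∀ r → 2 ℕ.* (2 ℕ.+ r) ≡ (1 ℕ.+ 2 ℕ.* (1 ℕ.+ r)) ℕ.+ 1
        identity = solve-∀
        split = split-parity {b′} j (1 ℕ.+ r) (ℕ.+-cancelʳ-≡ 1 _ _ (≡.trans (ℕ.+-assoc b′ (2 ℕ.* j) 1) (≡.trans eq (identity r))))

    viterbi : ViterbiSequence n s
    viterbi = Dominant.viterbi n s path target s-counts (near0 n) (κ-interval n 14 (ℕ.m≤m+n 15 17))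
      λ T b₀ b₁ → record { good = good T b₀ b₁ ; best = best T b₀ b₁ }

  -- The mirror situation: p₁₁ is at most `tiny`, only loops at 0 compete, and a `returns` path has
  -- an odd number of them. After the trade the target a yʳ⁺² meets b yʳ⁺², and b < a.
  module OddC (r : ℕ) where

    n = 2 ℕ.* (2 ℕ.+ r) ℕ.+ 1
    s = 𝟎 ∷ [01]^ (2 ℕ.+ r) ++ 𝟎 ∷ []
    target = coordinates₄ 1 (2 ℕ.+ r) (2 ℕ.+ r) 0

    s-counts : ∀ k → counts s k ≡ target k
    s-counts = countsAre⇒≡ target ≡.refl
      (counts-0[01]ᵏ (suc r) (𝟎 ∷ []) (counts-[01]ᵏ (suc r) (𝟎 ∷ []) (countsAre λ { 0F → ≡.refl ; 1F → ≡.refl ; 2F → ≡.refl ; 3F → ≡.refl })))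
      ≡.refl (ℕ.+-comm (suc r) 1) (ℕ.+-comm (suc r) 1) ≡.refl

    path : PathFrom0 n s
    path = ≡.cong suc (≡.trans (length-[01]ᵏ (2 ℕ.+ r) (𝟎 ∷ [])) (≡.cong (ℕ._+ 1) (ℕ.*-comm (2 ℕ.+ r) 2))) , ≡.refl

    module _ (T : TransitionMatrix) (b₀ : Between n (κ 17) (κ 18) (p₀₀ T)) (b₁ : Between n (1# - tiny n) 1# (p₁₀ T)) where

      a b c y : Carrier
      a = p₀₀ T
      b = p₀₁ T
      c = p₁₀ T
      y = b * c

      p₁₁≤tiny : p₁₁ T ≤ tiny n
      p₁₁≤tiny = large⇒≤tiny n (sum₁ T) (proj₁ b₁)

      κ31≤c : κ 31 ≤ c
      κ31≤c = ≤tiny⇒κ31 n (sum₁ T) p₁₁≤tiny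

      κ14≤b : κ 14 ≤ b
      κ14≤b = complement 18 14 ≡.refl (trans (+-comm _ _) (sum₀ T)) (proj₂ b₀)

      a²<y : a * a < y
      a²<y = loop²<trip (0≤p₀₀ T) (proj₂ b₀) κ14≤b κ31≤c

      b<a : b < a
      b<a = ≤-<-trans (complement′ 17 15 ≡.refl (trans (+-comm _ _) (sum₀ T)) (proj₁ b₀)) (<-≤-trans κ15<κ17 (proj₁ b₀))

      0≤a² : 0# ≤ a * a
      0≤a² = *-nonneg (0≤p₀₀ T) (0≤p₀₀ T)

      0<a : 0# < a
      0<a = <-≤-trans 0<h (≤-trans (h≤κ 16) (proj₁ b₀))

      good : h ↑ n ≤ monomial T target
      good = good-bound n T target (identity r) λ where
          0F → inj₂ (≤-trans (h≤κ 16) (proj₁ b₀))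
          1F → inj₂ (≤-trans (h≤κ 13) κ14≤b)
          2F → inj₂ (≤-trans (h≤κ 30) κ31≤c)
          3F → inj₁ ≡.refl
        where
        identity : ∀ r → (1 ℕ.+ (2 ℕ.+ r)) ℕ.+ ((2 ℕ.+ r) ℕ.+ 0) ≡ 2 ℕ.* (2 ℕ.+ r) ℕ.+ 1
        identity = solve-∀

      returns≈ : ∀ j v → a * (y ↑ j * (a * a) ↑ v) ≈ monomial T (coordinates₄ (1 ℕ.+ 2 ℕ.* v) j j 0)
      returns≈ j v = trans (*-congˡ (*-cong (↑-* b c j) (sym (↑-double a v))))
        (solve 4 (λ a b′ c′ a′ → a :* (b′ :* c′ :* a′) := (a :* a′ :* b′) :* (c′ :* con (+ 1))) refl a (b ↑ j) (c ↑ j) (a ↑ (2 ℕ.* v)))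

      target≈ : a * y ↑ (2 ℕ.+ r) ≈ monomial T target
      target≈ = trans (*-congˡ (sym (*-identityʳ _))) (returns≈ (2 ℕ.+ r) 0)

      leaves≈ : ∀ j v → b * (y ↑ j * (a * a) ↑ v) ≈ monomial T (coordinates₄ (2 ℕ.* v) (suc j) j 0)
      leaves≈ j v = trans (*-congˡ (*-cong (↑-* b c j) (sym (↑-double a v))))
        (solve 4 (λ b b′ c′ a′ → b :* (b′ :* c′ :* a′) := (a′ :* (b :* b′)) :* (c′ :* con (+ 1))) refl b (b ↑ j) (c ↑ j) (a ↑ (2 ℕ.* v)))

      beaten-returns : ∀ j v → v ℕ.+ j ≡ 2 ℕ.+ r → Beaten n T target (coordinates₄ (1 ℕ.+ 2 ℕ.* v) j j 0)
      beaten-returns j zero    j≡ = inj₁ λ { 0F → ≡.refl ; 1F → j≡ ; 2F → j≡ ; 3F → ≡.refl }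
      beaten-returns j (suc v) eq = inj₂ (<-resp-≈ (returns≈ j (suc v)) target≈ (*-monoˡ-< 0<a (exchange-< 0≤a² a²<y j v eq)))

      beaten-leaves : ∀ j v → v ℕ.+ j ≡ 2 ℕ.+ r → Beaten n T target (coordinates₄ (2 ℕ.* v) (suc j) j 0)
      beaten-leaves j v eq = inj₂ (<-resp-≈ (leaves≈ j v) target≈ (≤-<-trans
        (*-monoˡ-≤ (0≤p₀₁ T) (exchange-≤ 0≤a² a²<y j v eq))
        (<-resp-≈ (*-comm _ _) (*-comm _ _) (*-monoˡ-< (↑-pos (2 ℕ.+ r) (0<y 0≤a² a²<y)) b<a))))

      best : ∀ {x₀₀ x₀₁ x₁₀ x₁₁} → Shape n x₀₀ x₀₁ x₁₀ x₁₁ → Beaten n T target (coordinates₄ x₀₀ x₀₁ x₁₀ x₁₁)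
      -- The constant path has no round trips and all its loops at 0, so it is the case j = 0 of the
      -- returning paths.
      best stays = ≡.subst (λ l → Beaten n T target (coordinates₄ l 0 0 0)) (ℕ.+-comm 1 (2 ℕ.* (2 ℕ.+ r)))
        (beaten-returns 0 (2 ℕ.+ r) (ℕ.+-identityʳ (2 ℕ.+ r)))
      best (returns {_} {suc _} _ _)   = bad-loses n T target _ 3F good p₁₁≤tiny ≡.refl
      best (returns {a′} {zero} j eq) = ≡.subst (λ l → Beaten n T target (coordinates₄ l (suc j) (suc j) 0)) (≡.sym (proj₂ (proj₂ split)))
          (beaten-returns (suc j) (proj₁ split) (proj₁ (proj₂ split)))
        where
        identity : ∀ a j → a ℕ.+ 2 ℕ.* suc j ≡ (a ℕ.+ 0) ℕ.+ (2 ℕ.* j ℕ.+ 2)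
        identity = solve-∀
        split = split-parity {a′} (suc j) (2 ℕ.+ r) (≡.trans (identity a′ j) (≡.trans eq (ℕ.+-comm _ 1)))
      best (leaves {_} {suc _} _ _)   = bad-loses n T target _ 3F good p₁₁≤tiny ≡.refl
      best (leaves {a′} {zero} j eq) = ≡.subst (λ l → Beaten n T target (coordinates₄ l (suc j) j 0)) (≡.sym (proj₂ (proj₂ split)))
          (beaten-leaves j (proj₁ split) (proj₁ (proj₂ split)))
        where
        identity : ∀ a j → a ℕ.+ 2 ℕ.* j ℕ.+ 1 ≡ (a ℕ.+ 0) ℕ.+ (2 ℕ.* j ℕ.+ 1)
        identity = solve-∀
        split = split-even {a′} j (2 ℕ.+ r) (ℕ.+-cancelʳ-≡ 1 _ _ (≡.trans (identity a′ j) eq))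

    viterbi : ViterbiSequence n s
    viterbi = Dominant.viterbi n s path target s-counts (κ-interval n 17 (ℕ.m≤m+n 18 14)) (near1 n)
      λ T b₀ b₁ → record { good = good T b₀ b₁ ; best = best T b₀ b₁ }

-- Assembly for both parities.

open import Data.Nat using (_+_; _*_; _<_; _∸_)

open Data.List.Membership.DecPropositional (Fin._≟_ {7}) using (_∈?_)

evenModel : ∀ r → Model (2 * (2 + r)) (evenSeq (2 + r))
evenModel r = record
  { table = evenTable ; valid = evenValid ; r = r ; size-eq = even-size r
  ; seq-path = even-path r ; seq-counts = even-counts r ; mean = even-mean r }

oddModel : ∀ r → Model (2 * (2 + r) + 1) (oddSeq (2 + r))
oddModel r = record
  { table = oddTable ; valid = oddValid ; r = r ; size-eq = odd-size r
  ; seq-path = odd-path r ; seq-counts = odd-counts r ; mean = odd-mean r }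

holds⇔ : ∀ {P Q : Set} → P → Q → P ⇔ Q
holds⇔ p q = mk⇔ (λ _ → q) (λ _ → p)

fails⇔ : ∀ {P Q : Set} → ¬ P → ¬ Q → P ⇔ Q
fails⇔ ¬p ¬q = mk⇔ (λ p → contradiction p ¬p) (λ q → contradiction q ¬q)

module _ (em : ExcludedMiddle 0ℓ) (ℝ : CompleteOrderedField) where

  open Over ℝ using (ViterbiSequence)
  open NotViterbi em ℝ
  open Viterbi em ℝ

  ¬viterbi-F : ∀ {n} k → n ≡ 4 + k → ¬ ViterbiSequence n (𝟎 ∷ 𝟏 ^ (n ∸ 1) ++ 𝟎 ∷ [])
  ¬viterbi-F k ≡.refl = SequenceF.¬viterbi k

  viterbi-even : ∀ r i → ViterbiSequence (2 * (2 + r)) (evenSeq (2 + r) i) ⇔ (i ∈ A ∷ D ∷ E ∷ G ∷ [])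
  viterbi-even r A = holds⇔ (≡.subst (λ l → ViterbiSequence n (𝟎 ^ l)) (ℕ.+-comm 1 n) (viterbi-A n)) (from-yes (A ∈? A ∷ D ∷ E ∷ G ∷ []))
    where n = 2 * (2 + r)
  viterbi-even r B = fails⇔ (SequenceB.¬viterbi (r + suc (suc (r + 0)))) (from-no (B ∈? A ∷ D ∷ E ∷ G ∷ []))
  viterbi-even r C = fails⇔ (λ v → EvenSequenceC.¬viterbi r
    (≡.subst (λ s → ViterbiSequence (2 * (2 + r)) (𝟎 ∷ s)) (≡.sym (List.++-identityʳ ([01]^ (2 + r)))) v)) (from-no (C ∈? A ∷ D ∷ E ∷ G ∷ []))
  viterbi-even r D = holds⇔ (EvenD.viterbi r) (from-yes (D ∈? A ∷ D ∷ E ∷ G ∷ []))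
  viterbi-even r E = holds⇔ (EvenE.viterbi r) (from-yes (E ∈? A ∷ D ∷ E ∷ G ∷ []))
  viterbi-even r F = fails⇔ (¬viterbi-F (2 * r) (identity r)) (from-no (F ∈? A ∷ D ∷ E ∷ G ∷ []))
    where
    identity : ∀ r → 2 * (2 + r) ≡ 4 + 2 * r
    identity = solve-∀
  viterbi-even r G = holds⇔ (viterbi-G (suc (r + suc (suc (r + 0))))) (from-yes (G ∈? A ∷ D ∷ E ∷ G ∷ []))

  viterbi-odd : ∀ r i → ViterbiSequence (2 * (2 + r) + 1) (oddSeq (2 + r) i) ⇔ (i ∈ A ∷ C ∷ E ∷ G ∷ [])
  viterbi-odd r A = holds⇔ (≡.subst (λ l → ViterbiSequence n (𝟎 ^ l)) (≡.sym (ℕ.+-suc (2 * (2 + r)) 1)) (viterbi-A n)) (from-yes (A ∈? A ∷ C ∷ E ∷ G ∷ []))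
    where n = 2 * (2 + r) + 1
  viterbi-odd r B = fails⇔ (SequenceB.¬viterbi (r + suc (suc (r + 0)) + 1)) (from-no (B ∈? A ∷ C ∷ E ∷ G ∷ []))
  viterbi-odd r C = holds⇔ (OddC.viterbi r) (from-yes (C ∈? A ∷ C ∷ E ∷ G ∷ []))
  viterbi-odd r D = fails⇔ (OddSequenceD.¬viterbi r) (from-no (D ∈? A ∷ C ∷ E ∷ G ∷ []))
  viterbi-odd r E = holds⇔ (≡.subst (ViterbiSequence (2 * (2 + r) + 1))
    (≡.trans (List.++-identityʳ ([01]^ (3 + r))) (≡.cong [01]^_ (ℕ.+-comm 1 (2 + r)))) (OddE.viterbi r)) (from-yes (E ∈? A ∷ C ∷ E ∷ G ∷ []))
  viterbi-odd r F = fails⇔ (λ v → ¬viterbi-F (1 + 2 * r) (identity r)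
    (≡.subst (λ l → ViterbiSequence (2 * (2 + r) + 1) (𝟎 ∷ 𝟏 ^ l ++ 𝟎 ∷ [])) (≡.sym (ℕ.m+n∸n≡m (2 * (2 + r)) 1)) v)) (from-no (F ∈? A ∷ C ∷ E ∷ G ∷ []))
    where
    identity : ∀ r → 2 * (2 + r) + 1 ≡ 4 + (1 + 2 * r)
    identity = solve-∀
  viterbi-odd r G = holds⇔ (viterbi-G (suc (r + suc (suc (r + 0)) + 1))) (from-yes (G ∈? A ∷ C ∷ E ∷ G ∷ []))

mainTheorem5 : ExcludedMiddle 0ℓ → (ℝ : CompleteOrderedField) → (n : ℕ) → 3 < n →
    ((m : ℕ) → n ≡ 2 * m →
    Over.SevenMinWeightSequences ℝ n (evenSeq m)
    × Over.PolytopeStructure ℝ n (evenSeq m)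
    × ((i : Fin 7) → Over.ViterbiSequence ℝ n (evenSeq m i) ⇔ (i ∈ A ∷ D ∷ E ∷ G ∷ [])))
    × ((m : ℕ) → n ≡ 2 * m + 1 →
    Over.SevenMinWeightSequences ℝ n (oddSeq m)
    × Over.PolytopeStructure ℝ n (oddSeq m)
    × ((i : Fin 7) → Over.ViterbiSequence ℝ n (oddSeq m i) ⇔ (i ∈ A ∷ C ∷ E ∷ G ∷ [])))
mainTheorem5 em ℝ n 3<n = (λ m n≡ → even m n≡ 3<n) , (λ m n≡ → odd m n≡ 3<n)
  where
  even : ∀ {n} m → n ≡ 2 * m → 3 < n →
    Over.SevenMinWeightSequences ℝ n (evenSeq m)
    × Over.PolytopeStructure ℝ n (evenSeq m)
    × ((i : Fin 7) → Over.ViterbiSequence ℝ n (evenSeq m i) ⇔ (i ∈ A ∷ D ∷ E ∷ G ∷ []))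
  even (suc zero)    ≡.refl (ℕ.s≤s (ℕ.s≤s ()))
  even (suc (suc r)) ≡.refl _ =
    MinWeight.sevenMinWeightSequences em ℝ (evenModel r) , Polytope.polytopeStructure em ℝ (evenModel r) , viterbi-even em ℝ r
  odd : ∀ {n} m → n ≡ 2 * m + 1 → 3 < n →
    Over.SevenMinWeightSequences ℝ n (oddSeq m)
    × Over.PolytopeStructure ℝ n (oddSeq m)
    × ((i : Fin 7) → Over.ViterbiSequence ℝ n (oddSeq m i) ⇔ (i ∈ A ∷ C ∷ E ∷ G ∷ []))
  odd zero          ≡.refl (ℕ.s≤s ())
  odd (suc zero)    ≡.refl (ℕ.s≤s (ℕ.s≤s (ℕ.s≤s ())))
  odd (suc (suc r)) ≡.refl _ =
    MinWeight.sevenMinWeightSequences em ℝ (oddModel r) , Polytope.polytopeStructure em ℝ (oddModel r) , viterbi-odd em ℝ r
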